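{- For $p\in(0,1)$, \[ f(K_3,p)=\Theta(p^{ -3/2}),\qquad f(K_4,p)=\Theta(p^{ -2}),\qquad f(K_5,p)=\Theta(p^{ -8/3}), \] with absolute implicit constants.
   Context: In the Subgraph Query Game with parameter $p\in(0,1)$, Builder plays alone on the random graph $G(\mathbb Z,p)$ with infinitely many vertices, whose edges are initially hidden. At each turn Builder queries (adaptively) one pair of vertices and is told whether it is an edge; equivalently, each queried edge is built successfully, independently, with probability $p$, and each pair may be queried at most once. For a graph $H$, $f(H,p)$ is the minimum, over all Builder strategies, of the number of turns needed to build a copy of $H$ with probability at least $\frac12$. -}

module Defs where

open import Algebra.Bundles using (AbelianGroup)
import Algebra.Properties.Group as GroupProperties
open import Data.Bool.Base using (Bool; true; false; T; if_then_else_)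
open import Data.Fin.Base using (Fin; toℕ)
open import Data.Fin.Properties using (toℕ-injective; all?)
  renaming (_≟_ to _≟ᶠ_)
open import Data.Integer.Base as ℤ using (ℤ; +_)
import Data.Integer.Properties as ℤ
open import Data.List.Base using (List; []; _∷_; _++_; map; concatMap; foldr; tabulate)
open import Data.List.Membership.Propositional using (_∈_; _∉_; find; lose)
open import Data.List.Membership.Propositional.Properties
  using (∈-++⁺ˡ; ∈-++⁺ʳ; ∈-concatMap⁺; ∈-tabulate⁺)
import Data.List.Membership.DecPropositional as DecMembership
open import Data.List.Relation.Unary.Any as Any using (Any; here; there; any?)
open import Data.Nat.Base as ℕ using (ℕ; zero; suc)
import Data.Nat.Properties as ℕ
open import Data.Product.Base using (∃; _×_; _,_; proj₁; proj₂)
open import Data.Rational.Base as ℚ using (ℚ; 0ℚ; 1ℚ; ½; ∣_∣)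
import Data.Rational.Properties as ℚ
open import Data.Rational.Solver using (module +-*-Solver)
open import Data.Sum.Base using (_⊎_; inj₁; inj₂; [_,_]′)
open import Data.Vec.Functional using () renaming (_∷_ to _∷ᵛ_; [] to []ᵛ)
open import Function.Base using (_∘_)
open import Function.Definitions using (Injective)
open import Relation.Nullary using (¬_; Dec; yes; no; contradiction)
open import Relation.Nullary.Decidable
  using (does; map′; ¬?; _×-dec_; _⊎-dec_; _→-dec_; T?)
open import Relation.Binary.Definitions using (Decidable)
open import Relation.Binary.PropositionalEquality
  using (_≡_; _≢_; refl; sym; trans; cong; subst; subst₂)

-- Reals as Cauchy sequences of rationals, considered up to _≈_ (below).
record ℝ : Set where
  constructor mkℝ
  field
    seq    : ℕ → ℚ
    cauchy : ∀ ε → 0ℚ ℚ.< ε →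
             ∃ λ N → ∀ m n → N ℕ.≤ m → N ℕ.≤ n → ∣ seq m ℚ.- seq n ∣ ℚ.≤ ε

open ℝ public

infix 4 _≈_ _≤_ _<_

_≈_ _≤_ _<_ : ℝ → ℝ → Set
x ≈ y = ∀ ε → 0ℚ ℚ.< ε → ∃ λ N → ∀ n → N ℕ.≤ n → ∣ seq x n ℚ.- seq y n ∣ ℚ.≤ ε
x ≤ y = ∀ ε → 0ℚ ℚ.< ε → ∃ λ N → ∀ n → N ℕ.≤ n → seq x n ℚ.≤ seq y n ℚ.+ ε
x < y = ∃ λ ε → 0ℚ ℚ.< ε × ∃ λ N → ∀ n → N ℕ.≤ n → seq x n ℚ.+ ε ℚ.≤ seq y n

private
  half : ∀ {ε} → 0ℚ ℚ.< ε → 0ℚ ℚ.< ½ ℚ.* ε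
  half {ε} 0<ε = ℚ.positive⁻¹ (½ ℚ.* ε) {{ℚ.pos*pos⇒pos ½ ε {{ℚ.positive 0<ε}}}}

  halves : ∀ ε → ½ ℚ.* ε ℚ.+ ½ ℚ.* ε ≡ ε
  halves ε = trans (sym (ℚ.*-distribʳ-+ ε ½ ½)) (ℚ.*-identityˡ ε)

  -- 1 + |a|, an upper bound for the terms of a sequence close to a
  bd : ℚ → ℚ
  bd a = 1ℚ ℚ.+ ∣ a ∣

  bd-pos : ∀ a → ℚ.Positive (bd a)
  bd-pos a = ℚ.pos+nonNeg⇒pos 1ℚ ∣ a ∣ {{ℚ.∣-∣-nonNeg a}}

  bounded : ∀ a b → ∣ a ℚ.- b ∣ ℚ.≤ 1ℚ → ∣ a ∣ ℚ.≤ bd b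
  bounded a b h = begin
    ∣ a ∣                     ≡⟨ cong ∣_∣ (solve 2 (λ a b → a := (a :- b) :+ b) refl a b) ⟩
    ∣ (a ℚ.- b) ℚ.+ b ∣       ≤⟨ ℚ.∣p+q∣≤∣p∣+∣q∣ (a ℚ.- b) b ⟩
    ∣ a ℚ.- b ∣ ℚ.+ ∣ b ∣     ≤⟨ ℚ.+-monoˡ-≤ ∣ b ∣ h ⟩
    1ℚ ℚ.+ ∣ b ∣              ∎
    where open ℚ.≤-Reasoning
          open +-*-Solver

  scaled : ∀ (A d ε : ℚ) .{{_ : ℚ.Positive A}} u →
           ∣ u ∣ ℚ.≤ A → ∣ d ∣ ℚ.≤ ε ℚ.* (ℚ.1/_ A {{ℚ.pos⇒nonZero A}}) →
           ∣ u ℚ.* d ∣ ℚ.≤ ε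
  scaled A d ε {{A>0}} u u≤A d≤ = begin
    ∣ u ℚ.* d ∣            ≡⟨ ℚ.∣p*q∣≡∣p∣*∣q∣ u d ⟩
    ∣ u ∣ ℚ.* ∣ d ∣        ≤⟨ ℚ.*-monoʳ-≤-nonNeg ∣ d ∣ {{ℚ.∣-∣-nonNeg d}} u≤A ⟩
    A ℚ.* ∣ d ∣            ≤⟨ ℚ.*-monoˡ-≤-nonNeg A {{ℚ.pos⇒nonNeg A}} d≤ ⟩
    A ℚ.* (ε ℚ.* A⁻¹)      ≡⟨ solve 3 (λ A ε i → A :* (ε :* i) := ε :* (A :* i)) refl A ε A⁻¹ ⟩
    ε ℚ.* (A ℚ.* A⁻¹)      ≡⟨ cong (ε ℚ.*_) (ℚ.*-inverseʳ A {{ℚ.pos⇒nonZero A}}) ⟩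
    ε ℚ.* 1ℚ               ≡⟨ ℚ.*-identityʳ ε ⟩
    ε                      ∎
    where open ℚ.≤-Reasoning
          open +-*-Solver
          A⁻¹ = ℚ.1/_ A {{ℚ.pos⇒nonZero A}}

  scale-pos : ∀ (A ε : ℚ) .{{_ : ℚ.Positive A}} → 0ℚ ℚ.< ε →
              0ℚ ℚ.< ε ℚ.* (ℚ.1/_ A {{ℚ.pos⇒nonZero A}})
  scale-pos A ε 0<ε =
    ℚ.positive⁻¹ _ {{ℚ.pos*pos⇒pos ε {{ℚ.positive 0<ε}} _ {{ℚ.1/pos⇒pos A}}}}

  0<1 : 0ℚ ℚ.< 1ℚ
  0<1 = ℚ.positive⁻¹ 1ℚ

  split : ∀ {ε} a b → ∣ a ∣ ℚ.≤ ½ ℚ.* ε → ∣ b ∣ ℚ.≤ ½ ℚ.* ε → ∣ a ℚ.+ b ∣ ℚ.≤ ε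
  split {ε} a b a≤ b≤ = ℚ.≤-trans (ℚ.∣p+q∣≤∣p∣+∣q∣ a b)
    (ℚ.≤-trans (ℚ.+-mono-≤ a≤ b≤) (ℚ.≤-reflexive (halves ε)))

infixl 6 _+_ _-_
infixl 7 _*_
infixr 8 _^_
infix  8 -_

fromℚ : ℚ → ℝ
fromℚ q = mkℝ (λ _ → q) λ ε 0<ε → 0 , λ _ _ _ _ →
  subst (λ r → ∣ r ∣ ℚ.≤ ε) (sym (ℚ.+-inverseʳ q)) (ℚ.<⇒≤ 0<ε)

fromℕ : ℕ → ℝ
fromℕ n = fromℚ (+ n ℚ./ 1)

0ℝ 1ℝ : ℝ
0ℝ = fromℚ 0ℚ
1ℝ = fromℚ 1ℚ

_+_ : ℝ → ℝ → ℝ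
x + y = mkℝ (λ n → seq x n ℚ.+ seq y n) λ ε 0<ε →
  let Nx , hx = cauchy x _ (half 0<ε)
      Ny , hy = cauchy y _ (half 0<ε)
  in Nx ℕ.⊔ Ny , λ m n m≥ n≥ →
    subst (λ r → ∣ r ∣ ℚ.≤ ε)
      (solve 4 (λ a b c d → (a :- b) :+ (c :- d) := (a :+ c) :- (b :+ d)) refl
        (seq x m) (seq x n) (seq y m) (seq y n))
      (split _ _ (hx m n (ℕ.m⊔n≤o⇒m≤o Nx Ny m≥) (ℕ.m⊔n≤o⇒m≤o Nx Ny n≥))
                 (hy m n (ℕ.m⊔n≤o⇒n≤o Nx Ny m≥) (ℕ.m⊔n≤o⇒n≤o Nx Ny n≥)))
  where open +-*-Solver

-_ : ℝ → ℝ
- x = mkℝ (λ n → ℚ.- seq x n) λ ε 0<ε →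
  let N , h = cauchy x ε 0<ε
  in N , λ m n m≥ n≥ →
    subst (λ r → ∣ r ∣ ℚ.≤ ε)
      (solve 2 (λ a b → b :- a := :- a :- :- b) refl (seq x m) (seq x n))
      (h n m n≥ m≥)
  where open +-*-Solver

_-_ : ℝ → ℝ → ℝ
x - y = x + (- y)

_*_ : ℝ → ℝ → ℝ
x * y = mkℝ (λ n → seq x n ℚ.* seq y n) λ ε 0<ε →
  let Mx , bx = cauchy x 1ℚ 0<1
      My , by = cauchy y 1ℚ 0<1
      A       = bd (seq x Mx)
      B       = bd (seq y My)
      instance
        A>0 : ℚ.Positive A
        A>0 = bd-pos (seq x Mx)
        B>0 : ℚ.Positive B
        B>0 = bd-pos (seq y My)
      Nx , hx = cauchy x _ (scale-pos B _ (half 0<ε))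
      Ny , hy = cauchy y _ (scale-pos A _ (half 0<ε))
      M       = Mx ℕ.⊔ My
      N       = Nx ℕ.⊔ Ny
  in M ℕ.⊔ N , λ m n m≥ n≥ →
    let M≤m = ℕ.m⊔n≤o⇒m≤o M N m≥
        N≤m = ℕ.m⊔n≤o⇒n≤o M N m≥
        M≤n = ℕ.m⊔n≤o⇒m≤o M N n≥
        N≤n = ℕ.m⊔n≤o⇒n≤o M N n≥
    in subst (λ r → ∣ r ∣ ℚ.≤ ε)
      (solve 4 (λ a b c d → a :* (c :- d) :+ d :* (a :- b) := a :* c :- b :* d) refl
        (seq x m) (seq x n) (seq y m) (seq y n))
      (split _ _
        (scaled A _ _ (seq x m)
          (bounded _ _ (bx m Mx (ℕ.m⊔n≤o⇒m≤o Mx My M≤m) ℕ.≤-refl))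
          (hy m n (ℕ.m⊔n≤o⇒n≤o Nx Ny N≤m) (ℕ.m⊔n≤o⇒n≤o Nx Ny N≤n)))
        (scaled B _ _ (seq y n)
          (bounded _ _ (by n My (ℕ.m⊔n≤o⇒n≤o Mx My M≤n) ℕ.≤-refl))
          (hx m n (ℕ.m⊔n≤o⇒m≤o Nx Ny N≤m) (ℕ.m⊔n≤o⇒m≤o Nx Ny N≤n))))
  where open +-*-Solver

_^_ : ℝ → ℕ → ℝ
x ^ zero  = 1ℝ
x ^ suc n = x * x ^ n

-- For x > 0 and b ≥ 1 there is exactly one such y up to _≈_, namely x^(-a/b).
_Is_^-_/_ : ℝ → ℝ → ℕ → ℕ → Set
y Is x ^- a / b = 0ℝ < y × y ^ b * x ^ a ≈ 1ℝ

record Graph : Set₁ where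
  field
    order : ℕ
    Adj   : Fin order → Fin order → Set
    adj?  : Decidable Adj
    symm  : ∀ {i j} → Adj i j → Adj j i
    irr   : ∀ {i} → ¬ Adj i i

open Graph public

K : ℕ → Graph
K n = record
  { order = n
  ; Adj   = _≢_
  ; adj?  = λ i j → ¬? (i ≟ᶠ j)
  ; symm  = λ i≢j → i≢j ∘ sym
  ; irr   = λ i≢i → i≢i refl
  }

-- An unordered pair of distinct vertices, listed in increasing order.
record Pair : Set where
  constructor mkPair
  field
    lo hi  : ℤ
    .lo<hi : lo ℤ.< hi

open Pair public using (lo; hi)

Joins : Pair → ℤ → ℤ → Set
Joins e u v = (lo e ≡ u × hi e ≡ v) ⊎ (lo e ≡ v × hi e ≡ u)

-- The queries made so far, latest first; `true` means that the pair is an edge.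
History : Set
History = List (Pair × Bool)

queried : History → List Pair
queried = map proj₁

Built : History → ℤ → ℤ → Set
Built h u v = Any (λ (e , b) → T b × Joins e u v) h

built? : ∀ h → Decidable (Built h)
built? h u v = any? (λ (e , b) → T? b ×-dec
  ((lo e ℤ.≟ u ×-dec hi e ℤ.≟ v) ⊎-dec (lo e ℤ.≟ v ×-dec hi e ℤ.≟ u))) h

IsCopy : (H : Graph) → History → (Fin (order H) → ℤ) → Set
IsCopy H h φ = Injective _≡_ _≡_ φ × (∀ i j → Adj H i j → Built h (φ i) (φ j))

ContainsCopy : Graph → History → Set
ContainsCopy H h = ∃ (IsCopy H h)

-- Containing a copy is decidable: it suffices to look for φ among the
-- endpoints of queried pairs together with `order H` further vertices,
-- the latter accommodating isolated vertices of H.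

private
  module Search (H : Graph) (h : History) where

    open DecMembership ℤ._≟_ using (_∈?_)
    open GroupProperties (AbelianGroup.group ℤ.+-0-abelianGroup) using (∙-cancelˡ)

    k : ℕ
    k = order H

    endpoints : List ℤ
    endpoints = concatMap (λ (e , _) → lo e ∷ hi e ∷ []) h

    top : List ℤ → ℤ
    top = foldr ℤ._⊔_ (+ 0)

    ∈⇒≤top : ∀ {x} xs → x ∈ xs → x ℤ.≤ top xs
    ∈⇒≤top (x ∷ xs) (here refl) = ℤ.i≤i⊔j x (top xs)
    ∈⇒≤top (x ∷ xs) (there p)   = ℤ.≤-trans (∈⇒≤top xs p) (ℤ.i≤j⊔i x (top xs))

    fresh : Fin k → ℤ
    fresh i = top endpoints ℤ.+ (+ suc (toℕ i))

    fresh-inj : ∀ {i j} → fresh i ≡ fresh j → i ≡ j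
    fresh-inj eq = toℕ-injective (ℕ.suc-injective (ℤ.+-injective (∙-cancelˡ (top endpoints) _ _ eq)))

    fresh∉ : ∀ i → fresh i ∉ endpoints
    fresh∉ i p = ℤ.<-irrefl refl (ℤ.<-≤-trans lt (∈⇒≤top endpoints p))
      where
      lt : top endpoints ℤ.< fresh i
      lt = subst (ℤ._< fresh i) (ℤ.+-identityʳ (top endpoints))
             (ℤ.+-monoʳ-< (top endpoints) (ℤ.+<+ (ℕ.s≤s ℕ.z≤n)))

    candidates : List ℤ
    candidates = endpoints ++ tabulate fresh

    move : (Fin k → ℤ) → Fin k → ℤ
    move φ i with φ i ∈? endpoints
    ... | yes _ = φ i
    ... | no  _ = fresh i

    move-∈ : ∀ φ i → move φ i ∈ candidates
    move-∈ φ i with φ i ∈? endpoints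
    ... | yes p = ∈-++⁺ˡ p
    ... | no  _ = ∈-++⁺ʳ endpoints (∈-tabulate⁺ i)

    move-inj : ∀ φ → Injective _≡_ _≡_ φ → Injective _≡_ _≡_ (move φ)
    move-inj φ inj {i} {j} eq with φ i ∈? endpoints | φ j ∈? endpoints
    ... | yes _ | yes _ = inj eq
    ... | yes p | no  _ = contradiction (subst (_∈ endpoints) eq p) (fresh∉ j)
    ... | no  _ | yes q = contradiction (subst (_∈ endpoints) (sym eq) q) (fresh∉ i)
    ... | no  _ | no  _ = fresh-inj eq

    move-fix : ∀ φ i → φ i ∈ endpoints → move φ i ≡ φ i
    move-fix φ i p with φ i ∈? endpoints
    ... | yes _ = refl
    ... | no ¬p = contradiction p ¬p

    built-sym : ∀ {u v} → Built h u v → Built h v u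
    built-sym = Any.map λ (t , js) → t , [ inj₂ , inj₁ ]′ js

    built-∈ : ∀ {u v} → Built h u v → u ∈ endpoints
    built-∈ {u} {v} b = ∈-concatMap⁺ _ (Any.map (λ {x} → end {u} {v} {x}) b)
      where
      end : ∀ {u v x} → T (proj₂ x) × Joins (proj₁ x) u v →
            u ∈ (lo (proj₁ x) ∷ hi (proj₁ x) ∷ [])
      end (_ , inj₁ (refl , _)) = here refl
      end (_ , inj₂ (_ , refl)) = there (here refl)

    move-copy : ∀ φ → IsCopy H h φ → IsCopy H h (move φ)
    move-copy φ (inj , bs) = move-inj φ inj , λ i j a →
      let b = bs i j a in
      subst₂ (Built h) (sym (move-fix φ i (built-∈ b)))
                       (sym (move-fix φ j (built-∈ (built-sym b)))) b

    isCopy? : ∀ φ → Dec (IsCopy H h φ)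
    isCopy? φ = inj? ×-dec all? λ i → all? λ j → adj? H i j →-dec built? h (φ i) (φ j)
      where
      inj? : Dec (Injective _≡_ _≡_ φ)
      inj? = map′ (λ f {i} {j} → f i j) (λ f i j → f)
               (all? λ i → all? λ j → (φ i ℤ.≟ φ j) →-dec (i ≟ᶠ j))

    copy-ext : ∀ φ ψ → (∀ i → φ i ≡ ψ i) → IsCopy H h φ → IsCopy H h ψ
    copy-ext φ ψ eq (inj , bs) =
      (λ {i} {j} e → inj (trans (eq i) (trans e (sym (eq j))))) ,
      λ i j a → subst₂ (Built h) (eq i) (eq j) (bs i j a)

    Ext : ∀ {n} → ((Fin n → ℤ) → Set) → Set
    Ext P = ∀ φ ψ → (∀ i → φ i ≡ ψ i) → P φ → P ψ

    ∷-ext : ∀ {n} x {φ ψ : Fin n → ℤ} → (∀ i → φ i ≡ ψ i) → ∀ i → (x ∷ᵛ φ) i ≡ (x ∷ᵛ ψ) i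
    ∷-ext x eq Fin.zero    = refl
    ∷-ext x eq (Fin.suc i) = eq i

    η : ∀ {n} (φ : Fin (suc n) → ℤ) i → φ i ≡ (φ Fin.zero ∷ᵛ (φ ∘ Fin.suc)) i
    η φ Fin.zero    = refl
    η φ (Fin.suc i) = refl

    search : ∀ n (P : (Fin n → ℤ) → Set) → Ext P → (∀ φ → Dec (P φ)) →
             Dec (∃ λ φ → (∀ i → φ i ∈ candidates) × P φ)
    search zero P ext P? =
      map′ (λ p → []ᵛ , (λ ()) , p) (λ (φ , _ , p) → ext φ []ᵛ (λ ()) p) (P? []ᵛ)
    search (suc n) P ext P? = map′ to from
      (any? (λ x → search n (λ φ → P (x ∷ᵛ φ))
                     (λ φ ψ eq → ext _ _ (∷-ext x eq)) (λ φ → P? (x ∷ᵛ φ)))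
            candidates)
      where
      Q : ℤ → Set
      Q x = ∃ λ φ → (∀ i → φ i ∈ candidates) × P (x ∷ᵛ φ)

      to : Any Q candidates → ∃ λ φ → (∀ i → φ i ∈ candidates) × P φ
      to a = let x , x∈ , φ , φ∈ , p = find a in
        (x ∷ᵛ φ) , (λ { Fin.zero → x∈ ; (Fin.suc i) → φ∈ i }) , p

      from : (∃ λ φ → (∀ i → φ i ∈ candidates) × P φ) → Any Q candidates
      from (φ , φ∈ , p) = lose (φ∈ Fin.zero)
        (φ ∘ Fin.suc , φ∈ ∘ Fin.suc , ext _ _ (η φ) p)

containsCopy? : ∀ H h → Dec (ContainsCopy H h)
containsCopy? H h = map′ (λ (φ , _ , c) → φ , c)
  (λ (φ , c) → move φ , move-∈ φ , move-copy φ c)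
  (search k (IsCopy H h) copy-ext isCopy?)
  where open Search H h

-- `Strategy h n` : adaptive strategies making at most n further queries after
-- the history h, given as decision trees; no pair is ever queried twice.
data Strategy (h : History) : ℕ → Set where
  stop  : ∀ {n} → Strategy h n
  query : ∀ {n} (e : Pair) → e ∉ queried h →
          (present : Strategy ((e , true)  ∷ h) n) →
          (absent  : Strategy ((e , false) ∷ h) n) →
          Strategy h (suc n)

-- The probability that the final built graph contains a copy of H, when each
-- queried pair is independently an edge with probability p.
successProb : Graph → ℝ → ∀ {h n} → Strategy h n → ℝ
successProb H p {h} stop = if does (containsCopy? H h) then 1ℝ else 0ℝ
successProb H p (query e _ present absent) =
  p * successProb H p present + (1ℝ - p) * successProb H p absent

-- n turns suffice to build a copy of H with probability at least 1/2.
Suffices : Graph → ℝ → ℕ → Set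
Suffices H p n = ∃ λ (σ : Strategy [] n) → fromℚ ½ ≤ successProb H p σ

-- f(H,p) is the least n with `Suffices H p n`. Selecting a least n would
-- require deciding inequalities between reals, so it is used through its
-- upper and lower bounds: min S ≤ r iff some n ∈ S has n ≤ r (in particular
-- S is nonempty), and r ≤ min S iff every n ∈ S has r ≤ n.
f[_,_]≤_ : Graph → ℝ → ℝ → Set
f[ H , p ]≤ r = ∃ λ n → Suffices H p n × fromℕ n ≤ r

_≤f[_,_] : ℝ → Graph → ℝ → Set
r ≤f[ H , p ] = ∀ n → Suffices H p n → r ≤ fromℕ n

-- f(H,p) = Θ(p^(-a/b)) for p ∈ (0,1), the constants c, C being uniform in p.
f[_,p]=Θ[p^-_/_] : Graph → ℕ → ℕ → Set
f[ H ,p]=Θ[p^- a / b ] =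
  ∃ λ c → ∃ λ C → 0ℝ < c × 0ℝ < C ×
    (∀ p → 0ℝ < p → p < 1ℝ → ∀ y → y Is p ^- a / b →
      (c * y) ≤f[ H , p ] × f[ H , p ]≤ (C * y))

{-# OPTIONS --safe #-}

-- Lower bounds.  Suppose a copy of K_m appears within N turns.  Pick s of its
-- edges that cover its vertices and guess their times (N^s possibilities).  Call
-- a query key if it is made at a guessed time or if both its ends are covered by
-- earlier guessed queries.  In the copy every key query succeeds, so if at least
-- k of them occur, the guess has probability at most p^k, because
-- p^(k − number of key queries so far), replaced by 0 after a failure, is a
-- supermartingale.  Hence the success probability is at most N^s p^k, and the
-- edges can be picked with (s, k) = (2, 3), (2, 4), (3, 8) for m = 3, 4, 5: a cover
-- among the first 2, 4 or 5 edges of the copy, except that for m = 5 the first 5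
-- edges may miss a vertex v; then a perfect matching of the other vertices among
-- the first 4 edges, together with the first edge at v, will do.
--
-- Upper bounds.  Take a natural number t with p ≈ 1/t^b, so that p^(-a/b) ≈ t^a.
-- Build a large star at a vertex v; all further queries are made among its leaves.
-- For K_3 look for an edge there.  For K_4 look for a triangle: for each a in a
-- set of leaves search for an edge ab (b is then discarded), and for each such
-- edge search for a common neighbour c.  For K_5 repeatedly take a leaf w, collect
-- about t^2 neighbours of w among the leaves, and look for a triangle there in the
-- same way; a round succeeds with probability of order p and there are about 1/p
-- rounds, each using new vertices so that no pair is ever queried twice.

module Submission where

open import Defs
open import Data.Product.Base using (_×_)
open import Data.Bool.Base using (true; false; if_then_else_)
open import Data.Empty using (⊥; ⊥-elim; ⊥-elim-irr)
open import Data.Fin.Base as Fin using (Fin)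
import Data.Fin.Properties as Fin
import Data.Integer.Base as ℤ
import Data.Integer.Properties as ℤ
open import Data.List.Base
  using (List; []; _∷_; _++_; map; length; lookup; take; drop; upTo; filter; allFin; cartesianProduct; cartesianProductWith)
open import Data.List.Membership.Propositional using (_∈_; _∉_; find; lose)
open import Data.List.Membership.Propositional.Properties
  using (∈-cartesianProductWith⁺; ∈-upTo⁺; ∈-filter⁺; ∈-filter⁻; ∈-∃++; ∈-++⁺ˡ; ∈-++⁺ʳ; ∈-++⁻;
         ∈-map⁺; ∈-map⁻; ∈-lookup)
import Data.List.Membership.DecPropositional as DecMembership
open import Data.List.Properties
  using (length-++; length-map; length-upTo; length-take; length-drop; take++drop≡id; ++-assoc)
open import Data.List.Relation.Binary.Permutation.Propositional
  using (_↭_; ↭-refl; ↭-sym; ↭-trans; ↭-prep; ↭-swap; ↭-reflexive; ↭⇒↭ₛ)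
open import Data.List.Relation.Binary.Permutation.Propositional.Properties
  using (∈-resp-↭; ↭-length; shift; shifts; ++⁺ˡ; ++⁺ʳ; ++-comm)
import Data.List.Relation.Binary.Permutation.Setoid.Properties as PermutationSetoid
open import Data.List.Relation.Unary.All as All using (All; []; _∷_)
open import Data.List.Relation.Unary.AllPairs as AllPairs using (AllPairs; []; _∷_; allPairs?)
open import Data.List.Relation.Unary.Any as Any using (Any; here; there; any?)
open import Data.List.Relation.Unary.Unique.Propositional using (Unique)
import Data.List.Relation.Unary.Unique.Propositional.Properties as Unique
open import Data.Maybe.Base as Maybe using (Maybe; just; nothing)
open import Data.Nat.Base as ℕ using (ℕ; zero; suc; _∸_)
import Data.Nat.Properties as ℕ
import Data.Nat.Solver as ℕ-Solver
open import Data.Product.Base using (∃; ∃₂; _,_; proj₁; proj₂)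
open import Data.Product.Properties using (≡-dec)
open import Data.Rational.Base as ℚ using (ℚ; 0ℚ; 1ℚ; ½)
import Data.Rational.Properties as ℚ
open import Data.Rational.Solver using (module +-*-Solver)
import Data.Rational.Unnormalised.Base as ℚᵘ
import Data.Rational.Unnormalised.Properties as ℚᵘ
open import Data.Sum.Base using (_⊎_; inj₁; inj₂)
open import Data.Unit.Base using (⊤; tt)
open import Function.Base using (_∘_; id; case_of_)
open import Function.Definitions using (Injective)
open import Relation.Binary.Definitions using (tri<; tri≈; tri>)
open import Relation.Binary.PropositionalEquality
open import Relation.Nullary using (¬_; Dec; yes; no; contradiction)
open import Relation.Nullary.Decidable
  using (does; _×-dec_; _⊎-dec_; _→-dec_; ¬?; from-yes; from-no; dec-true; dec-false)

-- Turn counts of the three strategies.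

suc≤2* : ∀ n → suc (suc n) ℕ.≤ 2 ℕ.* suc n
suc≤2* n = ℕ.s≤s (ℕ.≤-trans (ℕ.≤-reflexive (ℕ.+-comm 1 n)) (ℕ.+-monoʳ-≤ n (ℕ.s≤s ℕ.z≤n)))

module _ where

  open ℕ-Solver.+-*-Solver

  -- For K_5 the two steps towards a triangle succeed with chances at least 1/(2t) and 1/(2tm); this
  -- turns their product into 1/(`na` m), where `na` is 4t^2.
  product : ∀ t m → 2 ℕ.* t ℕ.* (2 ℕ.* (t ℕ.* m)) ≡ 4 ℕ.* (t ℕ.* t) ℕ.* m
  product = solve 2 (λ t m → con 2 :* t :* (con 2 :* (t :* m)) := con 4 :* (t :* t) :* m) refl

  -- The left side is the length of `Triangle.wins`: 12t^2 queries for each of the `na + t` leaves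
  -- of the star, then `na * t` queries for an edge among them.
  turns₃ : ∀ u → let t = suc u ; na = 3 ℕ.* (2 ℕ.* t) in
    (na ℕ.+ t) ℕ.* (6 ℕ.* (2 ℕ.* (t ℕ.* t))) ℕ.+ (na ℕ.* t ℕ.+ 0) ℕ.≤ 90 ℕ.* t ℕ.^ 3
  turns₃ u = ℕ.≤-trans
    -- The term of degree 2 is given an extra factor 1, which `1≤t` then raises to t.
    (ℕ.≤-reflexive (solve 1 (λ t → let na = con 3 :* (con 2 :* t) in
      (na :+ t) :* (con 6 :* (con 2 :* (t :* t))) :+ (na :* t :+ con 0)
        := con 84 :* t :^ 3 :+ con 6 :* (t :* t :* con 1)) refl t))
    (ℕ.≤-trans (ℕ.+-monoʳ-≤ (84 ℕ.* t ℕ.^ 3) (ℕ.*-monoʳ-≤ 6 (ℕ.*-monoʳ-≤ (t ℕ.* t) 1≤t)))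
      (ℕ.≤-reflexive (solve 1 (λ t → con 84 :* t :^ 3 :+ con 6 :* (t :* t :* t) := con 90 :* t :^ 3) refl t)))
    where
    t = suc u
    1≤t : 1 ℕ.≤ t
    1≤t = ℕ.s≤s ℕ.z≤n

  turns₄ : ∀ u → let t = suc u ; na = 3 ℕ.* (2 ℕ.* (2 ℕ.* t)) in
    (na ℕ.+ (t ℕ.+ (t ℕ.+ na))) ℕ.* (6 ℕ.* (2 ℕ.* t)) ℕ.+ (na ℕ.* (t ℕ.+ t ℕ.* 2) ℕ.+ 0) ℕ.≤ 348 ℕ.* t ℕ.^ 2
  turns₄ u = ℕ.≤-reflexive (solve 1 (λ t → let na = con 3 :* (con 2 :* (con 2 :* t)) in
    (na :+ (t :+ (t :+ na))) :* (con 6 :* (con 2 :* t)) :+ (na :* (t :+ t :* con 2) :+ con 0)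
      := con 348 :* t :^ 2) refl (suc u))

  -- The star accounts for 2880 t^8 and the rounds for 1440 t^8; the remaining terms have degrees 7
  -- and 6 and are raised to degree 8.
  turns₅ : ∀ u → let t = suc u ; s = t ℕ.* t ; m = s ℕ.* t ; na = 4 ℕ.* s ; k = na ℕ.+ (s ℕ.+ (s ℕ.+ na))
                     nw = 3 ℕ.* (2 ℕ.* (2 ℕ.* m)) ; trials = 6 ℕ.* (2 ℕ.* m) in
    (nw ℕ.+ (k ℕ.* trials ℕ.+ nw ℕ.* k)) ℕ.* trials ℕ.+ nw ℕ.* (k ℕ.* trials ℕ.+ na ℕ.* (s ℕ.+ s ℕ.* 2))
      ℕ.≤ 4608 ℕ.* t ℕ.^ 8
  turns₅ u = ℕ.≤-trans
    (ℕ.≤-reflexive (solve 1 (λ t →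
      let s = t :* t ; m = s :* t ; na = con 4 :* s ; k = na :+ (s :+ (s :+ na))
          nw = con 3 :* (con 2 :* (con 2 :* m)) ; trials = con 6 :* (con 2 :* m) in
      (nw :+ (k :* trials :+ nw :* k)) :* trials :+ nw :* (k :* trials :+ na :* (s :+ s :* con 2))
        := (con 4320 :* t :^ 8 :+ con 144 :* t :^ 7 :* con 1) :+ con 144 :* t :^ 6 :* (con 1 :* con 1)) refl t))
    (ℕ.≤-trans (ℕ.+-mono-≤ (ℕ.+-monoʳ-≤ (4320 ℕ.* t ℕ.^ 8) (ℕ.*-monoʳ-≤ (144 ℕ.* t ℕ.^ 7) 1≤t))
                           (ℕ.*-monoʳ-≤ (144 ℕ.* t ℕ.^ 6) (ℕ.*-mono-≤ 1≤t 1≤t)))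
      (ℕ.≤-reflexive (solve 1 (λ t → (con 4320 :* t :^ 8 :+ con 144 :* t :^ 7 :* t) :+ con 144 :* t :^ 6 :* (t :* t)
        := con 4608 :* t :^ 8) refl t)))
    where
    t = suc u
    1≤t : 1 ℕ.≤ t
    1≤t = ℕ.s≤s ℕ.z≤n

open +-*-Solver using (solve; _:+_; _:*_; _:-_; :-_; _:=_; con)

-- Rational arithmetic

infixr 8 _^ℚ_

_^ℚ_ : ℚ → ℕ → ℚ
x ^ℚ zero  = 1ℚ
x ^ℚ suc n = x ℚ.* x ^ℚ n

0≤1 : 0ℚ ℚ.≤ 1ℚ
0≤1 = from-yes (0ℚ ℚ.≤? 1ℚ)

*-monoˡ : ∀ {x y} z → 0ℚ ℚ.≤ z → x ℚ.≤ y → z ℚ.* x ℚ.≤ z ℚ.* y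
*-monoˡ z 0≤z = ℚ.*-monoˡ-≤-nonNeg z {{ℚ.nonNegative 0≤z}}

*-monoʳ : ∀ {x y} z → 0ℚ ℚ.≤ z → x ℚ.≤ y → x ℚ.* z ℚ.≤ y ℚ.* z
*-monoʳ z 0≤z = ℚ.*-monoʳ-≤-nonNeg z {{ℚ.nonNegative 0≤z}}

*-mono : ∀ {x y u v} → 0ℚ ℚ.≤ x → x ℚ.≤ y → 0ℚ ℚ.≤ u → u ℚ.≤ v → x ℚ.* u ℚ.≤ y ℚ.* v
*-mono {y = y} {u} 0≤x x≤y 0≤u u≤v =
  ℚ.≤-trans (*-monoʳ u 0≤u x≤y) (*-monoˡ y (ℚ.≤-trans 0≤x x≤y) u≤v)

0≤* : ∀ {x y} → 0ℚ ℚ.≤ x → 0ℚ ℚ.≤ y → 0ℚ ℚ.≤ x ℚ.* y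
0≤* {x} 0≤x 0≤y = ℚ.≤-trans (ℚ.≤-reflexive (sym (ℚ.*-zeroʳ x))) (*-monoˡ x 0≤x 0≤y)

0≤^ : ∀ {x} n → 0ℚ ℚ.≤ x → 0ℚ ℚ.≤ x ^ℚ n
0≤^ zero    0≤x = 0≤1
0≤^ (suc n) 0≤x = 0≤* 0≤x (0≤^ n 0≤x)

^-mono : ∀ {x y} n → 0ℚ ℚ.≤ x → x ℚ.≤ y → x ^ℚ n ℚ.≤ y ^ℚ n
^-mono zero    0≤x x≤y = ℚ.≤-refl
^-mono (suc n) 0≤x x≤y = *-mono 0≤x x≤y (0≤^ n 0≤x) (^-mono n 0≤x x≤y)

^-distrib-* : ∀ x y n → (x ℚ.* y) ^ℚ n ≡ x ^ℚ n ℚ.* y ^ℚ n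
^-distrib-* x y zero    = refl
^-distrib-* x y (suc n) = trans (cong (x ℚ.* y ℚ.*_) (^-distrib-* x y n))
  (solve 4 (λ a b c d → a :* b :* (c :* d) := a :* c :* (b :* d)) refl x y (x ^ℚ n) (y ^ℚ n))

^-homo-+ : ∀ x m n → x ^ℚ (m ℕ.+ n) ≡ x ^ℚ m ℚ.* x ^ℚ n
^-homo-+ x zero    n = sym (ℚ.*-identityˡ _)
^-homo-+ x (suc m) n = trans (cong (x ℚ.*_) (^-homo-+ x m n)) (sym (ℚ.*-assoc x _ _))

^-*-assoc : ∀ x m n → x ^ℚ (m ℕ.* n) ≡ (x ^ℚ n) ^ℚ m
^-*-assoc x zero    n = refl
^-*-assoc x (suc m) n = trans (^-homo-+ x n (m ℕ.* n)) (cong (x ^ℚ n ℚ.*_) (^-*-assoc x m n))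

1^ : ∀ n → 1ℚ ^ℚ n ≡ 1ℚ
1^ zero    = refl
1^ (suc n) = trans (ℚ.*-identityˡ _) (1^ n)

0≤y-x : ∀ {x y} → x ℚ.≤ y → 0ℚ ℚ.≤ y ℚ.- x
0≤y-x {x} {y} x≤y = subst (ℚ._≤ y ℚ.- x) (ℚ.+-inverseʳ x) (ℚ.+-monoˡ-≤ (ℚ.- x) x≤y)

≤-from-diff : ∀ {x y} → 0ℚ ℚ.≤ y ℚ.- x → x ℚ.≤ y
≤-from-diff {x} {y} 0≤d = subst₂ ℚ._≤_ (ℚ.+-identityˡ x)
  (solve 2 (λ x y → (y :- x) :+ x := y) refl x y) (ℚ.+-monoˡ-≤ x 0≤d)

0≤+ : ∀ {x y} → 0ℚ ℚ.≤ x → 0ℚ ℚ.≤ y → 0ℚ ℚ.≤ x ℚ.+ y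
0≤+ = ℚ.+-mono-≤

-- Definitionally the constant term of `fromℕ`, so bounds on `⟦ n ⟧` serve directly as bounds on the
-- number of turns.
⟦_⟧ : ℕ → ℚ
⟦ n ⟧ = ℤ.+ n ℚ./ 1

private
  integer : ℕ → ℚᵘ.ℚᵘ
  integer n = ℚᵘ.mkℚᵘ (ℤ.+ n) 0

  -- Reducing a fraction to lowest terms does not compute for a variable n, so the laws of `⟦_⟧` are
  -- checked on unnormalised fractions and carried over.
  toℚᵘ-⟦⟧ : ∀ n → ℚ.toℚᵘ ⟦ n ⟧ ℚᵘ.≃ integer n
  toℚᵘ-⟦⟧ n = ℚ.toℚᵘ-fromℚᵘ (integer n)

⟦⟧-+ : ∀ m n → ⟦ m ℕ.+ n ⟧ ≡ ⟦ m ⟧ ℚ.+ ⟦ n ⟧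
⟦⟧-+ m n = ℚ.toℚᵘ-injective (ℚᵘ.≃-trans (toℚᵘ-⟦⟧ (m ℕ.+ n)) (ℚᵘ.≃-sym
  (ℚᵘ.≃-trans (ℚ.toℚᵘ-homo-+ ⟦ m ⟧ ⟦ n ⟧) (ℚᵘ.≃-trans (ℚᵘ.+-cong (toℚᵘ-⟦⟧ m) (toℚᵘ-⟦⟧ n)) (ℚᵘ.*≡* eq)))))
  where
  eq : (ℤ.+ m ℤ.* ℤ.+ 1 ℤ.+ ℤ.+ n ℤ.* ℤ.+ 1) ℤ.* ℤ.+ 1 ≡ ℤ.+ (m ℕ.+ n) ℤ.* (ℤ.+ 1 ℤ.* ℤ.+ 1)
  eq = cong (ℤ._* ℤ.+ 1) (cong₂ ℤ._+_ (ℤ.*-identityʳ (ℤ.+ m)) (ℤ.*-identityʳ (ℤ.+ n)))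

⟦⟧-* : ∀ m n → ⟦ m ℕ.* n ⟧ ≡ ⟦ m ⟧ ℚ.* ⟦ n ⟧
⟦⟧-* m n = ℚ.toℚᵘ-injective (ℚᵘ.≃-trans (toℚᵘ-⟦⟧ (m ℕ.* n)) (ℚᵘ.≃-sym
  (ℚᵘ.≃-trans (ℚ.toℚᵘ-homo-* ⟦ m ⟧ ⟦ n ⟧) (ℚᵘ.≃-trans (ℚᵘ.*-cong (toℚᵘ-⟦⟧ m) (toℚᵘ-⟦⟧ n)) (ℚᵘ.*≡* eq)))))
  where
  eq : (ℤ.+ m ℤ.* ℤ.+ n) ℤ.* ℤ.+ 1 ≡ ℤ.+ (m ℕ.* n) ℤ.* (ℤ.+ 1 ℤ.* ℤ.+ 1)
  eq = cong (ℤ._* ℤ.+ 1) (sym (ℤ.pos-* m n))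

⟦⟧-^ : ∀ m n → ⟦ m ℕ.^ n ⟧ ≡ ⟦ m ⟧ ^ℚ n
⟦⟧-^ m zero    = refl
⟦⟧-^ m (suc n) = trans (⟦⟧-* m (m ℕ.^ n)) (cong (⟦ m ⟧ ℚ.*_) (⟦⟧-^ m n))

⟦⟧-mono : ∀ {m n} → m ℕ.≤ n → ⟦ m ⟧ ℚ.≤ ⟦ n ⟧
⟦⟧-mono {m} {n} m≤n = ℚ.toℚᵘ-cancel-≤ (ℚᵘ.≤-respˡ-≃ (ℚᵘ.≃-sym (toℚᵘ-⟦⟧ m))
  (ℚᵘ.≤-respʳ-≃ (ℚᵘ.≃-sym (toℚᵘ-⟦⟧ n)) (ℚᵘ.*≤* (ℤ.*-monoʳ-≤-nonNeg (ℤ.+ 1) (ℤ.+≤+ m≤n)))))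

0≤⟦⟧ : ∀ n → 0ℚ ℚ.≤ ⟦ n ⟧
0≤⟦⟧ n = ⟦⟧-mono {0} {n} ℕ.z≤n

indicator≤ : ∀ {A : Set} (d : Dec A) {x} → 0ℚ ℚ.≤ x → (A → 1ℚ ℚ.≤ x) →
             (if does d then 1ℚ else 0ℚ) ℚ.≤ x
indicator≤ (yes a) 0≤x 1≤x = 1≤x a
indicator≤ (no _)  0≤x 1≤x = 0≤x

prob : Graph → ℚ → ∀ {h n} → Strategy h n → ℚ
prob H q {h} stop          = if does (containsCopy? H h) then 1ℚ else 0ℚ
prob H q (query _ _ σ₁ σ₀) = q ℚ.* prob H q σ₁ ℚ.+ (1ℚ ℚ.- q) ℚ.* prob H q σ₀

-- The success probability is a polynomial in p and real operations act termwise. Everything below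
-- can therefore be done for a rational edge probability q, one term of p at a time.
seq-prob : ∀ H p {h n} (σ : Strategy h n) k → seq (successProb H p σ) k ≡ prob H (seq p k) σ
seq-prob H p {h} stop k with does (containsCopy? H h)
... | true  = refl
... | false = refl
seq-prob H p (query _ _ σ₁ σ₀) k =
  cong₂ (λ x y → seq p k ℚ.* x ℚ.+ (1ℚ ℚ.- seq p k) ℚ.* y) (seq-prob H p σ₁ k) (seq-prob H p σ₀ k)

-- Key queries

open DecMembership ℕ._≟_ using () renaming (_∈?_ to _∈ℕ?_)

-- The time of a query is the number of earlier queries.
Covered : List ℕ → History → ℤ.ℤ → Set
Covered τ []            x = ⊥
Covered τ ((e , _) ∷ h) x = (length h ∈ τ × (x ≡ lo e ⊎ x ≡ hi e)) ⊎ Covered τ h x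

covered? : ∀ τ h x → Dec (Covered τ h x)
covered? τ []            x = no id
covered? τ ((e , _) ∷ h) x =
  ((length h ∈ℕ? τ) ×-dec ((x ℤ.≟ lo e) ⊎-dec (x ℤ.≟ hi e))) ⊎-dec covered? τ h x

Key : List ℕ → History → Pair → Set
Key τ h e = length h ∈ τ ⊎ (Covered τ h (lo e) × Covered τ h (hi e))

key? : ∀ τ h e → Dec (Key τ h e)
key? τ h e = (length h ∈ℕ? τ) ⊎-dec (covered? τ h (lo e) ×-dec covered? τ h (hi e))

-- The number of key queries, or nothing if one of them has failed.
status : List ℕ → History → Maybe ℕ
status τ []            = just 0
status τ ((e , b) ∷ h) =
  if does (key? τ h e)
  then (if b then Maybe.map suc (status τ h) else nothing)
  else status τ h

-- Bounds the chance that k key queries will all succeed, given the status so far. The subtraction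
-- is truncated, so the weight is 1 from the k-th success on.
weight : ℚ → ℕ → Maybe ℕ → ℚ
weight q k nothing  = 0ℚ
weight q k (just c) = q ^ℚ (k ∸ c)

-- The supermartingale bound on the success probability.

module Supermartingale (H : Graph) (s k : ℕ)
  (certificate : ∀ h → Unique (queried h) → ContainsCopy H h →
     ∃ λ τ → length τ ≡ s × All (ℕ._< length h) τ × ∃ λ c → status τ h ≡ just c × k ℕ.≤ c)
  (q : ℚ) (0≤q : 0ℚ ℚ.≤ q) (q≤1 : q ℚ.≤ 1ℚ) where

  0≤1-q : 0ℚ ℚ.≤ 1ℚ ℚ.- q
  0≤1-q = 0≤y-x q≤1

  0≤weight : ∀ m → 0ℚ ℚ.≤ weight q k m
  0≤weight nothing  = ℚ.≤-refl
  0≤weight (just c) = 0≤^ (k ∸ c) 0≤q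

  -- Below k the two sides agree; from k on both exponents are truncated to 0 and q ≤ 1 remains.
  success-step : ∀ c k → q ℚ.* q ^ℚ (k ∸ suc c) ℚ.≤ q ^ℚ (k ∸ c)
  success-step zero    zero    = ℚ.≤-trans (ℚ.≤-reflexive (ℚ.*-identityʳ q)) q≤1
  success-step (suc c) zero    = ℚ.≤-trans (ℚ.≤-reflexive (ℚ.*-identityʳ q)) q≤1
  success-step zero    (suc k) = ℚ.≤-refl
  success-step (suc c) (suc k) = success-step c k

  average : ∀ x → q ℚ.* x ℚ.+ (1ℚ ℚ.- q) ℚ.* x ≡ x
  average = solve 2 (λ q x → q :* x :+ (con 1ℚ :- q) :* x := x) refl q

  -- A query that is not key leaves the status alone. At a key query failure contributes 0, and
  -- success, of chance q, gains at most a factor 1/q.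
  weight-step : ∀ τ h e →
    q ℚ.* weight q k (status τ ((e , true) ∷ h)) ℚ.+ (1ℚ ℚ.- q) ℚ.* weight q k (status τ ((e , false) ∷ h))
      ℚ.≤ weight q k (status τ h)
  weight-step τ h e with does (key? τ h e)
  ... | false = ℚ.≤-reflexive (average _)
  ... | true with status τ h
  ...   | nothing = ℚ.≤-reflexive (average 0ℚ)
  ...   | just c  = ℚ.≤-trans (ℚ.≤-reflexive
            (solve 2 (λ x q → x :+ (con 1ℚ :- q) :* con 0ℚ := x) refl (q ℚ.* q ^ℚ (k ∸ suc c)) q))
            (success-step c k)

  -- The union bound: one supermartingale for each guess, all added up.
  total : List (List ℕ) → History → ℚ
  total []       h = 0ℚ
  total (τ ∷ ts) h = weight q k (status τ h) ℚ.+ total ts h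

  0≤total : ∀ ts h → 0ℚ ℚ.≤ total ts h
  0≤total []       h = ℚ.≤-refl
  0≤total (τ ∷ ts) h = 0≤+ (0≤weight (status τ h)) (0≤total ts h)

  total-step : ∀ ts h e →
    q ℚ.* total ts ((e , true) ∷ h) ℚ.+ (1ℚ ℚ.- q) ℚ.* total ts ((e , false) ∷ h) ℚ.≤ total ts h
  total-step []       h e = ℚ.≤-reflexive (average 0ℚ)
  total-step (τ ∷ ts) h e = ℚ.≤-trans (ℚ.≤-reflexive
    (solve 5 (λ q a b c d → q :* (a :+ b) :+ (con 1ℚ :- q) :* (c :+ d)
                         := (q :* a :+ (con 1ℚ :- q) :* c) :+ (q :* b :+ (con 1ℚ :- q) :* d))
       refl q _ _ _ _))
    (ℚ.+-mono-≤ (weight-step τ h e) (total-step ts h e))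

  total-∈ : ∀ {τ ts} h → τ ∈ ts → weight q k (status τ h) ℚ.≤ total ts h
  total-∈ {ts = τ ∷ ts} h (here refl) =
    ℚ.≤-trans (ℚ.≤-reflexive (sym (ℚ.+-identityʳ _))) (ℚ.+-monoʳ-≤ (weight q k (status τ h)) (0≤total ts h))
  total-∈ {ts = τ ∷ ts} h (there p)   = ℚ.≤-trans (total-∈ h p)
    (ℚ.≤-trans (ℚ.≤-reflexive (sym (ℚ.+-identityˡ _))) (ℚ.+-monoˡ-≤ (total ts h) (0≤weight (status τ h))))

  tuples : ℕ → ℕ → List (List ℕ)
  tuples N zero    = [] ∷ []
  tuples N (suc s) = cartesianProductWith _∷_ (upTo N) (tuples N s)

  length-product : ∀ {A B C : Set} (f : A → B → C) xs ys →
    length (cartesianProductWith f xs ys) ≡ length xs ℕ.* length ys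
  length-product f []       ys = refl
  length-product f (x ∷ xs) ys = trans (length-++ (map (f x) ys))
    (cong₂ ℕ._+_ (length-map (f x) ys) (length-product f xs ys))

  length-tuples : ∀ N s → length (tuples N s) ≡ N ℕ.^ s
  length-tuples N zero    = refl
  length-tuples N (suc s) = trans (length-product _∷_ (upTo N) (tuples N s))
    (cong₂ ℕ._*_ (length-upTo N) (length-tuples N s))

  ∈-tuples : ∀ N τ → All (ℕ._< N) τ → τ ∈ tuples N (length τ)
  ∈-tuples N []      []         = here refl
  ∈-tuples N (i ∷ τ) (i<N ∷ a) = ∈-cartesianProductWith⁺ _∷_ (∈-upTo⁺ i<N) (∈-tuples N τ a)

  -- Induction on the decision tree. N is the same at all nodes, so that the guesses do not depend
  -- on the branch; at a leaf with a copy, the certificate provides one guess of weight 1, and that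
  -- is enough.
  prob≤total : ∀ N {h n} (σ : Strategy h n) → Unique (queried h) → length h ℕ.+ n ≡ N →
               prob H q σ ℚ.≤ total (tuples N s) h
  prob≤total N {h} {n} stop u eq = indicator≤ (containsCopy? H h) (0≤total (tuples N s) h) λ w →
    case certificate h u w of λ { (τ , refl , τ< , c , st , k≤c) →
      -- From k ≤ c the exponent `k ∸ c` is 0, so this weight equals 1.
      ℚ.≤-trans (ℚ.≤-reflexive (sym (trans (cong (weight q k) st) (cong (q ^ℚ_) (ℕ.m≤n⇒m∸n≡0 k≤c)))))
        (total-∈ h (∈-tuples N τ (All.map (λ lt → ℕ.<-≤-trans lt h≤N) τ<))) }
    where
    h≤N : length h ℕ.≤ N
    h≤N = subst (length h ℕ.≤_) eq (ℕ.m≤m+n (length h) n)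
  prob≤total N {h} {suc n} (query e e∉ σ₁ σ₀) u eq = ℚ.≤-trans
    (ℚ.+-mono-≤ (*-monoˡ q 0≤q (prob≤total N σ₁ u′ eq′)) (*-monoˡ _ 0≤1-q (prob≤total N σ₀ u′ eq′)))
    (total-step (tuples N s) h e)
    where
    u′ : Unique (e ∷ queried h)
    u′ = All.tabulate (λ x∈ e≡x → e∉ (subst (_∈ _) (sym e≡x) x∈)) ∷ u
    eq′ : suc (length h ℕ.+ n) ≡ N
    eq′ = trans (sym (ℕ.+-suc (length h) n)) eq

  total-[] : ∀ ts → total ts [] ≡ ⟦ length ts ⟧ ℚ.* q ^ℚ k
  total-[] []       = sym (ℚ.*-zeroˡ (q ^ℚ k))
  total-[] (τ ∷ ts) = trans (cong (q ^ℚ k ℚ.+_) (total-[] ts))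
    (trans (solve 2 (λ x n → x :+ n :* x := (con 1ℚ :+ n) :* x) refl (q ^ℚ k) ⟦ length ts ⟧)
           (cong (ℚ._* q ^ℚ k) (sym (⟦⟧-+ 1 (length ts)))))

  prob≤ : ∀ {n} (σ : Strategy [] n) → prob H q σ ℚ.≤ ⟦ n ⟧ ^ℚ s ℚ.* q ^ℚ k
  prob≤ {n} σ = ℚ.≤-trans (prob≤total n σ [] refl) (ℚ.≤-reflexive (trans (total-[] (tuples n s))
    (cong (ℚ._* q ^ℚ k) (trans (cong ⟦_⟧ (length-tuples n s)) (⟦⟧-^ n s)))))

-- Lists without repetition

unique-⊆⇒length≤ : ∀ {A : Set} {xs ys : List A} → Unique xs → (∀ {x} → x ∈ xs → x ∈ ys) → length xs ℕ.≤ length ys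
unique-⊆⇒length≤ {xs = []}     u        sub = ℕ.z≤n
unique-⊆⇒length≤ {A} {x ∷ xs} {ys} (x∉ ∷ u) sub with ∈-∃++ (sub (here refl))
... | as , bs , refl = ℕ.≤-trans (ℕ.s≤s (unique-⊆⇒length≤ u sub′)) (ℕ.≤-reflexive eq)
  where
  sub′ : ∀ {y} → y ∈ xs → y ∈ as ++ bs
  sub′ y∈ with ∈-++⁻ as (sub (there y∈))
  ... | inj₁ p            = ∈-++⁺ˡ p
  ... | inj₂ (here refl)  = contradiction refl (All.lookup x∉ y∈)
  ... | inj₂ (there p)    = ∈-++⁺ʳ as p
  eq : suc (length (as ++ bs)) ≡ length (as ++ x ∷ bs)
  eq = trans (cong suc (length-++ as)) (trans (sym (ℕ.+-suc (length as) (length bs))) (sym (length-++ as)))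

unique-∷ : ∀ {A : Set} {x : A} {xs} → x ∉ xs → Unique xs → Unique (x ∷ xs)
unique-∷ x∉ u = All.tabulate (λ y∈ x≡y → x∉ (subst (_∈ _) (sym x≡y) y∈)) ∷ u

unique-functional : ∀ {A B : Set} {xs : List (A × B)} {x b c} → Unique (map proj₁ xs) →
                    (x , b) ∈ xs → (x , c) ∈ xs → b ≡ c
unique-functional (x∉ ∷ u) (here refl) (here refl) = refl
unique-functional (x∉ ∷ u) (here refl) (there q)   = contradiction refl (All.lookup x∉ (∈-map⁺ proj₁ q))
unique-functional (x∉ ∷ u) (there p)   (here refl) = contradiction refl (All.lookup x∉ (∈-map⁺ proj₁ p))
unique-functional (x∉ ∷ u) (there p)   (there q)   = unique-functional u p q

-- Orderings of the edges of a clique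

Label : ℕ → Set
Label m = Fin m × Fin m

_≟ˡ_ : ∀ {m} (k l : Label m) → Dec (k ≡ l)
_≟ˡ_ = ≡-dec Fin._≟_ Fin._≟_

_∈ˡ?_ : ∀ {m} (l : Label m) ls → Dec (l ∈ ls)
l ∈ˡ? ls = any? (l ≟ˡ_) ls

edges : ∀ m → List (Label m)
edges m = filter (λ (i , j) → i Fin.<? j) (cartesianProduct (allFin m) (allFin m))

edges-unique : ∀ m → Unique (edges m)
edges-unique m = Unique.filter⁺ (λ (i , j) → i Fin.<? j)
  (Unique.cartesianProduct⁺ (Unique.allFin⁺ m) (Unique.allFin⁺ m))

∈-edges⁻ : ∀ {m} {i j : Fin m} → (i , j) ∈ edges m → i Fin.< j
∈-edges⁻ {m} p = proj₂ (∈-filter⁻ (λ (i , j) → i Fin.<? j) {xs = cartesianProduct (allFin m) (allFin m)} p)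

Touches : ∀ {m} → Fin m → Label m → Set
Touches v (i , j) = v ≡ i ⊎ v ≡ j

Touched : ∀ {m} → List (Label m) → List (Label m) → Fin m → Set
Touched S ls v = Any (λ l → l ∈ S × Touches v l) ls

-- The trace of `Key` inside the copy: S stands for the guessed queries and `ls` for the earlier
-- edges of the copy.
KeyLabel : ∀ {m} → List (Label m) → List (Label m) → Label m → Set
KeyLabel S ls l = l ∈ S ⊎ (Touched S ls (proj₁ l) × Touched S ls (proj₂ l))

-- Lists of labels, like histories, have the latest edge first.
data Hits {m} (S : List (Label m)) : List (Label m) → ℕ → Set where
  []   : Hits S [] 0
  skip : ∀ {l ls n} → Hits S ls n → Hits S (l ∷ ls) n
  hit  : ∀ {l ls n} → KeyLabel S ls l → Hits S ls n → Hits S (l ∷ ls) (suc n)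

lo≢hi : ∀ e → lo e ≢ hi e
lo≢hi (mkPair a b a<b) refl = ⊥-elim-irr (ℤ.<-irrefl refl a<b)

-- Edges of a copy in the order of their queries.

module Ordering {m} (φ : Fin m → ℤ.ℤ) (φ-inj : Injective _≡_ _≡_ φ) where

  JoinsL : Pair → Label m → Set
  JoinsL e (i , j) = Joins e (φ i) (φ j)

  joinsL? : ∀ e l → Dec (JoinsL e l)
  joinsL? e (i , j) = ((lo e ℤ.≟ φ i) ×-dec (hi e ℤ.≟ φ j)) ⊎-dec ((lo e ℤ.≟ φ j) ×-dec (hi e ℤ.≟ φ i))

  -- Labels in `edges m` are increasing, so two labels of one pair cannot have opposite
  -- orientations.
  JoinsL-label : ∀ {e k l} → k ∈ edges m → l ∈ edges m → JoinsL e k → JoinsL e l → k ≡ l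
  JoinsL-label k∈ l∈ (inj₁ (a , b)) (inj₁ (c , d)) =
    cong₂ _,_ (φ-inj (trans (sym a) c)) (φ-inj (trans (sym b) d))
  JoinsL-label k∈ l∈ (inj₂ (a , b)) (inj₂ (c , d)) =
    cong₂ _,_ (φ-inj (trans (sym b) d)) (φ-inj (trans (sym a) c))
  JoinsL-label k∈ l∈ (inj₁ (a , b)) (inj₂ (c , d)) = contradiction (∈-edges⁻ l∈)
    (ℕ.<-asym (subst₂ Fin._<_ (φ-inj (trans (sym a) c)) (φ-inj (trans (sym b) d)) (∈-edges⁻ k∈)))
  JoinsL-label k∈ l∈ (inj₂ (a , b)) (inj₁ (c , d)) = contradiction (∈-edges⁻ l∈)
    (ℕ.<-asym (subst₂ Fin._<_ (φ-inj (trans (sym b) d)) (φ-inj (trans (sym a) c)) (∈-edges⁻ k∈)))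

  pair-≡ : ∀ {e e′ : Pair} → lo e ≡ lo e′ → hi e ≡ hi e′ → e ≡ e′
  pair-≡ refl refl = refl

  JoinsL-pair : ∀ {e e′ l} → JoinsL e l → JoinsL e′ l → e ≡ e′
  JoinsL-pair (inj₁ (a , b)) (inj₁ (c , d)) = pair-≡ (trans a (sym c)) (trans b (sym d))
  JoinsL-pair (inj₂ (a , b)) (inj₂ (c , d)) = pair-≡ (trans a (sym c)) (trans b (sym d))
  JoinsL-pair {mkPair x y x<y} {mkPair y′ x′ y<x} (inj₁ (a , b)) (inj₂ (c , d)) =
    swapped (trans a (sym d)) (trans b (sym c)) x<y y<x
    where
    swapped : ∀ {A : Set} {x y x′ y′ : ℤ.ℤ} → x ≡ x′ → y ≡ y′ → .(x ℤ.< y) → .(y′ ℤ.< x′) → A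
    swapped refl refl p q = ⊥-elim-irr (ℤ.<-asym p q)
  JoinsL-pair {e} {e′} {l} p@(inj₂ _) q@(inj₁ _) = sym (JoinsL-pair {e′} {e} {l} q p)

  data Ordered : History → List (Label m) → Set where
    []   : Ordered [] []
    miss : ∀ {e b h ls} → Ordered h ls → Ordered ((e , b) ∷ h) ls
    pick : ∀ {e b h ls} l → l ∈ edges m → JoinsL e l → Ordered h ls → Ordered ((e , b) ∷ h) (l ∷ ls)

  label? : ∀ e → Dec (∃ λ l → l ∈ edges m × JoinsL e l)
  label? e with any? (joinsL? e) (edges m)
  ... | yes p = yes (find p)
  ... | no ¬p = no λ (l , l∈ , js) → ¬p (lose l∈ js)

  labels : History → List (Label m)
  labels []            = []
  labels ((e , b) ∷ h) with label? e
  ... | yes (l , _) = l ∷ labels h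
  ... | no  _       = labels h

  ordered : ∀ h → Ordered h (labels h)
  ordered []            = []
  ordered ((e , b) ∷ h) with label? e
  ... | yes (l , l∈ , js) = pick l l∈ js (ordered h)
  ... | no  _             = miss (ordered h)

  ∈-labels⁺ : ∀ {e b h l} → (e , b) ∈ h → l ∈ edges m → JoinsL e l → l ∈ labels h
  ∈-labels⁺ {e} {h = _ ∷ h} {l} (here refl) l∈ js with label? e
  ... | yes (k , k∈ , js′) = here (JoinsL-label {e} {l} {k} l∈ k∈ js js′)
  ... | no  ¬p             = contradiction (l , l∈ , js) ¬p
  ∈-labels⁺ {h = (e′ , _) ∷ h} (there p) l∈ js with label? e′
  ... | yes _ = there (∈-labels⁺ p l∈ js)
  ... | no  _ = ∈-labels⁺ p l∈ js

  ∈-labels⁻ : ∀ {h ls l} → Ordered h ls → l ∈ ls → l ∈ edges m × ∃ λ e → e ∈ queried h × JoinsL e l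
  ∈-labels⁻ (miss o) p = let l∈ , e , e∈ , js = ∈-labels⁻ o p in l∈ , e , there e∈ , js
  ∈-labels⁻ (pick l l∈ js o) (here refl) = l∈ , _ , here refl , js
  ∈-labels⁻ (pick l l∈ js o) (there p)   = let l∈ , e , e∈ , js = ∈-labels⁻ o p in l∈ , e , there e∈ , js

  labels-unique : ∀ {h ls} → Ordered h ls → Unique (queried h) → Unique ls
  labels-unique []                 u = []
  labels-unique (miss o)           (_ ∷ u)  = labels-unique o u
  labels-unique (pick {e} l l∈ js o) (e∉ ∷ u) = unique-∷ fresh (labels-unique o u)
    where
    fresh : l ∉ _
    fresh p = let _ , e′ , e′∈ , js′ = ∈-labels⁻ o p in
      All.lookup e∉ e′∈ (JoinsL-pair {e} {e′} {l} js js′)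

  module _ (S : List (Label m)) where

    times : ∀ {h ls} → Ordered h ls → List ℕ
    times []       = []
    times (miss o) = times o
    times (pick {h = h} l _ _ o) with l ∈ˡ? S
    ... | yes _ = length h ∷ times o
    ... | no  _ = times o

    times< : ∀ {h ls} (o : Ordered h ls) → All (ℕ._< length h) (times o)
    times< []       = []
    times< (miss o) = All.map ℕ.m<n⇒m<1+n (times< o)
    times< (pick {h = h} l _ _ o) with l ∈ˡ? S
    ... | yes _ = ℕ.≤-refl ∷ All.map ℕ.m<n⇒m<1+n (times< o)
    ... | no  _ = All.map ℕ.m<n⇒m<1+n (times< o)

    length-times : ∀ {h ls} (o : Ordered h ls) → length (times o) ≡ length (filter (_∈ˡ? S) ls)
    length-times []       = refl
    length-times (miss o) = length-times o
    length-times (pick l _ _ o) with l ∈ˡ? S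
    ... | yes _ = cong suc (length-times o)
    ... | no  _ = length-times o

    -- The agreement between times and labels, for a τ that stays fixed. The list `times` shrinks
    -- together with the history, whereas the induction in `status-bound` needs one τ throughout.
    Selects : List ℕ → ∀ {h ls} → Ordered h ls → Set
    Selects τ []                    = ⊤
    Selects τ (miss {h = h} o)      = length h ∉ τ × Selects τ o
    Selects τ (pick {h = h} l _ _ o) = (length h ∈ τ → l ∈ S) × (l ∈ S → length h ∈ τ) × Selects τ o

    -- Only times before the end of the current history are compared, because the other members of τ
    -- belong to queries that have already been peeled off.
    times-select : ∀ {τ h ls} (o : Ordered h ls) →
      (∀ {x} → x ℕ.< length h → (x ∈ τ → x ∈ times o) × (x ∈ times o → x ∈ τ)) → Selects τ o
    times-select [] agree = tt
    times-select (miss o) agree =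
      (λ p → ℕ.<-irrefl refl (All.lookup (times< o) (proj₁ (agree ℕ.≤-refl) p))) ,
      times-select o (λ x< → agree (ℕ.m<n⇒m<1+n x<))
    times-select {τ} (pick {h = h} l _ _ o) agree with l ∈ˡ? S
    ... | yes l∈S = (λ _ → l∈S) , (λ _ → proj₂ (agree ℕ.≤-refl) (here refl)) ,
        times-select o λ x< → (λ p → earlier x< (proj₁ (agree (ℕ.m<n⇒m<1+n x<)) p)) ,
                              (λ p → proj₂ (agree (ℕ.m<n⇒m<1+n x<)) (there p))
      where
      earlier : ∀ {x} → x ℕ.< length h → x ∈ length h ∷ times o → x ∈ times o
      earlier x< (here refl) = contradiction x< (ℕ.<-irrefl refl)
      earlier x< (there p)   = p
    ... | no l∉S =
        (λ p → ⊥-elim (ℕ.<-irrefl refl (All.lookup (times< o) (proj₁ (agree ℕ.≤-refl) p)))) ,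
        (λ l∈S → contradiction l∈S l∉S) ,
        times-select o (λ x< → agree (ℕ.m<n⇒m<1+n x<))

    module _ (τ : List ℕ) where

      -- Guessed times are times of picked queries, whose ends lie in the copy. Hence a query with
      -- both ends covered joins two vertices of the copy and must have succeeded.
      covered⇒image : ∀ {h ls x} (o : Ordered h ls) → Selects τ o → Covered τ h x → ∃ λ i → x ≡ φ i
      covered⇒image (miss o) (∉τ , sel) (inj₁ (∈τ , _)) = contradiction ∈τ ∉τ
      covered⇒image (miss o) (∉τ , sel) (inj₂ c) = covered⇒image o sel c
      covered⇒image (pick (i , j) _ (inj₁ (a , b)) o) sel (inj₁ (_ , inj₁ eq)) = i , trans eq a
      covered⇒image (pick (i , j) _ (inj₁ (a , b)) o) sel (inj₁ (_ , inj₂ eq)) = j , trans eq b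
      covered⇒image (pick (i , j) _ (inj₂ (a , b)) o) sel (inj₁ (_ , inj₁ eq)) = j , trans eq a
      covered⇒image (pick (i , j) _ (inj₂ (a , b)) o) sel (inj₁ (_ , inj₂ eq)) = i , trans eq b
      covered⇒image (pick _ _ _ o) (_ , _ , sel) (inj₂ c) = covered⇒image o sel c

      touched⇒covered : ∀ {h ls i} (o : Ordered h ls) → Selects τ o → Touched S ls i → Covered τ h (φ i)
      touched⇒covered (miss o) (_ , sel) t = inj₂ (touched⇒covered o sel t)
      touched⇒covered (pick _ _ (inj₁ (a , b)) o) (_ , ∈τ , _) (here (l∈S , inj₁ refl)) = inj₁ (∈τ l∈S , inj₁ (sym a))
      touched⇒covered (pick _ _ (inj₁ (a , b)) o) (_ , ∈τ , _) (here (l∈S , inj₂ refl)) = inj₁ (∈τ l∈S , inj₂ (sym b))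
      touched⇒covered (pick _ _ (inj₂ (a , b)) o) (_ , ∈τ , _) (here (l∈S , inj₁ refl)) = inj₁ (∈τ l∈S , inj₂ (sym b))
      touched⇒covered (pick _ _ (inj₂ (a , b)) o) (_ , ∈τ , _) (here (l∈S , inj₂ refl)) = inj₁ (∈τ l∈S , inj₁ (sym a))
      touched⇒covered (pick _ _ _ o) (_ , _ , sel) (there t) = inj₂ (touched⇒covered o sel t)

      Truthful : History → Set
      Truthful h = ∀ i j {e b} → (e , b) ∈ h → Joins e (φ i) (φ j) → b ≡ true

      keyLabel⇒key : ∀ {h ls e b l l∈ js} (o : Ordered h ls) → Selects τ (pick {e} {b} l l∈ js o) →
                     KeyLabel S ls l → Key τ h e
      keyLabel⇒key o (_ , ∈τ , _) (inj₁ l∈S) = inj₁ (∈τ l∈S)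
      keyLabel⇒key {h} {js = inj₁ (a , b)} o (_ , _ , sel) (inj₂ (ti , tj)) =
        inj₂ (subst (Covered τ h) (sym a) (touched⇒covered o sel ti) ,
              subst (Covered τ h) (sym b) (touched⇒covered o sel tj))
      keyLabel⇒key {h} {js = inj₂ (a , b)} o (_ , _ , sel) (inj₂ (ti , tj)) =
        inj₂ (subst (Covered τ h) (sym a) (touched⇒covered o sel tj) ,
              subst (Covered τ h) (sym b) (touched⇒covered o sel ti))

      status-key : ∀ {h e b} → Key τ h e → b ≡ true → status τ ((e , b) ∷ h) ≡ Maybe.map suc (status τ h)
      status-key {h} {e} key refl =
        cong (λ d → if d then Maybe.map suc (status τ h) else status τ h) (dec-true (key? τ h e) key)

      status-nonkey : ∀ {h e b} → ¬ Key τ h e → status τ ((e , b) ∷ h) ≡ status τ h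
      status-nonkey {h} {e} {b} ¬key =
        cong (λ d → if d then (if b then Maybe.map suc (status τ h) else nothing) else status τ h)
             (dec-false (key? τ h e) ¬key)

      covered-key-true : ∀ {h ls e b} (o : Ordered h ls) → Selects τ o → Truthful ((e , b) ∷ h) →
                         Covered τ h (lo e) → Covered τ h (hi e) → b ≡ true
      covered-key-true o sel truth c d =
        let i , eqi = covered⇒image o sel c
            j , eqj = covered⇒image o sel d
        in truth i j (here refl) (inj₁ (eqi , eqj))

      -- A key query joins two vertices of the copy, so it never fails and the status is never
      -- `nothing`. Key queries that `Hits` does not count only increase c.
      status-bound : ∀ {h ls n} (o : Ordered h ls) → Selects τ o → Truthful h → Hits S ls n →
                     ∃ λ c → status τ h ≡ just c × n ℕ.≤ c
      status-bound [] sel truth [] = 0 , refl , ℕ.≤-refl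
      status-bound (miss {e} {b} {h} o) (∉τ , sel) truth hits
        with status-bound o sel (λ i j → truth i j ∘ there) hits | key? τ h e
      ... | c , st , n≤c | no ¬key = c , trans (status-nonkey {h} {e} {b} ¬key) st , n≤c
      ... | c , st , n≤c | yes (inj₁ ∈τ) = contradiction ∈τ ∉τ
      ... | c , st , n≤c | yes key@(inj₂ (x , y)) = suc c ,
            trans (status-key {h} {e} key (covered-key-true o sel truth x y)) (cong (Maybe.map suc) st) ,
            ℕ.m≤n⇒m≤1+n n≤c
      status-bound (pick {e} {b} {h} l l∈ js o) (p , q , sel) truth (skip hits)
        with status-bound o sel (λ i j → truth i j ∘ there) hits | key? τ h e
      ... | c , st , n≤c | no ¬key = c , trans (status-nonkey {h} {e} {b} ¬key) st , n≤c
      ... | c , st , n≤c | yes key = suc c ,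
            trans (status-key {h} {e} key (truth (proj₁ l) (proj₂ l) (here refl) js)) (cong (Maybe.map suc) st) ,
            ℕ.m≤n⇒m≤1+n n≤c
      status-bound (pick {e} {b} {h} l l∈ js o) s@(p , q , sel) truth (hit kl hits)
        with status-bound o sel (λ i j → truth i j ∘ there) hits
      ... | c , st , n≤c = suc c ,
            trans (status-key {h} {e} (keyLabel⇒key {e = e} {b} {l} {l∈} {js} o s kl)
                    (truth (proj₁ l) (proj₂ l) (here refl) js)) (cong (Maybe.map suc) st) ,
            ℕ.s≤s n≤c

-- From a choice of key edges to a certificate.

KeyChoice : (m s k : ℕ) → Set
KeyChoice m s k = ∀ ls → Unique ls → (∀ {l} → l ∈ edges m → l ∈ ls) → (∀ {l} → l ∈ ls → l ∈ edges m) →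
  ∃ λ S → length S ≡ s × Unique S × (∀ {l} → l ∈ S → l ∈ ls) × Hits S ls k

built⇒∈ : ∀ {h u v} → Built h u v → ∃ λ e → (e , true) ∈ h × Joins e u v
built⇒∈ (here {e , true} (_ , js)) = e , here refl , js
built⇒∈ (there b)                  = let e , e∈ , js = built⇒∈ b in e , there e∈ , js

-- The guess consists of the times at which the chosen edges were queried. There are s of them
-- because each edge of the copy occurs once among the labels.
clique-certificate : ∀ {m s k} → KeyChoice m s k →
  ∀ h → Unique (queried h) → ContainsCopy (K m) h →
  ∃ λ τ → length τ ≡ s × All (ℕ._< length h) τ × ∃ λ c → status τ h ≡ just c × k ℕ.≤ c
clique-certificate {m} {s} choice h u (φ , inj , built) =
  let S , len , uS , S⊆ , hits = choice ls (labels-unique o u) complete (proj₁ ∘ ∈-labels⁻ o)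
      τ = times S o
      len-τ : length τ ≡ s
      len-τ = trans (length-times S o) (trans (ℕ.≤-antisym
        (unique-⊆⇒length≤ (Unique.filter⁺ (_∈ˡ? S) (labels-unique o u)) (λ p → proj₂ (∈-filter⁻ (_∈ˡ? S) {xs = ls} p)))
        (unique-⊆⇒length≤ uS (λ p → ∈-filter⁺ (_∈ˡ? S) (S⊆ p) p))) len)
  in τ , len-τ , times< S o , status-bound S τ o (times-select S o (λ _ → id , id)) truth hits
  where
  open Ordering φ inj
  ls = labels h
  o = ordered h
  complete : ∀ {l} → l ∈ edges m → l ∈ ls
  complete {i , j} l∈ = let e , e∈ , js = built⇒∈ (built i j (λ i≡j → ℕ.<-irrefl (cong Fin.toℕ i≡j) (∈-edges⁻ l∈)))
                        in ∈-labels⁺ e∈ l∈ js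
  truth : ∀ i j {e b} → (e , b) ∈ h → Joins e (φ i) (φ j) → b ≡ true
  truth i j {e} {b} p js with i Fin.≟ j
  truth i j {e} p (inj₁ (a , b)) | yes refl = contradiction (trans a (sym b)) (lo≢hi e)
  truth i j {e} p (inj₂ (a , b)) | yes refl = contradiction (trans a (sym b)) (lo≢hi e)
  truth i j {e} {b} p js | no i≢j =
    -- The copy contains a successful query of the same two vertices; no pair is queried twice, so
    -- it is this one.
    let e′ , e′∈ , js′ = built⇒∈ (built i j i≢j)
        eq = JoinsL-pair {e} {e′} {i , j} js js′
    in unique-functional u p (subst (λ x → (x , true) ∈ h) (sym eq) e′∈)

-- Key edges: reduction to finitely many sets of edges.

combinations : ∀ {A : Set} → ℕ → List A → List (List A)
combinations zero    xs       = [] ∷ []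
combinations (suc k) []       = []
combinations (suc k) (x ∷ xs) = map (x ∷_) (combinations k xs) ++ combinations (suc k) xs

combinations-weaken : ∀ {A : Set} {x : A} {xs ys} k → ys ∈ combinations k xs → ys ∈ combinations k (x ∷ xs)
combinations-weaken         zero    p = p
combinations-weaken {x = x} {xs} (suc k) p = ∈-++⁺ʳ (map (x ∷_) (combinations k xs)) p

filter∈combinations : ∀ {m} (P xs : List (Label m)) →
  filter (_∈ˡ? P) xs ∈ combinations (length (filter (_∈ˡ? P) xs)) xs
filter∈combinations P []       = here refl
filter∈combinations P (x ∷ xs) with x ∈ˡ? P
... | yes _ = ∈-++⁺ˡ (∈-map⁺ (x ∷_) (filter∈combinations P xs))
... | no  _ = combinations-weaken (length (filter (_∈ˡ? P) xs)) (filter∈combinations P xs)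

-- Filtering `edges m` by membership in P sorts P, so a property of edge sets need be checked for
-- one arrangement of each set only.
by-enumeration : ∀ {m} {F : List (Label m) → Set} k {P : List (Label m)} →
  All F (combinations k (edges m)) → length P ≡ k → Unique P → (∀ {l} → l ∈ P → l ∈ edges m) →
  ∃ λ G → F G × (∀ {l} → l ∈ G → l ∈ P) × (∀ {l} → l ∈ P → l ∈ G)
by-enumeration {m} {F} k {P} all len u P⊆ =
  G , All.lookup all (subst (λ k → G ∈ combinations k (edges m)) len-G (filter∈combinations P (edges m))) , G⊆P , P⊆G
  where
  G : List (Label m)
  G = filter (_∈ˡ? P) (edges m)
  G⊆P : ∀ {l} → l ∈ G → l ∈ P
  G⊆P p = proj₂ (∈-filter⁻ (_∈ˡ? P) {xs = edges m} p)
  P⊆G : ∀ {l} → l ∈ P → l ∈ G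
  P⊆G p = ∈-filter⁺ (_∈ˡ? P) (P⊆ p) p
  len-G : length G ≡ k
  len-G = trans (ℕ.≤-antisym (unique-⊆⇒length≤ (Unique.filter⁺ (_∈ˡ? P) (edges-unique m)) G⊆P)
                             (unique-⊆⇒length≤ u P⊆G)) len

touches? : ∀ {m} (v : Fin m) l → Dec (Touches v l)
touches? v (i , j) = (v Fin.≟ i) ⊎-dec (v Fin.≟ j)

-- E marks the exempt vertices: none for a full cover, and the single vertex v for the matching in
-- K_5 that leaves v out.
CoversBut : ∀ {m} → (Fin m → Set) → List (Label m) → Set
CoversBut E S = ∀ v → E v ⊎ Any (Touches v) S

Chosen : ∀ {m} → ℕ → (Fin m → Set) → List (Label m) → List (Label m) → Set
Chosen s E G S = length S ≡ s × Unique S × All (_∈ G) S × CoversBut E S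

chosen? : ∀ {m} s {E : Fin m → Set} → (∀ v → Dec (E v)) → ∀ G S → Dec (Chosen s E G S)
chosen? s E? G S = (length S ℕ.≟ s) ×-dec allPairs? (λ k l → ¬? (k ≟ˡ l)) S
  ×-dec All.all? (_∈ˡ? G) S ×-dec Fin.all? (λ v → E? v ⊎-dec any? (touches? v) S)

HasCover : ∀ {m} → ℕ → List (Label m) → Set
HasCover s G = Any (Chosen s (λ _ → ⊥) G) (combinations s G)

hasCover? : ∀ {m} s (G : List (Label m)) → Dec (HasCover s G)
hasCover? s G = any? (chosen? s (λ _ → no id) G) (combinations s G)

Avoids : ∀ {m} → Fin m → List (Label m) → Set
Avoids v = All (λ l → ¬ Touches v l)

avoids? : ∀ {m} (v : Fin m) G → Dec (Avoids v G)
avoids? v = All.all? (¬? ∘ touches? v)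

hits-filter : ∀ {m} (S ls : List (Label m)) → Hits S ls (length (filter (_∈ˡ? S) ls))
hits-filter S []       = []
hits-filter S (l ∷ ls) with l ∈ˡ? S
... | yes l∈S = hit (inj₁ l∈S) (hits-filter S ls)
... | no  _   = skip (hits-filter S ls)

hits-≤ : ∀ {m n n′} {S ls : List (Label m)} → n ℕ.≤ n′ → Hits S ls n′ → Hits S ls n
hits-≤ ℕ.z≤n       []        = []
hits-≤ p           (skip h)  = skip (hits-≤ p h)
hits-≤ ℕ.z≤n       (hit k h) = skip (hits-≤ ℕ.z≤n h)
hits-≤ (ℕ.s≤s p)   (hit k h) = hit k (hits-≤ p h)

hits-⊆ : ∀ {m} {S S′ ls : List (Label m)} → Unique S′ → (∀ {l} → l ∈ S′ → l ∈ S) →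
         (∀ {l} → l ∈ S′ → l ∈ ls) → Hits S ls (length S′)
hits-⊆ {S = S} {S′} {ls} u S′⊆S S′⊆ls = hits-≤
  (unique-⊆⇒length≤ u (λ p → ∈-filter⁺ (_∈ˡ? S) (S′⊆ls p) (S′⊆S p))) (hits-filter S ls)

touched : ∀ {m} {S S′ ls : List (Label m)} {v} → (∀ {l} → l ∈ S′ → l ∈ S) →
          (∀ {l} → l ∈ S′ → l ∈ ls) → Any (Touches v) S′ → Touched S ls v
touched S′⊆S S′⊆ls a = let l , l∈ , t = find a in lose (S′⊆ls l∈) (S′⊆S l∈ , t)

-- Once the vertices outside E are covered by chosen edges, each later edge that avoids E has both
-- ends covered and so is key.
hits-++ : ∀ {m n} {E : Fin m → Set} {S S′ ls} mid → CoversBut E S′ →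
  (∀ {l} → l ∈ S′ → l ∈ S) → (∀ {l} → l ∈ S′ → l ∈ ls) → All (λ l → ¬ E (proj₁ l) × ¬ E (proj₂ l)) mid →
  Hits S ls n → Hits S (mid ++ ls) (length mid ℕ.+ n)
hits-++ []        cov S′⊆S S′⊆ls []       hits = hits
hits-++ {E = E} {S} {S′} {ls} (l ∷ mid) cov S′⊆S S′⊆ls ((¬i , ¬j) ∷ a) hits =
  hit (inj₂ (end (proj₁ l) ¬i , end (proj₂ l) ¬j)) (hits-++ mid cov S′⊆S S′⊆ls a hits)
  where
  end : ∀ v → ¬ E v → Touched S (mid ++ ls) v
  end v ¬e with cov v
  ... | inj₁ e = contradiction e ¬e
  ... | inj₂ t = touched S′⊆S (∈-++⁺ʳ mid ∘ S′⊆ls) t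

covers-hits : ∀ {m} {S ls : List (Label m)} pre → CoversBut (λ _ → ⊥) S → Unique S → (∀ {l} → l ∈ S → l ∈ ls) →
              Hits S (pre ++ ls) (length pre ℕ.+ length S)
covers-hits pre cov u S⊆ = hits-++ pre cov id S⊆ (All.tabulate (λ _ → id , id)) (hits-⊆ u id S⊆)

unique-++⁻ʳ : ∀ {A : Set} (xs : List A) {ys} → Unique (xs ++ ys) → Unique ys
unique-++⁻ʳ []       u       = u
unique-++⁻ʳ (x ∷ xs) (_ ∷ u) = unique-++⁻ʳ xs u

from-cover : ∀ {m s} {G : List (Label m)} pre {suf} → (∀ {l} → l ∈ G → l ∈ suf) → HasCover s G →
  ∃ λ S → length S ≡ s × Unique S × (∀ {l} → l ∈ S → l ∈ pre ++ suf) × Hits S (pre ++ suf) (length pre ℕ.+ s)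
from-cover pre {suf} G⊆ cover =
  let S , _ , len , uS , S⊆G , cov = find cover
      S⊆ : ∀ {l} → l ∈ S → l ∈ suf
      S⊆ p = G⊆ (All.lookup S⊆G p)
  in S , len , uS , ∈-++⁺ʳ pre ∘ S⊆ ,
     subst (λ s → Hits S (pre ++ suf) (length pre ℕ.+ s)) len (covers-hits pre cov uS S⊆)

-- Here `suf` holds the first edges. A cover of size s among them makes all edges of `pre` key, in
-- addition to its own s.
early-cover : ∀ {m s} pre suf → All (HasCover s) (combinations (length suf) (edges m)) → Unique (pre ++ suf) →
  (∀ {l} → l ∈ pre ++ suf → l ∈ edges m) →
  ∃ λ S → length S ≡ s × Unique S × (∀ {l} → l ∈ S → l ∈ pre ++ suf) × Hits S (pre ++ suf) (length pre ℕ.+ s)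
early-cover pre suf all u ⊆e =
  let G , cover , G⊆ , _ = by-enumeration (length suf) all refl (unique-++⁻ʳ pre u) (⊆e ∘ ∈-++⁺ʳ pre)
  in from-cover pre G⊆ cover

length-complete : ∀ {m} (ls : List (Label m)) → Unique ls →
                  (∀ {l} → l ∈ edges m → l ∈ ls) → (∀ {l} → l ∈ ls → l ∈ edges m) →
                  length ls ≡ length (edges m)
length-complete {m} ls u e⊆ ⊆e = ℕ.≤-antisym (unique-⊆⇒length≤ u ⊆e) (unique-⊆⇒length≤ (edges-unique m) e⊆)

-- Finite checks in K_3, K_4 and K_5.

abstract
  covers₃ : All (HasCover 2) (combinations 2 (edges 3))
  covers₃ = from-yes (All.all? (hasCover? 2) (combinations 2 (edges 3)))

  -- The two absent edges can destroy at most two of the three perfect matchings of K_4.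
  covers₄ : All (HasCover 2) (combinations 4 (edges 4))
  covers₄ = from-yes (All.all? (hasCover? 2) (combinations 4 (edges 4)))

  -- Pairwise meeting edges form a star, here of at most 4 edges, or a triangle. So five edges
  -- include two disjoint ones, and a third edge at the remaining vertex, if there is one, completes
  -- a cover.
  covers₅ : All (λ G → HasCover 3 G ⊎ ∃ λ v → Avoids v G) (combinations 5 (edges 5))
  covers₅ = from-yes (All.all? (λ G → hasCover? 3 G ⊎-dec Fin.any? (λ v → avoids? v G)) (combinations 5 (edges 5)))

  -- The four edges lie in the K_4 on the vertices other than v, where the argument for `covers₄`
  -- applies.
  matching₅ : All (λ G → ∀ v → Avoids v G → Any (Chosen 2 (_≡ v) G) (combinations 2 G)) (combinations 4 (edges 5))
  matching₅ = from-yes (All.all? (λ G → Fin.all? (λ v → avoids? v G →-dec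
    any? (chosen? 2 (Fin._≟ v) G) (combinations 2 G))) (combinations 4 (edges 5)))

  -- Only 6 edges of K_5 avoid a given vertex.
  spanning₅ : All (λ G → ∀ v → ¬ Avoids v G) (combinations 7 (edges 5))
  spanning₅ = from-yes (All.all? (λ G → Fin.all? (λ v → ¬? (avoids? v G))) (combinations 7 (edges 5)))

choice₃ : KeyChoice 3 2 3
choice₃ ls u e⊆ ⊆e = go ls u ⊆e (length-complete ls u e⊆ ⊆e)
  where
  go : ∀ ls → Unique ls → (∀ {l} → l ∈ ls → l ∈ edges 3) → length ls ≡ length (edges 3) →
       ∃ λ S → length S ≡ 2 × Unique S × (∀ {l} → l ∈ S → l ∈ ls) × Hits S ls 3
  go (e₃ ∷ e₂ ∷ e₁ ∷ []) u ⊆e refl = early-cover (e₃ ∷ []) (e₂ ∷ e₁ ∷ []) covers₃ u ⊆e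

choice₄ : KeyChoice 4 2 4
choice₄ ls u e⊆ ⊆e = go ls u ⊆e (length-complete ls u e⊆ ⊆e)
  where
  go : ∀ ls → Unique ls → (∀ {l} → l ∈ ls → l ∈ edges 4) → length ls ≡ length (edges 4) →
       ∃ λ S → length S ≡ 2 × Unique S × (∀ {l} → l ∈ S → l ∈ ls) × Hits S ls 4
  go (e₆ ∷ e₅ ∷ e₄ ∷ e₃ ∷ e₂ ∷ e₁ ∷ []) u ⊆e refl =
    early-cover (e₆ ∷ e₅ ∷ []) (e₄ ∷ e₃ ∷ e₂ ∷ e₁ ∷ []) covers₄ u ⊆e

-- The first edges form a matching S of the vertices other than v among the
-- edges suf; e is the first edge at v.
pendant-hits : ∀ {m} {S} {v : Fin m} {suf e} pre mid → CoversBut (_≡ v) S → Unique S → (∀ {l} → l ∈ S → l ∈ suf) →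
  Avoids v mid → Touches v e → Hits (e ∷ S) (pre ++ e ∷ mid ++ suf) (length pre ℕ.+ suc (length mid ℕ.+ length S))
pendant-hits {S = S} {v} {suf} {e} pre mid cov u S⊆ avoids te = hits-++ pre cov′ id e∷S⊆ (All.tabulate (λ _ → id , id))
  (hit (inj₁ (here refl)) (hits-++ mid cov there S⊆
    (All.map (λ ¬t → (λ eq → ¬t (inj₁ (sym eq))) , (λ eq → ¬t (inj₂ (sym eq)))) avoids) (hits-⊆ u there S⊆)))
  where
  cov′ : CoversBut (λ _ → ⊥) (e ∷ S)
  cov′ w with cov w
  ... | inj₁ refl = inj₂ (here te)
  ... | inj₂ t    = inj₂ (there t)
  e∷S⊆ : ∀ {l} → l ∈ e ∷ S → l ∈ e ∷ mid ++ suf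
  e∷S⊆ (here refl) = here refl
  e∷S⊆ (there p)   = there (∈-++⁺ʳ mid (S⊆ p))

-- Of the ten edges only the two in `suf` outside the matching remain uncounted, which leaves 8.
pendant : ∀ {v : Fin 5} suf e pre mid → length suf ≡ 4 → Unique (pre ++ e ∷ mid ++ suf) →
  (∀ {l} → l ∈ pre ++ e ∷ mid ++ suf → l ∈ edges 5) → Avoids v (mid ++ suf) → Touches v e →
  ∃ λ S → length S ≡ 3 × Unique S × (∀ {l} → l ∈ S → l ∈ pre ++ e ∷ mid ++ suf) ×
          Hits S (pre ++ e ∷ mid ++ suf) (length pre ℕ.+ suc (length mid ℕ.+ 2))
pendant {v} suf e pre mid len u ⊆e avoids te =
  let u′ = unique-++⁻ʳ pre u
      G , F , G⊆ , ⊆G = by-enumeration 4 matching₅ len (unique-++⁻ʳ (e ∷ mid) u′) (⊆e ∘ ∈-++⁺ʳ pre ∘ there ∘ ∈-++⁺ʳ mid)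
      S , _ , lenS , uS , S⊆G , cov = find (F v (All.tabulate (All.lookup avoids ∘ ∈-++⁺ʳ mid ∘ G⊆)))
      S⊆ : ∀ {l} → l ∈ S → l ∈ suf
      S⊆ p = G⊆ (All.lookup S⊆G p)
  in e ∷ S , cong suc lenS , unique-∷ (λ p → All.lookup (AllPairs.head u′) (∈-++⁺ʳ mid (S⊆ p)) refl) uS ,
     (λ { (here refl) → ∈-++⁺ʳ pre (here refl) ; (there p) → ∈-++⁺ʳ pre (there (∈-++⁺ʳ mid (S⊆ p))) }) ,
     subst (λ s → Hits (e ∷ S) (pre ++ e ∷ mid ++ suf) (length pre ℕ.+ suc (length mid ℕ.+ s))) lenS
       (pendant-hits pre mid cov uS S⊆ (All.tabulate (All.lookup avoids ∘ ∈-++⁺ˡ)) te)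

choice₅ : KeyChoice 5 3 8
choice₅ ls u e⊆ ⊆e = go ls u ⊆e (length-complete ls u e⊆ ⊆e)
  where
  go : ∀ ls → Unique ls → (∀ {l} → l ∈ ls → l ∈ edges 5) → length ls ≡ length (edges 5) →
       ∃ λ S → length S ≡ 3 × Unique S × (∀ {l} → l ∈ S → l ∈ ls) × Hits S ls 8
  go (e₁₀ ∷ e₉ ∷ e₈ ∷ e₇ ∷ e₆ ∷ e₅ ∷ e₄ ∷ e₃ ∷ e₂ ∷ e₁ ∷ []) u ⊆e refl
    with by-enumeration 5 covers₅ refl (unique-++⁻ʳ (e₁₀ ∷ e₉ ∷ e₈ ∷ e₇ ∷ e₆ ∷ []) u)
           (⊆e ∘ ∈-++⁺ʳ (e₁₀ ∷ e₉ ∷ e₈ ∷ e₇ ∷ e₆ ∷ []))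
  -- The 5 later edges and the 3 edges of the cover make 8.
  ... | G , inj₁ cover , G⊆ , _ = from-cover (e₁₀ ∷ e₉ ∷ e₈ ∷ e₇ ∷ e₆ ∷ []) G⊆ cover
  ... | G , inj₂ (v , avoids) , _ , ⊆G with touches? v e₆ | touches? v e₇
  ... | yes t₆ | _      = pendant (e₄ ∷ e₃ ∷ e₂ ∷ e₁ ∷ []) e₆ (e₁₀ ∷ e₉ ∷ e₈ ∷ e₇ ∷ []) (e₅ ∷ []) refl u ⊆e
                            (All.tabulate (All.lookup avoids ∘ ⊆G)) t₆
  ... | no ¬t₆ | yes t₇ = pendant (e₄ ∷ e₃ ∷ e₂ ∷ e₁ ∷ []) e₇ (e₁₀ ∷ e₉ ∷ e₈ ∷ []) (e₆ ∷ e₅ ∷ []) refl u ⊆e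
                            (¬t₆ ∷ All.tabulate (All.lookup avoids ∘ ⊆G)) t₇
  -- The first edge at v is the sixth or the seventh, since seven edges cannot all avoid v.
  ... | no ¬t₆ | no ¬t₇ with by-enumeration 7 spanning₅ refl (unique-++⁻ʳ (e₁₀ ∷ e₉ ∷ e₈ ∷ []) u)
                               (⊆e ∘ ∈-++⁺ʳ (e₁₀ ∷ e₉ ∷ e₈ ∷ []))
  ...   | G₇ , F , G₇⊆ , _ = contradiction
            (All.tabulate (All.lookup (¬t₇ ∷ ¬t₆ ∷ All.tabulate (All.lookup avoids ∘ ⊆G)) ∘ G₇⊆)) (F v)

-- Eventual behaviour of Cauchy sequences

Eventually : (ℕ → Set) → Set
Eventually P = ∃ λ N → ∀ n → N ℕ.≤ n → P n

map-ev : ∀ {P Q} → (∀ {n} → P n → Q n) → Eventually P → Eventually Q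
map-ev f (N , h) = N , λ n N≤n → f (h n N≤n)

infixr 4 _∧-ev_

_∧-ev_ : ∀ {P Q} → Eventually P → Eventually Q → Eventually (λ n → P n × Q n)
(M , g) ∧-ev (N , h) = M ℕ.⊔ N , λ n le → g n (ℕ.m⊔n≤o⇒m≤o M N le) , h n (ℕ.m⊔n≤o⇒n≤o M N le)

seq-^ : ∀ x n k → seq (x ^ n) k ≡ seq x k ^ℚ n
seq-^ x zero    k = refl
seq-^ x (suc n) k = cong (seq x k ℚ.*_) (seq-^ x n k)

∣-∣⇒≤ : ∀ {x y ε} → ℚ.∣ x ℚ.- y ∣ ℚ.≤ ε → x ℚ.≤ y ℚ.+ ε
∣-∣⇒≤ {x} {y} {ε} h = ≤-from-diff (ℚ.≤-trans (0≤y-x (ℚ.≤-trans (p≤∣p∣ (x ℚ.- y)) h))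
  (ℚ.≤-reflexive (solve 3 (λ x y e → e :- (x :- y) := (y :+ e) :- x) refl x y ε)))
  where
  p≤∣p∣ : ∀ p → p ℚ.≤ ℚ.∣ p ∣
  p≤∣p∣ p with ℚ.≤-total 0ℚ p
  ... | inj₁ 0≤p = ℚ.≤-reflexive (sym (ℚ.0≤p⇒∣p∣≡p 0≤p))
  ... | inj₂ p≤0 = ℚ.≤-trans p≤0 (ℚ.0≤∣p∣ p)

∣-∣⇒≥ : ∀ {x y ε} → ℚ.∣ x ℚ.- y ∣ ℚ.≤ ε → y ℚ.≤ x ℚ.+ ε
∣-∣⇒≥ {x} {y} h = ∣-∣⇒≤ {y} {x} (ℚ.≤-trans (ℚ.≤-reflexive flip) h)
  where
  flip : ℚ.∣ y ℚ.- x ∣ ≡ ℚ.∣ x ℚ.- y ∣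
  flip = trans (cong ℚ.∣_∣ (solve 2 (λ x y → y :- x := con 0ℚ :- (x :- y)) refl x y))
    (trans (cong ℚ.∣_∣ (ℚ.+-identityˡ (ℚ.- (x ℚ.- y)))) (ℚ.∣-p∣≡∣p∣ (x ℚ.- y)))

x≤x+y : ∀ x {y} → 0ℚ ℚ.≤ y → x ℚ.≤ x ℚ.+ y
x≤x+y x {y} 0≤y = ℚ.≤-trans (ℚ.≤-reflexive (sym (ℚ.+-identityʳ x))) (ℚ.+-monoʳ-≤ x 0≤y)

eventually-positive : ∀ {x} → 0ℝ < x → Eventually (λ n → 0ℚ ℚ.≤ seq x n)
eventually-positive (ε , 0<ε , N , h) = N , λ n le →
  ℚ.≤-trans (ℚ.<⇒≤ 0<ε) (ℚ.≤-trans (ℚ.≤-reflexive (sym (ℚ.+-identityˡ ε))) (h n le))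

eventually-<1 : ∀ {x} → x < 1ℝ → Eventually (λ n → seq x n ℚ.≤ 1ℚ)
eventually-<1 {x} (ε , 0<ε , N , h) = N , λ n le → ℚ.≤-trans (x≤x+y (seq x n) (ℚ.<⇒≤ 0<ε)) (h n le)

^≤ : ∀ {x} n → 0ℚ ℚ.≤ x → x ℚ.≤ 1ℚ → x ^ℚ suc n ℚ.≤ x
^≤ {x} n 0≤x x≤1 = ℚ.≤-trans (*-monoˡ x 0≤x (ℚ.≤-trans (^-mono n 0≤x x≤1) (ℚ.≤-reflexive (1^ n))))
  (ℚ.≤-reflexive (ℚ.*-identityʳ x))

-- Lower bound for f(H, p) from a bound on success probabilities.

⅛ ¼ 2ℚ : ℚ
⅛ = ℤ.+ 1 ℚ./ 8
¼ = ℤ.+ 1 ℚ./ 4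
2ℚ = ℤ.+ 2 ℚ./ 1

0≤⅛ : 0ℚ ℚ.≤ ⅛
0≤⅛ = from-yes (0ℚ ℚ.≤? ⅛)

0<⅛ : 0ℚ ℚ.< ⅛
0<⅛ = from-yes (0ℚ ℚ.<? ⅛)

-- With B = b + 1, the base n^B q^a is at most 2/8^B ≤ 1/4, and a further power of a number in
-- [0, 1] does not exceed it. The outer power is there for K_4, where the bound n^2 q^4 is the
-- square of n q^2.
small-power : ∀ a b r {n q y} → 0ℚ ℚ.≤ n → 0ℚ ℚ.≤ q → n ℚ.≤ ⅛ ℚ.* y →
  y ^ℚ suc b ℚ.* q ^ℚ a ℚ.≤ 2ℚ → n ^ℚ (suc r ℕ.* suc b) ℚ.* q ^ℚ (suc r ℕ.* a) ℚ.≤ ¼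
small-power a b r {n} {q} {y} 0≤n 0≤q n≤ yq≤2 = begin
  n ^ℚ (suc r ℕ.* suc b) ℚ.* q ^ℚ (suc r ℕ.* a)
    ≡⟨ cong₂ ℚ._*_ (^-*-assoc n (suc r) (suc b)) (^-*-assoc q (suc r) a) ⟩
  (n ^ℚ suc b) ^ℚ suc r ℚ.* (q ^ℚ a) ^ℚ suc r          ≡⟨ ^-distrib-* (n ^ℚ suc b) (q ^ℚ a) (suc r) ⟨
  (n ^ℚ suc b ℚ.* q ^ℚ a) ^ℚ suc r                     ≤⟨ ^≤ r 0≤nq (ℚ.≤-trans nq≤¼ (from-yes (¼ ℚ.≤? 1ℚ))) ⟩
  n ^ℚ suc b ℚ.* q ^ℚ a                                ≤⟨ nq≤¼ ⟩
  ¼                                                    ∎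
  where
  open ℚ.≤-Reasoning
  0≤nq : 0ℚ ℚ.≤ n ^ℚ suc b ℚ.* q ^ℚ a
  0≤nq = 0≤* (0≤^ (suc b) 0≤n) (0≤^ a 0≤q)
  nq≤¼ : n ^ℚ suc b ℚ.* q ^ℚ a ℚ.≤ ¼
  nq≤¼ = begin
    n ^ℚ suc b ℚ.* q ^ℚ a                   ≤⟨ *-monoʳ (q ^ℚ a) (0≤^ a 0≤q) (^-mono (suc b) 0≤n n≤) ⟩
    (⅛ ℚ.* y) ^ℚ suc b ℚ.* q ^ℚ a           ≡⟨ cong (ℚ._* q ^ℚ a) (^-distrib-* ⅛ y (suc b)) ⟩
    ⅛ ^ℚ suc b ℚ.* y ^ℚ suc b ℚ.* q ^ℚ a    ≡⟨ ℚ.*-assoc (⅛ ^ℚ suc b) _ _ ⟩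
    ⅛ ^ℚ suc b ℚ.* (y ^ℚ suc b ℚ.* q ^ℚ a)  ≤⟨ *-monoˡ (⅛ ^ℚ suc b) (0≤^ (suc b) 0≤⅛) yq≤2 ⟩
    ⅛ ^ℚ suc b ℚ.* 2ℚ
      ≤⟨ *-monoʳ 2ℚ (from-yes (0ℚ ℚ.≤? 2ℚ)) (^≤ b 0≤⅛ (from-yes (⅛ ℚ.≤? 1ℚ))) ⟩
    ⅛ ℚ.* 2ℚ                                ≡⟨⟩
    ¼                                       ∎

-- At a late term either y/8 ≤ n already, or the success probability is at most 1/4. The latter
-- contradicts a limit of at least 1/2, as 1/4 + 1/8 < 1/2. Comparing rational terms avoids deciding
-- an inequality between reals.
lower-bound : ∀ {H} a b r →
  (∀ q → 0ℚ ℚ.≤ q → q ℚ.≤ 1ℚ → ∀ {n} (σ : Strategy [] n) →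
     prob H q σ ℚ.≤ ⟦ n ⟧ ^ℚ (suc r ℕ.* suc b) ℚ.* q ^ℚ (suc r ℕ.* a)) →
  ∀ p → 0ℝ < p → p < 1ℝ → ∀ y → y Is p ^- a / suc b → (fromℚ ⅛ * y) ≤f[ H , p ]
lower-bound {H} a b r bound p 0<p p<1 y (_ , y^b*p^a≈1) n (σ , ½≤) ε 0<ε =
  map-ev (λ {k} → step k)
    (eventually-positive {p} 0<p ∧-ev eventually-<1 {p} p<1 ∧-ev y^b*p^a≈1 1ℚ (from-yes (0ℚ ℚ.<? 1ℚ)) ∧-ev ½≤ ⅛ 0<⅛)
  where
  step : ∀ k → 0ℚ ℚ.≤ seq p k × seq p k ℚ.≤ 1ℚ ×
         ℚ.∣ seq (y ^ suc b * p ^ a) k ℚ.- 1ℚ ∣ ℚ.≤ 1ℚ × ½ ℚ.≤ seq (successProb H p σ) k ℚ.+ ⅛ →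
         ⅛ ℚ.* seq y k ℚ.≤ ⟦ n ⟧ ℚ.+ ε
  step k (0≤q , q≤1 , close , ½≤P) with ℚ.≤-total (⅛ ℚ.* seq y k) ⟦ n ⟧
  ... | inj₁ le = ℚ.≤-trans le (x≤x+y ⟦ n ⟧ (ℚ.<⇒≤ 0<ε))
  ... | inj₂ n≤ = contradiction (ℚ.≤-trans ½≤P (ℚ.+-monoˡ-≤ ⅛ P≤¼)) (from-no (½ ℚ.≤? ¼ ℚ.+ ⅛))
    where
    yq≤2 : seq y k ^ℚ suc b ℚ.* seq p k ^ℚ a ℚ.≤ 2ℚ
    yq≤2 = subst (ℚ._≤ 2ℚ) (cong₂ ℚ._*_ (seq-^ y (suc b) k) (seq-^ p a k)) (∣-∣⇒≤ {seq (y ^ suc b * p ^ a) k} {1ℚ} close)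
    P≤¼ : seq (successProb H p σ) k ℚ.≤ ¼
    P≤¼ = ℚ.≤-trans (ℚ.≤-reflexive (seq-prob H p σ k)) (ℚ.≤-trans (bound (seq p k) 0≤q q≤1 σ)
      (small-power a b r {y = seq y k} (0≤⟦⟧ n) 0≤q n≤ yq≤2))

-- Histories and fresh vertices

Queried : History → ℤ.ℤ → ℤ.ℤ → Set
Queried h u v = Any (λ (e , _) → Joins e u v) h

joins-sym : ∀ {e u v} → Joins e u v → Joins e v u
joins-sym (inj₁ p) = inj₂ p
joins-sym (inj₂ p) = inj₁ p

built-symmetric : ∀ {h u v} → Built h u v → Built h v u
built-symmetric = Any.map λ { {e , _} (t , js) → t , joins-sym {e} js }

built⇒≢ : ∀ {h u v} → Built h u v → u ≢ v
built⇒≢ b refl with Any.satisfied b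
... | (e , _) , _ , inj₁ (p , q) = lo≢hi e (trans p (sym q))
... | (e , _) , _ , inj₂ (p , q) = lo≢hi e (trans p (sym q))

pair : ∀ u v → u ≢ v → ∃ λ e → Joins e u v
pair u v u≢v with ℤ.<-cmp u v
... | tri< u<v _ _ = mkPair u v u<v , inj₁ (refl , refl)
... | tri≈ _ u≡v _ = contradiction u≡v u≢v
... | tri> _ _ v<u = mkPair v u v<u , inj₂ (refl , refl)

-- h′ arises from h by queries that all involve a vertex in D.
record Extends (D : List ℤ.ℤ) (h h′ : History) : Set where
  field
    keeps : ∀ {u v} → Built h u v → Built h′ u v
    old   : ∀ {u v} → Queried h′ u v → Queried h u v ⊎ (u ∈ D ⊎ v ∈ D)

open Extends

extends-refl : ∀ {D h} → Extends D h h
extends-refl = record { keeps = id ; old = inj₁ }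

extends-trans : ∀ {D h h′ h″} → Extends D h h′ → Extends D h′ h″ → Extends D h h″
extends-trans x y = record
  { keeps = keeps y ∘ keeps x
  ; old   = λ q → case old y q of λ { (inj₁ q′) → old x q′ ; (inj₂ d) → inj₂ d } }

extends-⊆ : ∀ {D D′ h h′} → (∀ {x} → x ∈ D → x ∈ D′) → Extends D h h′ → Extends D′ h h′
extends-⊆ sub x = record
  { keeps = keeps x
  ; old   = λ q → case old x q of λ
      { (inj₁ q′) → inj₁ q′ ; (inj₂ (inj₁ d)) → inj₂ (inj₁ (sub d)) ; (inj₂ (inj₂ d)) → inj₂ (inj₂ (sub d)) } }

-- The pool of vertices among which every pair may still be queried, which is what keeps the
-- strategies legal.
record Fresh (h : History) (R : List ℤ.ℤ) : Set where
  field
    distinct  : Unique R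
    unqueried : ∀ {u v} → u ∈ R → v ∈ R → ¬ Queried h u v

open Fresh

fresh-↭ : ∀ {h R R′} → R ↭ R′ → Fresh h R → Fresh h R′
fresh-↭ p f = record
  { distinct  = PermutationSetoid.Unique-resp-↭ (setoid ℤ.ℤ) (↭⇒↭ₛ p) (distinct f)
  ; unqueried = λ u∈ v∈ → unqueried f (∈-resp-↭ (↭-sym p) u∈) (∈-resp-↭ (↭-sym p) v∈) }

disjoint : ∀ {D R : List ℤ.ℤ} {x} → Unique (D ++ R) → x ∈ D → ¬ x ∈ R
disjoint {x ∷ D} (x∉ ∷ u) (here refl) q = All.lookup x∉ (∈-++⁺ʳ D q) refl
disjoint         (x∉ ∷ u) (there p)   q = disjoint u p q

-- Each new query touches D, and D does not meet R.
fresh-stays : ∀ {D R h h′} → Unique (D ++ R) → Fresh h R → Extends D h h′ → Fresh h′ R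
fresh-stays u f x = record
  { distinct  = distinct f
  ; unqueried = λ u∈ v∈ q → case old x q of λ
      { (inj₁ q′)        → unqueried f u∈ v∈ q′
      ; (inj₂ (inj₁ u∈D)) → disjoint u u∈D u∈
      ; (inj₂ (inj₂ v∈D)) → disjoint u v∈D v∈ } }

fresh-++⁻ʳ : ∀ {h} D {R} → Fresh h (D ++ R) → Fresh h R
fresh-++⁻ʳ D f = record
  { distinct  = unique-++⁻ʳ D (distinct f)
  ; unqueried = λ u∈ v∈ → unqueried f (∈-++⁺ʳ D u∈) (∈-++⁺ʳ D v∈) }

fresh-++⁻ˡ : ∀ {h} R {D} → Fresh h (R ++ D) → Fresh h R
fresh-++⁻ˡ R {D} f = fresh-++⁻ʳ D (fresh-↭ (++-comm R D) f)

fresh-extend : ∀ {h h′} D {R} → Fresh h (D ++ R) → Extends D h h′ → Fresh h′ R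
fresh-extend D f x = fresh-stays (distinct f) (fresh-++⁻ʳ D f) x

fresh-head : ∀ {h u v R} → Fresh h (u ∷ v ∷ R) → u ≢ v
fresh-head f = All.head (AllPairs.head (distinct f))

-- Injectivity follows from adjacency, because a built edge has distinct ends.
clique⇒copy : ∀ {h} vs → AllPairs (Built h) vs → ContainsCopy (K (length vs)) h
clique⇒copy {h} vs c = lookup vs , injective c , λ i j → adjacent c {i} {j}
  where
  adjacent : ∀ {vs} → AllPairs (Built h) vs → ∀ {i j} → i ≢ j → Built h (lookup vs i) (lookup vs j)
  adjacent (a ∷ c) {Fin.zero}  {Fin.zero}  i≢j = contradiction refl i≢j
  adjacent {_ ∷ vs} (a ∷ c) {Fin.zero}  {Fin.suc j} i≢j = All.lookup a (∈-lookup j)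
  adjacent {_ ∷ vs} (a ∷ c) {Fin.suc i} {Fin.zero}  i≢j = built-symmetric (All.lookup a (∈-lookup i))
  adjacent (a ∷ c) {Fin.suc i} {Fin.suc j} i≢j = adjacent c (i≢j ∘ cong Fin.suc)
  injective : ∀ {vs} → AllPairs (Built h) vs → ∀ {i j} → lookup vs i ≡ lookup vs j → i ≡ j
  injective c {i} {j} eq with i Fin.≟ j
  ... | yes i≡j = i≡j
  ... | no  i≢j = contradiction eq (built⇒≢ (adjacent c i≢j))

-- Failure probabilities

-- The loss of a phase that fails with probability θ, where c is the loss after success and B the
-- loss after failure. In this form monotonicity in θ is just c ≤ B.
mix : ℚ → ℚ → ℚ → ℚ
mix θ c B = c ℚ.+ θ ℚ.* (B ℚ.- c)

mix-mono : ∀ {θ θ′ c B} → θ ℚ.≤ θ′ → c ℚ.≤ B → mix θ c B ℚ.≤ mix θ′ c B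
mix-mono {c = c} {B} θ≤ c≤B = ℚ.+-monoʳ-≤ c (*-monoʳ (B ℚ.- c) (0≤y-x c≤B) θ≤)

mix-0 : ∀ c B → mix 0ℚ c B ≡ c
mix-0 = solve 2 (λ c B → c :+ con 0ℚ :* (B :- c) := c) refl

mix-1 : ∀ c B → mix 1ℚ c B ≡ B
mix-1 = solve 2 (λ c B → c :+ con 1ℚ :* (B :- c) := B) refl

c≤mix : ∀ {θ c B} → 0ℚ ℚ.≤ θ → c ℚ.≤ B → c ℚ.≤ mix θ c B
c≤mix {θ} {c} {B} 0≤θ c≤B = ℚ.≤-trans (ℚ.≤-reflexive (sym (mix-0 c B))) (mix-mono 0≤θ c≤B)

B≤mix : ∀ {θ c B} → 1ℚ ℚ.≤ θ → c ℚ.≤ B → B ℚ.≤ mix θ c B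
B≤mix {θ} {c} {B} 1≤θ c≤B = ℚ.≤-trans (ℚ.≤-reflexive (sym (mix-1 c B))) (mix-mono 1≤θ c≤B)

mix≤B : ∀ {θ c B} → θ ℚ.≤ 1ℚ → c ℚ.≤ B → mix θ c B ℚ.≤ B
mix≤B {θ} {c} {B} θ≤1 c≤B = ℚ.≤-trans (mix-mono θ≤1 c≤B) (ℚ.≤-reflexive (mix-1 c B))

-- Alternatives tried in turn: failure requires both to fail.
mix-mix : ∀ θ η c B → mix θ c (mix η c B) ≡ mix (θ ℚ.* η) c B
mix-mix = solve 4 (λ θ η c B → c :+ θ :* (c :+ η :* (B :- c) :- c) := c :+ θ :* η :* (B :- c)) refl

infixl 6 _∨ℚ_

-- The probability that one of two independent events of probabilities θ and η occurs.
_∨ℚ_ : ℚ → ℚ → ℚ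
θ ∨ℚ η = θ ℚ.+ η ℚ.- θ ℚ.* η

-- Two steps that must both succeed: either failure leads to B.
mix-∨ : ∀ θ η c B → mix θ (mix η c B) B ≡ mix (θ ∨ℚ η) c B
mix-∨ = solve 4 (λ θ η c B → let d = c :+ η :* (B :- c) in
  d :+ θ :* (B :- d) := c :+ (θ :+ η :- θ :* η) :* (B :- c)) refl

^≤1 : ∀ {θ} n → 0ℚ ℚ.≤ θ → θ ℚ.≤ 1ℚ → θ ^ℚ n ℚ.≤ 1ℚ
^≤1 n 0≤θ θ≤1 = ℚ.≤-trans (^-mono n 0≤θ θ≤1) (ℚ.≤-reflexive (1^ n))

0≤∨ : ∀ {θ η} → θ ℚ.≤ 1ℚ → 0ℚ ℚ.≤ θ → 0ℚ ℚ.≤ η → 0ℚ ℚ.≤ θ ∨ℚ η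
0≤∨ {θ} {η} θ≤1 0≤θ 0≤η = ℚ.≤-trans (0≤+ 0≤θ (0≤* 0≤η (0≤y-x θ≤1)))
  (ℚ.≤-reflexive (solve 2 (λ θ η → θ :+ η :* (con 1ℚ :- θ) := θ :+ η :- θ :* η) refl θ η))

-- Building blocks of Builder's strategies.

module Builder (H : Graph) (ρ : ℚ) (0≤ρ : 0ℚ ℚ.≤ ρ) (ρ≤1 : ρ ℚ.≤ 1ℚ) where

  -- After h, some strategy with n turns fails with probability at most ℓ,
  -- whatever the edge probability q ≥ ρ.
  Loses : History → ℕ → ℚ → Set
  Loses h n ℓ = ∃ λ (σ : Strategy h n) → ∀ q → ρ ℚ.≤ q → q ℚ.≤ 1ℚ → 1ℚ ℚ.≤ prob H q σ ℚ.+ ℓ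

  give-up : ∀ {h n ℓ} → 1ℚ ℚ.≤ ℓ → Loses h n ℓ
  give-up {h} {ℓ = ℓ} 1≤ℓ = stop , λ q _ _ → ℚ.≤-trans 1≤ℓ
    (ℚ.≤-trans (ℚ.≤-reflexive (sym (ℚ.+-identityˡ ℓ))) (ℚ.+-monoˡ-≤ ℓ (0≤indicator (containsCopy? H h))))
    where
    0≤indicator : ∀ {A : Set} (d : Dec A) → 0ℚ ℚ.≤ (if does d then 1ℚ else 0ℚ)
    0≤indicator (yes _) = 0≤1
    0≤indicator (no _)  = ℚ.≤-refl

  found : ∀ {h n ℓ} → ContainsCopy H h → 0ℚ ℚ.≤ ℓ → Loses h n ℓ
  found {h} copy 0≤ℓ = stop , λ q _ _ → ℚ.≤-trans (1≤indicator (containsCopy? H h)) (x≤x+y _ 0≤ℓ)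
    where
    1≤indicator : ∀ (d : Dec (ContainsCopy H h)) → 1ℚ ℚ.≤ (if does d then 1ℚ else 0ℚ)
    1≤indicator (yes _) = ℚ.≤-refl
    1≤indicator (no ¬c) = contradiction copy ¬c

  lengthen : ∀ {h n n′} → n ℕ.≤ n′ → Strategy h n → Strategy h n′
  lengthen le         stop                = stop
  lengthen (ℕ.s≤s le) (query e e∉ σ₁ σ₀) = query e e∉ (lengthen le σ₁) (lengthen le σ₀)

  prob-lengthen : ∀ {h n n′} q (le : n ℕ.≤ n′) (σ : Strategy h n) → prob H q (lengthen le σ) ≡ prob H q σ
  prob-lengthen q le         stop               = refl
  prob-lengthen q (ℕ.s≤s le) (query e e∉ σ₁ σ₀) =
    cong₂ (λ x y → q ℚ.* x ℚ.+ (1ℚ ℚ.- q) ℚ.* y) (prob-lengthen q le σ₁) (prob-lengthen q le σ₀)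

  weaken : ∀ {h n n′ ℓ ℓ′} → n ℕ.≤ n′ → ℓ ℚ.≤ ℓ′ → Loses h n ℓ → Loses h n′ ℓ′
  weaken {ℓ = ℓ} le ℓ≤ (σ , w) = lengthen le σ , λ q ρ≤q q≤1 →
    ℚ.≤-trans (w q ρ≤q q≤1) (ℚ.+-mono-≤ (ℚ.≤-reflexive (sym (prob-lengthen q le σ))) ℓ≤)

  -- Bounds the failure probability of a single query, as q ≥ ρ.
  x : ℚ
  x = 1ℚ ℚ.- ρ

  0≤x : 0ℚ ℚ.≤ x
  0≤x = 0≤y-x ρ≤1

  x≤1 : x ℚ.≤ 1ℚ
  x≤1 = ≤-from-diff (ℚ.≤-trans 0≤ρ (ℚ.≤-reflexive (solve 1 (λ r → r := con 1ℚ :- (con 1ℚ :- r)) refl ρ)))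

  -- By c ≤ B a larger q can only help, so the worst case is q = ρ; the excess is (q - ρ)(B - c).
  query-loses : ∀ {h n c B} e → e ∉ queried h → c ℚ.≤ B →
    Loses ((e , true) ∷ h) n c → Loses ((e , false) ∷ h) n B → Loses h (suc n) (mix x c B)
  query-loses {c = c} {B} e e∉ c≤B (σ₁ , w₁) (σ₀ , w₀) = query e e∉ σ₁ σ₀ , λ q ρ≤q q≤1 →
    let P₁ = prob H q σ₁
        P₀ = prob H q σ₀
    in ≤-from-diff (ℚ.≤-trans
      (0≤+ (0≤* (ℚ.≤-trans 0≤ρ ρ≤q) (0≤y-x (w₁ q ρ≤q q≤1)))
        (0≤+ (0≤* (0≤y-x q≤1) (0≤y-x (w₀ q ρ≤q q≤1))) (0≤* (0≤y-x ρ≤q) (0≤y-x c≤B))))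
      (ℚ.≤-reflexive (solve 6 (λ q r c B P₁ P₀ →
        q :* (P₁ :+ c :- con 1ℚ) :+ ((con 1ℚ :- q) :* (P₀ :+ B :- con 1ℚ) :+ (q :- r) :* (B :- c))
          := (q :* P₁ :+ (con 1ℚ :- q) :* P₀) :+ (c :+ (con 1ℚ :- r) :* (B :- c)) :- con 1ℚ)
        refl q ρ c B P₁ P₀)))

  -- Strategies are composed by continuations that see the new history only through `Extends`. Both
  -- ends are reported, so the caller may regard either u or v as the vertex used up.
  query-vertices : ∀ {h n c B} u v → u ≢ v → ¬ Queried h u v → c ℚ.≤ B →
    (∀ {h′} → Extends (u ∷ []) h h′ → Extends (v ∷ []) h h′ → Built h′ u v → Loses h′ n c) →
    (∀ {h′} → Extends (u ∷ []) h h′ → Extends (v ∷ []) h h′ → Loses h′ n B) →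
    Loses h (suc n) (mix x c B)
  query-vertices {h} u v u≢v unq c≤B yes-case no-case with pair u v u≢v
  ... | e , js = query-loses e (λ e∈ → unq (find-query h e∈)) c≤B
        (yes-case (extend at-u) (extend at-v) (here (_ , js))) (no-case (extend at-u) (extend at-v))
    where
    find-query : ∀ h → e ∈ queried h → Queried h u v
    find-query (_ ∷ h) (here refl) = here js
    find-query (_ ∷ h) (there p)   = there (find-query h p)
    at-u : ∀ {a b} → Joins e a b → a ∈ u ∷ [] ⊎ b ∈ u ∷ []
    at-u p = case (js , p) of λ
      { (inj₁ (a , b) , inj₁ (c , d)) → inj₁ (here (trans (sym c) a))
      ; (inj₁ (a , b) , inj₂ (c , d)) → inj₂ (here (trans (sym c) a))
      ; (inj₂ (a , b) , inj₁ (c , d)) → inj₂ (here (trans (sym d) b))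
      ; (inj₂ (a , b) , inj₂ (c , d)) → inj₁ (here (trans (sym d) b)) }
    at-v : ∀ {a b} → Joins e a b → a ∈ v ∷ [] ⊎ b ∈ v ∷ []
    at-v p = case (js , p) of λ
      { (inj₁ (a , b) , inj₁ (c , d)) → inj₂ (here (trans (sym d) b))
      ; (inj₁ (a , b) , inj₂ (c , d)) → inj₁ (here (trans (sym d) b))
      ; (inj₂ (a , b) , inj₁ (c , d)) → inj₁ (here (trans (sym c) a))
      ; (inj₂ (a , b) , inj₂ (c , d)) → inj₂ (here (trans (sym c) a)) }
    extend : ∀ {D r} → (∀ {a b} → Joins e a b → a ∈ D ⊎ b ∈ D) → Extends D h ((e , r) ∷ h)
    extend at = record { keeps = there ; old = λ { (here p) → inj₂ (at p) ; (there q) → inj₁ q } }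

  query-fresh : ∀ {h n c B u v R} → Fresh h (u ∷ v ∷ R) → c ℚ.≤ B →
    (∀ {h′} → Extends (u ∷ []) h h′ → Extends (v ∷ []) h h′ → Fresh h′ (u ∷ R) → Built h′ u v → Loses h′ n c) →
    (∀ {h′} → Extends (u ∷ []) h h′ → Extends (v ∷ []) h h′ → Fresh h′ (u ∷ R) → Loses h′ n B) →
    Loses h (suc n) (mix x c B)
  query-fresh {u = u} {v} f c≤B yes-case no-case =
    query-vertices u v (fresh-head f) (unqueried f (here refl) (there (here refl))) c≤B
      (λ eu ev → yes-case eu ev (fresh-extend (v ∷ []) f′ ev)) (λ eu ev → no-case eu ev (fresh-extend (v ∷ []) f′ ev))
    where f′ = fresh-↭ (↭-swap u v ↭-refl) f

  -- The search stops at the first neighbour. All its queries involve a, so the vertices of `rest`,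
  -- whether tried or not, remain usable among themselves.
  search : ∀ {n h c B a} bs → Fresh h (a ∷ bs) → c ℚ.≤ B →
    (∀ {h′ b rest} → Extends (a ∷ []) h h′ → Extends bs h h′ → b ∷ rest ↭ bs → Built h′ a b → Loses h′ n c) →
    (∀ {h′} → Extends (a ∷ []) h h′ → Loses h′ n B) →
    Loses h (length bs ℕ.+ n) (mix (x ^ℚ length bs) c B)
  search {c = c} {B} [] f c≤B success failure = weaken ℕ.≤-refl (ℚ.≤-reflexive (sym (mix-1 c B))) (failure extends-refl)
  search {n} {c = c} {B} (b ∷ bs) f c≤B success failure =
    weaken ℕ.≤-refl (ℚ.≤-reflexive (mix-mix x (x ^ℚ length bs) c B))
      (query-fresh f (c≤mix (0≤^ (length bs) 0≤x) c≤B)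
        (λ e eb _ ab → weaken (ℕ.m≤n+m n (length bs)) ℚ.≤-refl
          (success e (extends-⊆ (λ { (here p) → here p }) eb) ↭-refl ab))
        (λ e eb f′ → search bs f′ c≤B
          (λ { {b = b′} e′ ebs p ab → success (extends-trans e e′)
                 (extends-trans (extends-⊆ (λ { (here p) → here p }) eb) (extends-⊆ there ebs))
                 (↭-trans (↭-swap b′ b ↭-refl) (↭-prep b p)) ab })
          (λ e′ → failure (extends-trans e e′))))

  -- Equals 1 - ρ^2, a bound on the chance that a given vertex is not a common neighbour of two
  -- others.
  z : ℚ
  z = x ∨ℚ x

  -- Each candidate takes at most two queries, the second only after the first succeeds. Freshness
  -- is assumed for a and for b separately, because the pair ab itself has been queried.
  common-neighbour : ∀ {n h c B a b} cs → Fresh h (a ∷ cs) → Fresh h (b ∷ cs) → a ≢ b → 0ℚ ℚ.≤ z → c ℚ.≤ B →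
    (∀ {h′ w} → Extends (a ∷ b ∷ []) h h′ → w ∈ cs → Built h′ a w → Built h′ b w → Loses h′ n c) →
    (∀ {h′} → Extends (a ∷ b ∷ []) h h′ → Loses h′ n B) →
    Loses h (length cs ℕ.* 2 ℕ.+ n) (mix (z ^ℚ length cs) c B)
  common-neighbour {c = c} {B} [] fa fb a≢b 0≤z c≤B success failure =
    weaken ℕ.≤-refl (ℚ.≤-reflexive (sym (mix-1 c B))) (failure extends-refl)
  common-neighbour {n} {h} {c} {B} {a} {b} (w ∷ cs) fa fb a≢b 0≤z c≤B success failure =
    weaken ℕ.≤-refl (ℚ.≤-reflexive (trans (mix-∨ x x c R) (mix-mix z (z ^ℚ length cs) c B)))
      (query-fresh fa (mix≤B x≤1 c≤R)
        (λ ea _ fa′ aw → query-fresh (fresh-stays u-a fb ea) c≤R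
          (λ eb _ _ bw → weaken (ℕ.m≤n+m n (length cs ℕ.* 2)) ℚ.≤-refl
            (success (both ea eb) (here refl) (keeps eb aw) bw))
          (λ eb _ fb′ → continue (both ea eb) (fresh-stays u-b fa′ eb) fb′))
        (λ ea _ fa′ → weaken (ℕ.n≤1+n _) ℚ.≤-refl
          (continue (extends-⊆ (λ { (here p) → here p }) ea) fa′
            (fresh-++⁻ʳ (w ∷ []) (fresh-↭ (↭-swap b w ↭-refl) (fresh-stays u-a fb ea))))))
    where
    R : ℚ
    R = mix (z ^ℚ length cs) c B
    c≤R : c ℚ.≤ R
    c≤R = c≤mix (0≤^ (length cs) 0≤z) c≤B
    u-a : Unique (a ∷ b ∷ w ∷ cs)
    u-a = (a≢b ∷ AllPairs.head (distinct fa)) ∷ distinct fb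
    u-b : Unique (b ∷ a ∷ cs)
    u-b = (a≢b ∘ sym ∷ All.tail (AllPairs.head (distinct fb))) ∷
          All.tail (AllPairs.head (distinct fa)) ∷ AllPairs.tail (AllPairs.tail (distinct fa))
    both : ∀ {h′ h″} → Extends (a ∷ []) h h′ → Extends (b ∷ []) h′ h″ → Extends (a ∷ b ∷ []) h h″
    both ea eb = extends-trans (extends-⊆ (λ { (here p) → here p }) ea) (extends-⊆ there eb)
    continue : ∀ {h′} → Extends (a ∷ b ∷ []) h h′ → Fresh h′ (a ∷ cs) → Fresh h′ (b ∷ cs) →
               Loses h′ (length cs ℕ.* 2 ℕ.+ n) R
    continue e fa′ fb′ = common-neighbour cs fa′ fb′ a≢b 0≤z c≤B
      (λ e′ w∈ → success (extends-trans e e′) (there w∈)) (λ e′ → failure (extends-trans e e′))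

  -- Each round uses up one a and at most one b. The slack of |`as`| vertices in `bs` thus keeps
  -- `nb` candidates available in every round, while `cs` can serve all rounds since its vertices
  -- always meet new partners.
  triangle : ∀ {n h B} D nb as bs cs → Fresh h (as ++ cs ++ bs) → (∀ {y} → y ∈ as ++ cs ++ bs → y ∈ D) →
    nb ℕ.+ length as ℕ.≤ length bs → 0ℚ ℚ.≤ z → z ℚ.≤ 1ℚ → 0ℚ ℚ.≤ B →
    (∀ {h′ a b c} → Extends D h h′ → a ∈ D → b ∈ D → c ∈ D →
       Built h′ a b → Built h′ a c → Built h′ b c → ContainsCopy H h′) →
    (∀ {h′} → Extends D h h′ → Loses h′ n B) →
    Loses h (length as ℕ.* (nb ℕ.+ length cs ℕ.* 2) ℕ.+ n) (mix ((x ^ℚ nb ∨ℚ z ^ℚ length cs) ^ℚ length as) 0ℚ B)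
  triangle {B = B} D nb [] bs cs f R⊆D nb≤ 0≤z z≤1 0≤B success failure =
    weaken ℕ.≤-refl (ℚ.≤-reflexive (sym (mix-1 0ℚ B))) (failure extends-refl)
  triangle {n} {h} {B} D nb (a ∷ as) bs cs f R⊆D nb≤ 0≤z z≤1 0≤B success failure =
    weaken (ℕ.≤-reflexive budget)
      (ℚ.≤-reflexive (trans (mix-∨ (x ^ℚ nb) (z ^ℚ length cs) 0ℚ R) (mix-mix θ (θ ^ℚ length as) 0ℚ B)))
      (subst (λ k → Loses h (length b₁ ℕ.+ (length cs ℕ.* 2 ℕ.+ n′)) (mix (x ^ℚ k) (mix (z ^ℚ length cs) 0ℚ R) R)) len-b₁
        (search b₁ fresh-b₁ (mix≤B (^≤1 (length cs) 0≤z z≤1) 0≤R)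
          (λ ea eb₁ p ab → found-edge ea eb₁ p ab)
          -- Without an edge at a, the turns reserved for common neighbours are forfeited and all of
          -- `bs` is kept.
          (λ ea → weaken (ℕ.m≤n+m n′ (length cs ℕ.* 2)) ℚ.≤-refl
            (continue bs (extends-⊆ a⊆D ea) (fresh-extend (a ∷ []) f ea) (R⊆D ∘ there)
              (ℕ.≤-trans (ℕ.+-monoʳ-≤ nb (ℕ.n≤1+n (length as))) nb≤)))))
    where
    b₁ b₂ : List ℤ.ℤ
    b₁ = take nb bs
    b₂ = drop nb bs
    θ R : ℚ
    θ = x ^ℚ nb ∨ℚ z ^ℚ length cs
    R = mix (θ ^ℚ length as) 0ℚ B
    n′ : ℕ
    n′ = length as ℕ.* (nb ℕ.+ length cs ℕ.* 2) ℕ.+ n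
    len-b₁ : length b₁ ≡ nb
    len-b₁ = trans (length-take nb bs) (ℕ.m≤n⇒m⊓n≡m (ℕ.≤-trans (ℕ.m≤m+n nb (suc (length as))) nb≤))
    budget : length b₁ ℕ.+ (length cs ℕ.* 2 ℕ.+ n′) ≡ suc (length as) ℕ.* (nb ℕ.+ length cs ℕ.* 2) ℕ.+ n
    budget = trans (cong (ℕ._+ (length cs ℕ.* 2 ℕ.+ n′)) len-b₁)
      (trans (sym (ℕ.+-assoc nb (length cs ℕ.* 2) n′)) (sym (ℕ.+-assoc (nb ℕ.+ length cs ℕ.* 2) _ n)))
    0≤R : 0ℚ ℚ.≤ R
    0≤R = c≤mix (0≤^ (length as) (0≤∨ (^≤1 nb 0≤x x≤1) (0≤^ nb 0≤x) (0≤^ (length cs) 0≤z))) 0≤B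
    bs≡ : b₁ ++ b₂ ≡ bs
    bs≡ = take++drop≡id nb bs
    a⊆D : ∀ {y} → y ∈ a ∷ [] → y ∈ D
    a⊆D (here refl) = R⊆D (here refl)
    fresh-b₁ : Fresh h (a ∷ b₁)
    fresh-b₁ = fresh-++⁻ˡ (a ∷ b₁) {b₂ ++ as ++ cs} (fresh-↭ (↭-prep a
      (↭-trans (↭-reflexive (sym (++-assoc as cs bs))) (↭-trans (++-comm (as ++ cs) bs)
        (↭-reflexive (trans (cong (_++ as ++ cs) (sym bs≡)) (++-assoc b₁ b₂ (as ++ cs))))))) f)
    continue : ∀ {h′} bs′ → Extends D h h′ → Fresh h′ (as ++ cs ++ bs′) → (∀ {y} → y ∈ as ++ cs ++ bs′ → y ∈ D) →
               nb ℕ.+ length as ℕ.≤ length bs′ → Loses h′ n′ R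
    continue bs′ e f′ R⊆D′ le = triangle D nb as bs′ cs f′ R⊆D′ le 0≤z z≤1 0≤B
      (success ∘ extends-trans e) (failure ∘ extends-trans e)
    found-edge : ∀ {h′ b rest} → Extends (a ∷ []) h h′ → Extends b₁ h h′ → b ∷ rest ↭ b₁ → Built h′ a b →
                 Loses h′ (length cs ℕ.* 2 ℕ.+ n′) (mix (z ^ℚ length cs) 0ℚ R)
    found-edge {h′} {b} {rest} ea eb₁ p ab =
      common-neighbour cs fresh-a (fresh-++⁻ˡ (b ∷ cs) fresh-b) (built⇒≢ ab) 0≤z 0≤R
      (λ e w∈ aw bw → found (success (extends-trans (extends-⊆ a⊆D ea) (extends-⊆ ab⊆D e)) (R⊆D (here refl)) b∈D
         (R⊆D (there (∈-++⁺ʳ as (∈-++⁺ˡ w∈)))) (keeps e ab) aw bw) ℚ.≤-refl)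
      (λ e → continue (rest ++ b₂) (extends-trans (extends-⊆ a⊆D ea) (extends-⊆ ab⊆D e))
         (fresh-stays (distinct f-ab) (fresh-extend (a ∷ []) (fresh-++⁻ʳ-mid f-ab) ea) e)
         (λ y∈ → R⊆D (∈-resp-↭ (↭-sym perm) (there (there y∈)))) len)
      where
      perm : a ∷ as ++ cs ++ bs ↭ a ∷ b ∷ as ++ cs ++ rest ++ b₂
      perm = ↭-prep a (↭-trans (++⁺ˡ as (++⁺ˡ cs (↭-trans (↭-reflexive (sym bs≡)) (++⁺ʳ b₂ (↭-sym p)))))
        (↭-trans (++⁺ˡ as (shift b cs (rest ++ b₂))) (shift b as (cs ++ rest ++ b₂))))
      f-ab : Fresh h (a ∷ b ∷ as ++ cs ++ rest ++ b₂)
      f-ab = fresh-↭ perm f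
      fresh-++⁻ʳ-mid : ∀ {h a b R} → Fresh h (a ∷ b ∷ R) → Fresh h (a ∷ R)
      fresh-++⁻ʳ-mid {a = a} {b} f = fresh-++⁻ʳ (b ∷ []) (fresh-↭ (↭-swap a b ↭-refl) f)
      b∈D : b ∈ D
      b∈D = R⊆D (∈-resp-↭ (↭-sym perm) (there (here refl)))
      ab⊆D : ∀ {y} → y ∈ a ∷ b ∷ [] → y ∈ D
      ab⊆D (here refl)         = R⊆D (here refl)
      ab⊆D (there (here refl)) = b∈D
      fresh-b : Fresh h′ (b ∷ cs ++ as ++ rest ++ b₂)
      fresh-b = fresh-↭ (↭-prep b (shifts as cs)) (fresh-extend (a ∷ []) f-ab ea)
      fresh-a : Fresh h′ (a ∷ cs)
      fresh-a = fresh-++⁻ˡ (a ∷ cs) (fresh-extend b₁ (fresh-↭ (↭-trans (↭-prep a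
        (↭-trans (++⁺ˡ as (++⁺ˡ cs (↭-reflexive (sym bs≡))))
          (↭-trans (++⁺ˡ as (shifts cs b₁)) (↭-trans (shifts as b₁) (++⁺ˡ b₁ (shifts as cs))))))
        (↭-sym (shift a b₁ (cs ++ as ++ b₂)))) f) eb₁)
      len : nb ℕ.+ length as ℕ.≤ length (rest ++ b₂)
      len = ℕ.s≤s⁻¹ (ℕ.≤-trans (ℕ.≤-reflexive (sym (ℕ.+-suc nb (length as)))) (ℕ.≤-trans nb≤ (ℕ.≤-reflexive
        (trans (cong length (sym bs≡)) (trans (length-++ b₁) (trans (cong (ℕ._+ length b₂) (sym (↭-length p)))
          (cong suc (sym (length-++ rest)))))))))

  -- All of `bs` serves every a, as pairs with a new a are new; the first edge found ends the game.
  edge : ∀ {n h B} D as bs → Fresh h (as ++ bs) → (∀ {y} → y ∈ as ++ bs → y ∈ D) → 0ℚ ℚ.≤ B →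
    (∀ {h′ a b} → Extends D h h′ → a ∈ D → b ∈ D → Built h′ a b → ContainsCopy H h′) →
    (∀ {h′} → Extends D h h′ → Loses h′ n B) →
    Loses h (length as ℕ.* length bs ℕ.+ n) (mix ((x ^ℚ length bs) ^ℚ length as) 0ℚ B)
  edge {B = B} D [] bs f R⊆D 0≤B success failure =
    weaken ℕ.≤-refl (ℚ.≤-reflexive (sym (mix-1 0ℚ B))) (failure extends-refl)
  edge {n} {h} {B} D (a ∷ as) bs f R⊆D 0≤B success failure =
    weaken (ℕ.≤-reflexive (sym (ℕ.+-assoc (length bs) _ n)))
      (ℚ.≤-reflexive (mix-mix (x ^ℚ length bs) ((x ^ℚ length bs) ^ℚ length as) 0ℚ B))
      (search bs (fresh-++⁻ˡ (a ∷ bs) (fresh-↭ (↭-prep a (++-comm as bs)) f)) 0≤R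
        (λ ea _ p ab → found (success (extends-⊆ a⊆D ea) (R⊆D (here refl))
          (R⊆D (there (∈-++⁺ʳ as (∈-resp-↭ p (here refl))))) ab) ℚ.≤-refl)
        (λ ea → edge D as bs (fresh-extend (a ∷ []) f ea) (R⊆D ∘ there) 0≤B
          (success ∘ extends-trans (extends-⊆ a⊆D ea)) (failure ∘ extends-trans (extends-⊆ a⊆D ea))))
    where
    0≤R : 0ℚ ℚ.≤ mix ((x ^ℚ length bs) ^ℚ length as) 0ℚ B
    0≤R = c≤mix (0≤^ (length as) (0≤^ (length bs) 0≤x)) 0≤B
    a⊆D : ∀ {y} → y ∈ a ∷ [] → y ∈ D
    a⊆D (here refl) = R⊆D (here refl)

  -- Bounds the probability of fewer than D successes in M trials: 2^(number of
  -- successes still needed) is multiplied by 1 − ρ/2 on average at each trial.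
  fail : ℕ → ℕ → ℚ
  fail M D = (1ℚ ℚ.- ½ ℚ.* ρ) ^ℚ M ℚ.* 2ℚ ^ℚ D

  0≤½ : 0ℚ ℚ.≤ ½
  0≤½ = from-yes (0ℚ ℚ.≤? ½)

  0≤1-½ρ : 0ℚ ℚ.≤ 1ℚ ℚ.- ½ ℚ.* ρ
  0≤1-½ρ = 0≤y-x (*-mono 0≤½ (from-yes (½ ℚ.≤? 1ℚ)) 0≤ρ ρ≤1)

  0≤2 : 0ℚ ℚ.≤ 2ℚ
  0≤2 = from-yes (0ℚ ℚ.≤? 2ℚ)

  0≤fail : ∀ M D → 0ℚ ℚ.≤ fail M D
  0≤fail M D = 0≤* (0≤^ M 0≤1-½ρ) (0≤^ D 0≤2)

  fail-suc : ∀ M D → fail M D ℚ.≤ fail M (suc D)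
  fail-suc M D = *-monoˡ _ (0≤^ M 0≤1-½ρ) (ℚ.≤-trans (ℚ.≤-reflexive (sym (ℚ.*-identityˡ _)))
    (*-monoʳ _ (0≤^ D 0≤2) (from-yes (1ℚ ℚ.≤? 2ℚ))))

  1≤fail-0 : ∀ D → 1ℚ ℚ.≤ fail 0 D
  1≤fail-0 D = ℚ.≤-trans (ℚ.≤-trans (ℚ.≤-reflexive (sym (1^ D))) (^-mono D 0≤1 (from-yes (1ℚ ℚ.≤? 2ℚ))))
    (ℚ.≤-reflexive (sym (ℚ.*-identityˡ _)))

  -- Success halves the power of 2 and failure keeps it, and ρ/2 + (1 - ρ) = 1 - ρ/2.
  mix-fail : ∀ M D c B → mix x (mix (fail M D) c B) (mix (fail M (suc D)) c B) ≡ mix (fail (suc M) (suc D)) c B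
  mix-fail M D c B = solve 6 (λ r u v c B two →
    (c :+ u :* v :* (B :- c)) :+ (con 1ℚ :- r) :* ((c :+ u :* (con 2ℚ :* v) :* (B :- c)) :- (c :+ u :* v :* (B :- c)))
      := c :+ ((con 1ℚ :- con ½ :* r) :* u) :* (con 2ℚ :* v) :* (B :- c))
    refl ρ ((1ℚ ℚ.- ½ ℚ.* ρ) ^ℚ M) (2ℚ ^ℚ D) c B 2ℚ

  collect : ∀ {n h c B w} D todo → Fresh h (w ∷ todo) → c ℚ.≤ B →
    (∀ {h′ S rest} → Extends (w ∷ []) h h′ → S ++ rest ↭ todo → length S ≡ D →
       (∀ {y} → y ∈ S → Built h′ w y) → Loses h′ n c) →
    (∀ {h′} → Extends (w ∷ []) h h′ → Loses h′ n B) →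
    Loses h (length todo ℕ.+ n) (mix (fail (length todo) D) c B)
  collect {n} zero todo f c≤B success failure =
    weaken (ℕ.m≤n+m n (length todo)) (c≤mix (0≤fail (length todo) 0) c≤B)
      (success {S = []} extends-refl ↭-refl refl (λ ()))
  collect (suc D) [] f c≤B success failure =
    weaken ℕ.≤-refl (B≤mix (1≤fail-0 (suc D)) c≤B) (failure extends-refl)
  collect {c = c} {B} {w} (suc D) (v ∷ todo) f c≤B success failure =
    weaken ℕ.≤-refl (ℚ.≤-reflexive (mix-fail (length todo) D c B))
      (query-fresh f (mix-mono (fail-suc (length todo) D) c≤B)
        (λ e _ f′ wv → collect D todo f′ c≤B
          (λ e′ p len built → success (extends-trans e e′) (↭-prep v p) (cong suc len)
            (λ { (here refl) → keeps e′ wv ; (there y∈) → built y∈ }))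
          (λ e′ → failure (extends-trans e e′)))
        (λ e _ f′ → collect (suc D) todo f′ c≤B
          (λ { {S = S} {rest} e′ p len built → success (extends-trans e e′)
                 (↭-trans (shift v S rest) (↭-prep v p)) len built })
          (λ e′ → failure (extends-trans e e′))))

  -- One round per w: collect k of its neighbours among M leaves and let `inner` look for a triangle
  -- there. A round removes at most w and these k leaves, which is why M + |`ws`| k leaves suffice.
  -- The hypothesis on `inner` is for all n and B, so that the remaining rounds can be its failure
  -- continuation.
  neighbourhoods : ∀ {h v} M k budget θ ws P → Fresh h (ws ++ P) → (∀ {y} → y ∈ ws ++ P → Built h v y) →
    M ℕ.+ length ws ℕ.* k ℕ.≤ length P → 0ℚ ℚ.≤ θ → θ ℚ.≤ 1ℚ →
    (∀ {h n B w S} → length S ≡ k → Fresh h S → (∀ {y} → y ∈ S → Built h v y) → (∀ {y} → y ∈ S → Built h w y) →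
       Built h v w → 0ℚ ℚ.≤ B → (∀ {h′} → Extends S h h′ → Loses h′ n B) → Loses h (budget ℕ.+ n) (mix θ 0ℚ B)) →
    Loses h (length ws ℕ.* (M ℕ.+ budget)) (mix ((fail M k ∨ℚ θ) ^ℚ length ws) 0ℚ 1ℚ)
  neighbourhoods M k budget θ [] P f built large 0≤θ θ≤1 inner = give-up (ℚ.≤-reflexive (sym (mix-1 0ℚ 1ℚ)))
  neighbourhoods {h} {v} M k budget θ (w ∷ ws) P f built large 0≤θ θ≤1 inner =
    weaken (ℕ.≤-reflexive (trans (cong (ℕ._+ (budget ℕ.+ n′)) len-todo) (sym (ℕ.+-assoc M budget n′))))
      (ℚ.≤-reflexive (trans (mix-∨ (fail M k) θ 0ℚ R) (mix-mix η (η ^ℚ length ws) 0ℚ 1ℚ)))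
      (subst (λ M → Loses h (length todo ℕ.+ (budget ℕ.+ n′)) (mix (fail M k) (mix θ 0ℚ R) R)) len-todo
        (collect k todo fresh-todo (mix≤B θ≤1 0≤R)
          (λ e p len wS → collected e p len wS)
          (λ e → weaken (ℕ.m≤n+m n′ budget) ℚ.≤-refl
            (neighbourhoods M k budget θ ws P (fresh-extend (w ∷ []) f e) (keeps e ∘ built ∘ there)
              (ℕ.≤-trans (ℕ.+-monoʳ-≤ M (ℕ.m≤n+m (length ws ℕ.* k) k)) large) 0≤θ θ≤1 inner))))
    where
    η R : ℚ
    η = fail M k ∨ℚ θ
    R = mix (η ^ℚ length ws) 0ℚ 1ℚ
    n′ : ℕ
    n′ = length ws ℕ.* (M ℕ.+ budget)
    0≤η : 0ℚ ℚ.≤ η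
    0≤η = ℚ.≤-trans (0≤∨ θ≤1 0≤θ (0≤fail M k)) (ℚ.≤-reflexive
      (solve 2 (λ a b → a :+ b :- a :* b := b :+ a :- b :* a) refl θ (fail M k)))
    0≤R : 0ℚ ℚ.≤ R
    0≤R = c≤mix (0≤^ (length ws) 0≤η) 0≤1
    todo others : List ℤ.ℤ
    todo = take M P
    others = drop M P
    P≡ : todo ++ others ≡ P
    P≡ = take++drop≡id M P
    len-todo : length todo ≡ M
    len-todo = trans (length-take M P) (ℕ.m≤n⇒m⊓n≡m (ℕ.≤-trans (ℕ.m≤m+n M _) large))
    fresh-todo : Fresh h (w ∷ todo)
    fresh-todo = fresh-++⁻ˡ (w ∷ todo) {others ++ ws} (fresh-↭ (↭-prep w (↭-trans (++-comm ws P)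
      (↭-reflexive (trans (cong (_++ ws) (sym P≡)) (++-assoc todo others ws))))) f)
    collected : ∀ {h′ S rest} → Extends (w ∷ []) h h′ → S ++ rest ↭ todo → length S ≡ k →
                (∀ {y} → y ∈ S → Built h′ w y) → Loses h′ (budget ℕ.+ n′) (mix θ 0ℚ R)
    collected {h′} {S} {rest} e p len wS = inner len (fresh-++⁻ˡ S fresh-S)
      (λ y∈ → keeps e (built (there (∈-resp-↭ (↭-sym perm) (∈-++⁺ˡ y∈))))) wS (keeps e (built (here refl))) 0≤R
      (λ e′ → neighbourhoods M k budget θ ws (rest ++ others) (fresh-extend S fresh-S e′)
        (λ y∈ → keeps e′ (keeps e (built (there (∈-resp-↭ (↭-sym perm) (∈-++⁺ʳ S y∈)))))) large′ 0≤θ θ≤1 inner)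
      where
      perm : ws ++ P ↭ S ++ ws ++ rest ++ others
      perm = ↭-trans (++⁺ˡ ws (↭-trans (↭-reflexive (sym P≡)) (↭-trans (++⁺ʳ others (↭-sym p))
        (↭-reflexive (++-assoc S rest others))))) (shifts ws S)
      fresh-S : Fresh h′ (S ++ ws ++ rest ++ others)
      fresh-S = fresh-↭ perm (fresh-extend (w ∷ []) f e)
      len-P : length P ≡ k ℕ.+ length (rest ++ others)
      len-P = trans (cong length (sym P≡)) (trans (↭-length (++⁺ʳ others (↭-sym p)))
        (trans (cong length (++-assoc S rest others)) (trans (length-++ S) (cong (ℕ._+ length (rest ++ others)) len))))
      large′ : M ℕ.+ length ws ℕ.* k ℕ.≤ length (rest ++ others)
      large′ = ℕ.+-cancelˡ-≤ k _ _ (ℕ.≤-trans (ℕ.≤-reflexive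
        (trans (sym (ℕ.+-assoc k M _)) (trans (cong (ℕ._+ length ws ℕ.* k) (ℕ.+-comm k M)) (ℕ.+-assoc M k _))))
        (ℕ.≤-trans large (ℕ.≤-reflexive len-P)))

  -- The centre is vertex 0 and the candidates are 1 to M. Too few leaves means giving up, with loss
  -- 1.
  star : ∀ {n c} M D → c ℚ.≤ 1ℚ →
    (∀ {h S v} → length S ≡ D → Fresh h S → (∀ {y} → y ∈ S → Built h v y) → Loses h n c) →
    Loses [] (M ℕ.+ n) (mix (fail M D) c 1ℚ)
  star {n} {c} M D c≤1 continue = subst (λ k → Loses [] (k ℕ.+ n) (mix (fail k D) c 1ℚ)) len
    (collect D todo fresh c≤1
      (λ {_} {S} e p len-S built → continue len-S
        (fresh-++⁻ˡ S (fresh-↭ (↭-sym p) (fresh-extend (ℤ.+ 0 ∷ []) fresh e))) built)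
      (λ _ → give-up ℚ.≤-refl))
    where
    todo : List ℤ.ℤ
    todo = map (λ i → ℤ.+ suc i) (upTo M)
    len : length todo ≡ M
    len = trans (length-map (λ i → ℤ.+ suc i) (upTo M)) (length-upTo M)
    fresh : Fresh [] (ℤ.+ 0 ∷ todo)
    fresh = record
      { distinct  = unique-∷ (λ p → case ∈-map⁻ (λ i → ℤ.+ suc i) p of λ { (_ , _ , ()) })
                      (Unique.map⁺ (ℕ.suc-injective ∘ ℤ.+-injective) (Unique.upTo⁺ M))
      ; unqueried = λ _ _ () }

-- A division-free form of 1 − θ ≥ 1/k.
Slack : ℕ → ℚ → Set
Slack k θ = 1ℚ ℚ.≤ ⟦ k ⟧ ℚ.* (1ℚ ℚ.- θ)

-- Success probabilities multiply: 1 - (θ ∨ η) = (1 - θ)(1 - η).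
slack-∨ : ∀ {k l θ η} → Slack k θ → Slack l η → Slack (k ℕ.* l) (θ ∨ℚ η)
slack-∨ {k} {l} {θ} {η} s t = ℚ.≤-trans (*-mono 0≤1 s 0≤1 t) (ℚ.≤-reflexive (trans
  (solve 4 (λ k l θ η → (k :* (con 1ℚ :- θ)) :* (l :* (con 1ℚ :- η)) := (k :* l) :* (con 1ℚ :- (θ :+ η :- θ :* η)))
    refl ⟦ k ⟧ ⟦ l ⟧ θ η)
  (cong (ℚ._* (1ℚ ℚ.- (θ ∨ℚ η))) (sym (⟦⟧-* k l)))))

slack-mono : ∀ {k l θ} → θ ℚ.≤ 1ℚ → k ℕ.≤ l → Slack k θ → Slack l θ
slack-mono {k} {l} {θ} θ≤1 k≤l s = ℚ.≤-trans s (*-monoʳ (1ℚ ℚ.- θ) (0≤y-x θ≤1) (⟦⟧-mono k≤l))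

-- The left side is 1 at n = 0 and does not increase: passing from n to n + 1 lowers it by (n + 1)
-- θ^n (1 - θ)^2.
bernoulli : ∀ n {θ} → 0ℚ ℚ.≤ θ → θ ^ℚ n ℚ.* (1ℚ ℚ.+ ⟦ n ⟧ ℚ.* (1ℚ ℚ.- θ)) ℚ.≤ 1ℚ
bernoulli zero    {θ} 0≤θ = ℚ.≤-reflexive
  (solve 1 (λ θ → con 1ℚ :* (con 1ℚ :+ con 0ℚ :* (con 1ℚ :- θ)) := con 1ℚ) refl θ)
bernoulli (suc n) {θ} 0≤θ = ℚ.≤-trans (≤-from-diff (ℚ.≤-trans
  (0≤* (0≤^ n 0≤θ) (0≤* (0≤+ 0≤1 (0≤⟦⟧ n)) (0≤square (1ℚ ℚ.- θ))))
  (ℚ.≤-reflexive (trans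
    (solve 3 (λ u N θ → u :* ((con 1ℚ :+ N) :* ((con 1ℚ :- θ) :* (con 1ℚ :- θ)))
        := u :* (con 1ℚ :+ N :* (con 1ℚ :- θ)) :- θ :* u :* (con 1ℚ :+ (con 1ℚ :+ N) :* (con 1ℚ :- θ)))
      refl (θ ^ℚ n) ⟦ n ⟧ θ)
    (cong (λ N → θ ^ℚ n ℚ.* (1ℚ ℚ.+ ⟦ n ⟧ ℚ.* (1ℚ ℚ.- θ)) ℚ.- θ ℚ.* θ ^ℚ n ℚ.* (1ℚ ℚ.+ N ℚ.* (1ℚ ℚ.- θ)))
      (sym (⟦⟧-+ 1 n)))))))
  (bernoulli n 0≤θ)
  where
  0≤square : ∀ d → 0ℚ ℚ.≤ d ℚ.* d
  0≤square d = ℚ.≤-trans (0≤* (ℚ.0≤∣p∣ d) (ℚ.0≤∣p∣ d)) (ℚ.≤-reflexive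
      (trans (sym (ℚ.∣p*q∣≡∣p∣*∣q∣ d d)) (abs-square d)))
    where
    abs-square : ∀ d → ℚ.∣ d ℚ.* d ∣ ≡ d ℚ.* d
    abs-square d with ℚ.∣p∣≡p∨∣p∣≡-p d
    ... | inj₁ eq = trans (ℚ.∣p*q∣≡∣p∣*∣q∣ d d) (cong₂ ℚ._*_ eq eq)
    ... | inj₂ eq = trans (ℚ.∣p*q∣≡∣p∣*∣q∣ d d) (trans (cong₂ ℚ._*_ eq eq)
                      (trans (sym (ℚ.neg-distribˡ-* d (ℚ.- d))) (trans (cong ℚ.-_ (sym (ℚ.neg-distribʳ-* d d)))
                        (solve 1 (λ y → :- (:- y) := y) refl (d ℚ.* d)))))

-- From 1 - θ ≥ 1/(nj), `bernoulli` gives θ^n ≤ 1/(1 + 1/j) = j/(j + 1).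
slack-^ : ∀ n j {θ} → 0ℚ ℚ.≤ θ → Slack (n ℕ.* j) θ → Slack (suc j) (θ ^ℚ n)
slack-^ n j {θ} 0≤θ s = ≤-from-diff (ℚ.≤-trans
  (0≤+ (0≤* (0≤⟦⟧ j) (0≤y-x (bernoulli n 0≤θ))) (0≤* (0≤^ n 0≤θ) (0≤y-x s)))
  (ℚ.≤-reflexive (trans
    (cong (λ X → ⟦ j ⟧ ℚ.* (1ℚ ℚ.- u ℚ.* (1ℚ ℚ.+ ⟦ n ⟧ ℚ.* (1ℚ ℚ.- θ))) ℚ.+ u ℚ.* (X ℚ.* (1ℚ ℚ.- θ) ℚ.- 1ℚ)) (⟦⟧-* n j))
    (trans
      (solve 4 (λ n j u θ →
          j :* (con 1ℚ :- u :* (con 1ℚ :+ n :* (con 1ℚ :- θ))) :+ u :* (n :* j :* (con 1ℚ :- θ) :- con 1ℚ)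
          := (con 1ℚ :+ j) :* (con 1ℚ :- u) :- con 1ℚ)
        refl ⟦ n ⟧ ⟦ j ⟧ u θ)
      (cong (λ X → X ℚ.* (1ℚ ℚ.- u) ℚ.- 1ℚ) (sym (⟦⟧-+ 1 j)))))))
  where
  u : ℚ
  u = θ ^ℚ n

slack⇒≤½ : ∀ {θ} → Slack 2 θ → θ ℚ.≤ ½
slack⇒≤½ {θ} s = ≤-from-diff (ℚ.≤-trans (0≤* (from-yes (0ℚ ℚ.≤? ½)) (0≤y-x s)) (ℚ.≤-reflexive
  (solve 1 (λ θ → con ½ :* (con 2ℚ :* (con 1ℚ :- θ) :- con 1ℚ) := con ½ :- θ) refl θ)))

≤½⇒slack : ∀ {θ} → θ ℚ.≤ ½ → Slack 2 θ
≤½⇒slack {θ} le = ≤-from-diff (ℚ.≤-trans (0≤* (from-yes (0ℚ ℚ.≤? 2ℚ)) (0≤y-x le)) (ℚ.≤-reflexive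
  (solve 1 (λ θ → con 2ℚ :* (con ½ :- θ) := con 2ℚ :* (con 1ℚ :- θ) :- con 1ℚ) refl θ)))

slack⇒^≤½ : ∀ k {θ} → 0ℚ ℚ.≤ θ → Slack k θ → θ ^ℚ k ℚ.≤ ½
slack⇒^≤½ k {θ} 0≤θ s = slack⇒≤½ (slack-^ k 1 0≤θ (subst (λ k → Slack k θ) (sym (ℕ.*-identityʳ k)) s))

-- Three blocks of k attempts, each failing with probability at most 1/2; hence the factor 3 in the
-- number of rounds of each strategy.
slack⇒^≤⅛ : ∀ k {θ} → 0ℚ ℚ.≤ θ → Slack k θ → θ ^ℚ (3 ℕ.* k) ℚ.≤ ⅛
slack⇒^≤⅛ k {θ} 0≤θ s = ℚ.≤-trans (ℚ.≤-reflexive (^-*-assoc θ 3 k)) (^-mono 3 (0≤^ k 0≤θ) (slack⇒^≤½ k 0≤θ s))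

recip : ∀ m → .{{_ : ℕ.NonZero m}} → ⟦ m ⟧ ℚ.* (ℤ.+ 1 ℚ./ m) ≡ 1ℚ
recip (suc m) = ℚ.toℚᵘ-injective (ℚᵘ.≃-trans (ℚ.toℚᵘ-homo-* ⟦ suc m ⟧ (ℤ.+ 1 ℚ./ suc m))
  (ℚᵘ.≃-trans (ℚᵘ.*-cong (ℚ.toℚᵘ-fromℚᵘ (ℚᵘ.mkℚᵘ (ℤ.+ suc m) 0)) (ℚ.toℚᵘ-fromℚᵘ (ℚᵘ.mkℚᵘ (ℤ.+ 1) m)))
    (ℚᵘ.*≡* (trans (ℤ.*-identityʳ _) (trans (ℤ.*-identityʳ _) (sym (trans (ℤ.*-identityˡ _)
      (cong (λ k → ℤ.+ suc k) (ℕ.+-identityʳ m)))))))))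

split : ∀ a {n} (S : List ℤ.ℤ) → length S ≡ a ℕ.+ n → ∃₂ λ X Y → X ++ Y ≡ S × length X ≡ a × length Y ≡ n
split a {n} S len = take a S , drop a S , take++drop≡id a S ,
  trans (length-take a S) (ℕ.m≤n⇒m⊓n≡m (subst (a ℕ.≤_) (sym len) (ℕ.m≤m+n a n))) ,
  trans (length-drop a S) (trans (cong (_∸ a) len) (ℕ.m+n∸m≡n a n))

-- Phases when ρ = 1/m.

module Parameters (H : Graph) (m : ℕ) .{{m≢0 : ℕ.NonZero m}}
  (ρ : ℚ) (0≤ρ : 0ℚ ℚ.≤ ρ) (mρ≡1 : ⟦ m ⟧ ℚ.* ρ ≡ 1ℚ) where

  ρ≤1 : ρ ℚ.≤ 1ℚ
  ρ≤1 = ℚ.≤-trans (ℚ.≤-reflexive (sym (ℚ.*-identityˡ ρ)))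
    (ℚ.≤-trans (*-monoʳ ρ 0≤ρ (⟦⟧-mono {1} {m} (ℕ.>-nonZero⁻¹ m))) (ℚ.≤-reflexive mρ≡1))

  open Builder H ρ 0≤ρ ρ≤1 public

  slack-x : Slack m x
  slack-x = ℚ.≤-reflexive (sym (trans (solve 2 (λ m r → m :* (con 1ℚ :- (con 1ℚ :- r)) := m :* r) refl ⟦ m ⟧ ρ) mρ≡1))

  slack-z : Slack (m ℕ.* m) z
  slack-z = slack-∨ {m} {m} {x} {x} slack-x slack-x

  0≤z : 0ℚ ℚ.≤ z
  0≤z = 0≤∨ x≤1 0≤x 0≤x

  ∨≤1 : ∀ {θ η} → θ ℚ.≤ 1ℚ → η ℚ.≤ 1ℚ → θ ∨ℚ η ℚ.≤ 1ℚ
  ∨≤1 {θ} {η} θ≤1 η≤1 = ≤-from-diff (ℚ.≤-trans (0≤* (0≤y-x θ≤1) (0≤y-x η≤1)) (ℚ.≤-reflexive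
    (solve 2 (λ θ η → (con 1ℚ :- θ) :* (con 1ℚ :- η) := con 1ℚ :- (θ :+ η :- θ :* η)) refl θ η)))

  z≤1 : z ℚ.≤ 1ℚ
  z≤1 = ∨≤1 x≤1 x≤1

  trials : ℕ → ℕ
  trials D = D ℕ.* (6 ℕ.* (2 ℕ.* m))

  1/32 : ℚ
  1/32 = ℤ.+ 1 ℚ./ 32

  -- Each wanted leaf is allotted 12m queries: (1 - ρ/2)^(2m) ≤ 1/2, the sixth power is at most
  -- 1/64, and the factor 2 paid for the leaf leaves 1/32.
  fail≤ : ∀ D → fail (trials (suc D)) (suc D) ℚ.≤ 1/32
  fail≤ D = begin
    y ^ℚ trials (suc D) ℚ.* 2ℚ ^ℚ suc D
      ≡⟨ cong (ℚ._* 2ℚ ^ℚ suc D) (^-*-assoc y (suc D) (6 ℕ.* (2 ℕ.* m))) ⟩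
    (y ^ℚ (6 ℕ.* (2 ℕ.* m))) ^ℚ suc D ℚ.* 2ℚ ^ℚ suc D    ≡⟨ ^-distrib-* (y ^ℚ (6 ℕ.* (2 ℕ.* m))) 2ℚ (suc D) ⟨
    (y ^ℚ (6 ℕ.* (2 ℕ.* m)) ℚ.* 2ℚ) ^ℚ suc D
      ≡⟨ cong (λ u → (u ℚ.* 2ℚ) ^ℚ suc D) (^-*-assoc y 6 (2 ℕ.* m)) ⟩
    ((y ^ℚ (2 ℕ.* m)) ^ℚ 6 ℚ.* 2ℚ) ^ℚ suc D              ≤⟨ ^-mono (suc D) (0≤* (0≤^ 6 (0≤^ (2 ℕ.* m) 0≤1-½ρ)) 0≤2)
                                                              (*-monoʳ 2ℚ 0≤2 (^-mono 6 (0≤^ (2 ℕ.* m) 0≤1-½ρ)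
                                                                (slack⇒^≤½ (2 ℕ.* m) 0≤1-½ρ slack-y))) ⟩
    (½ ^ℚ 6 ℚ.* 2ℚ) ^ℚ suc D                             ≡⟨⟩
    1/32 ^ℚ suc D
      ≤⟨ ^≤ D (from-yes (0ℚ ℚ.≤? 1/32)) (from-yes (1/32 ℚ.≤? 1ℚ)) ⟩
    1/32                                                 ∎
    where
    open ℚ.≤-Reasoning
    y : ℚ
    y = 1ℚ ℚ.- ½ ℚ.* ρ
    slack-y : Slack (2 ℕ.* m) y
    slack-y = ℚ.≤-reflexive (sym (trans (cong (ℚ._* (1ℚ ℚ.- y)) (⟦⟧-* 2 m))
      (trans (solve 2 (λ m r → con 2ℚ :* m :* (con 1ℚ :- (con 1ℚ :- con ½ :* r)) := m :* r) refl ⟦ m ⟧ ρ) mρ≡1)))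

  star-½ : ∀ {n θ} D → 0ℚ ℚ.≤ θ → θ ℚ.≤ ⅛ →
    (∀ {h S v} → length S ≡ suc D → Fresh h S → (∀ {y} → y ∈ S → Built h v y) → Loses h n (mix θ 0ℚ 1ℚ)) →
    Loses [] (trials (suc D) ℕ.+ n) ½
  star-½ {n} {θ} D 0≤θ θ≤⅛ continue = weaken ℕ.≤-refl bound
    (star (trials (suc D)) (suc D) (mix≤B (ℚ.≤-trans θ≤⅛ (from-yes (⅛ ℚ.≤? 1ℚ))) 0≤1) continue)
    where
    open ℚ.≤-Reasoning
    f : ℚ
    f = fail (trials (suc D)) (suc D)
    bound : mix f (mix θ 0ℚ 1ℚ) 1ℚ ℚ.≤ ½
    bound = begin
      mix f (mix θ 0ℚ 1ℚ) 1ℚ  ≡⟨ solve 2 (λ f θ → let c = con 0ℚ :+ θ :* (con 1ℚ :- con 0ℚ) in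
                                    c :+ f :* (con 1ℚ :- c) := f :+ θ :* (con 1ℚ :- f)) refl f θ ⟩
      f ℚ.+ θ ℚ.* (1ℚ ℚ.- f)  ≤⟨ ℚ.+-mono-≤ (fail≤ D) (*-mono 0≤θ θ≤⅛
                                    (0≤y-x (ℚ.≤-trans (fail≤ D) (from-yes (1/32 ℚ.≤? 1ℚ))))
                                    (≤-from-diff (ℚ.≤-trans (0≤fail (trials (suc D)) (suc D))
                                      (ℚ.≤-reflexive (solve 1 (λ f → f := con 1ℚ :- (con 1ℚ :- f)) refl f))))) ⟩
      1/32 ℚ.+ ⅛ ℚ.* 1ℚ       ≤⟨ from-yes (1/32 ℚ.+ ⅛ ℚ.* 1ℚ ℚ.≤? ½) ⟩
      ½                       ∎

-- K_3: ρ = 1/t^2 and of order t^3 turns.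

module Triangle (t-1 : ℕ) (ρ : ℚ) (0≤ρ : 0ℚ ℚ.≤ ρ) (mρ≡1 : ⟦ suc t-1 ℕ.* suc t-1 ⟧ ℚ.* ρ ≡ 1ℚ) where
  t : ℕ
  t = suc t-1

  open Parameters (K 3) (t ℕ.* t) ρ 0≤ρ mρ≡1

  x^t : ℚ
  x^t = x ^ℚ t

  -- A leaf has a neighbour among t others with chance of order t/t^2 = 1/t, so of order t leaves
  -- are tried.
  slack : Slack (2 ℕ.* t) x^t
  slack = slack-mono {suc t} {2 ℕ.* t} (^≤1 t 0≤x x≤1) (suc≤2* t-1) (slack-^ t t 0≤x slack-x)

  na D : ℕ
  na = 3 ℕ.* (2 ℕ.* t)
  D = na ℕ.+ t

  wins : Loses [] (trials D ℕ.+ (na ℕ.* t ℕ.+ 0)) ½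
  wins = star-½ (ℕ.pred D) (0≤^ na (0≤^ t 0≤x)) (slack⇒^≤⅛ (2 ℕ.* t) (0≤^ t 0≤x) slack) phase
    where
    phase : ∀ {h S v} → length S ≡ D → Fresh h S → (∀ {y} → y ∈ S → Built h v y) →
            Loses h (na ℕ.* t ℕ.+ 0) (mix (x^t ^ℚ na) 0ℚ 1ℚ)
    phase {h} {S} {v} len f built with split na S len
    ... | as , bs , refl , las , lbs = subst₂ (λ a b → Loses h (a ℕ.* b ℕ.+ 0) (mix ((x ^ℚ b) ^ℚ a) 0ℚ 1ℚ)) las lbs
      (edge (as ++ bs) as bs f id 0≤1
        (λ e a∈ b∈ ab → clique⇒copy (v ∷ _ ∷ _ ∷ [])
          ((keeps e (built a∈) ∷ keeps e (built b∈) ∷ []) ∷ (ab ∷ []) ∷ [] ∷ []))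
        (λ _ → give-up ℚ.≤-refl))

-- K_4: ρ = 1/t and of order t^2 turns.

module Tetrahedron (t-1 : ℕ) (ρ : ℚ) (0≤ρ : 0ℚ ℚ.≤ ρ) (mρ≡1 : ⟦ suc t-1 ⟧ ℚ.* ρ ≡ 1ℚ) where
  t : ℕ
  t = suc t-1

  open Parameters (K 4) t ρ 0≤ρ mρ≡1

  θ : ℚ
  θ = x ^ℚ t ∨ℚ z ^ℚ t

  -- The leaves split into `na` starting points, t candidates for c, and t + `na` candidates for b,
  -- as `triangle` requires.
  na D : ℕ
  na = 3 ℕ.* (2 ℕ.* (2 ℕ.* t))
  D = na ℕ.+ (t ℕ.+ (t ℕ.+ na))

  0≤θ : 0ℚ ℚ.≤ θ
  0≤θ = 0≤∨ (^≤1 t 0≤x x≤1) (0≤^ t 0≤x) (0≤^ t 0≤z)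

  -- An edge is found with chance at least 1/2, and then a common neighbour with chance at least
  -- 1/(2t), of the order of t ρ^2.
  slack : Slack (2 ℕ.* (2 ℕ.* t)) θ
  slack = slack-∨ {2} {2 ℕ.* t} {x ^ℚ t} {z ^ℚ t}
    (slack-^ t 1 0≤x (subst (λ k → Slack k x) (sym (ℕ.*-identityʳ t)) slack-x))
    (slack-mono {suc t} {2 ℕ.* t} (^≤1 t 0≤z z≤1) (suc≤2* t-1) (slack-^ t t 0≤z slack-z))

  budget : ℕ
  budget = na ℕ.* (t ℕ.+ t ℕ.* 2)

  wins : Loses [] (trials D ℕ.+ (budget ℕ.+ 0)) ½
  wins = star-½ (ℕ.pred D) (0≤^ na 0≤θ) (slack⇒^≤⅛ (2 ℕ.* (2 ℕ.* t)) 0≤θ slack) phase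
    where
    phase : ∀ {h S v} → length S ≡ D → Fresh h S → (∀ {y} → y ∈ S → Built h v y) →
            Loses h (budget ℕ.+ 0) (mix (θ ^ℚ na) 0ℚ 1ℚ)
    phase {h} {S} {v} len f built with split na S len
    ... | as , S′ , refl , las , lS′ with split t S′ lS′
    ...   | cs , bs , refl , lcs , lbs =
      subst₂ (λ a c → Loses h (a ℕ.* (t ℕ.+ c ℕ.* 2) ℕ.+ 0) (mix ((x ^ℚ t ∨ℚ z ^ℚ c) ^ℚ a) 0ℚ 1ℚ)) las lcs
      (triangle (as ++ cs ++ bs) t as bs cs f id
        (ℕ.≤-reflexive (trans (cong (t ℕ.+_) las) (sym lbs))) 0≤z z≤1 0≤1
        (λ e a∈ b∈ c∈ ab ac bc → clique⇒copy (v ∷ _ ∷ _ ∷ _ ∷ [])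
          ((keeps e (built a∈) ∷ keeps e (built b∈) ∷ keeps e (built c∈) ∷ []) ∷ (ab ∷ ac ∷ []) ∷ (bc ∷ []) ∷ [] ∷ []))
        (λ _ → give-up ℚ.≤-refl))

-- K_5: ρ = 1/t^3 and of order t^8 turns.

module Pentatope (t-1 : ℕ) (ρ : ℚ) (0≤ρ : 0ℚ ℚ.≤ ρ) (mρ≡1 : ⟦ suc t-1 ℕ.* suc t-1 ℕ.* suc t-1 ⟧ ℚ.* ρ ≡ 1ℚ) where
  t s m : ℕ
  t = suc t-1
  s = t ℕ.* t
  m = s ℕ.* t

  open Parameters (K 5) m ρ 0≤ρ mρ≡1

  -- In orders of magnitude: `k` = 10t^2 neighbours per round, `nw` = 12t^3 rounds, and `D` of order
  -- t^5 leaves, which cost t^3 queries each.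
  na k nw D budget : ℕ
  na = 4 ℕ.* s
  k = na ℕ.+ (s ℕ.+ (s ℕ.+ na))
  nw = 3 ℕ.* (2 ℕ.* (2 ℕ.* m))
  D = nw ℕ.+ (trials k ℕ.+ nw ℕ.* k)
  budget = na ℕ.* (s ℕ.+ s ℕ.* 2)

  θ η : ℚ
  θ = (x ^ℚ s ∨ℚ z ^ℚ s) ^ℚ na
  η = fail (trials k) k ∨ℚ θ

  0≤base : 0ℚ ℚ.≤ x ^ℚ s ∨ℚ z ^ℚ s
  0≤base = 0≤∨ (^≤1 s 0≤x x≤1) (0≤^ s 0≤x) (0≤^ s 0≤z)

  0≤θ : 0ℚ ℚ.≤ θ
  0≤θ = 0≤^ na 0≤base

  base≤1 : x ^ℚ s ∨ℚ z ^ℚ s ℚ.≤ 1ℚ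
  base≤1 = ∨≤1 (^≤1 s 0≤x x≤1) (^≤1 s 0≤z z≤1)

  θ≤1 : θ ℚ.≤ 1ℚ
  θ≤1 = ^≤1 na 0≤base base≤1

  -- An edge at a given leaf has chance of order t^2 ρ = 1/t and a common neighbour of order t^2 ρ^2
  -- = 1/(tm). With `na` starting leaves a round then succeeds with chance of order 1/m.
  slack-base : Slack (na ℕ.* m) (x ^ℚ s ∨ℚ z ^ℚ s)
  slack-base = subst (λ k → Slack k (x ^ℚ s ∨ℚ z ^ℚ s)) (product t m)
    (slack-∨ {2 ℕ.* t} {2 ℕ.* (t ℕ.* m)} {x ^ℚ s} {z ^ℚ s}
    (slack-mono {suc t} {2 ℕ.* t} (^≤1 s 0≤x x≤1) (suc≤2* t-1) (slack-^ s t 0≤x slack-x))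
    (slack-mono {suc (t ℕ.* m)} {2 ℕ.* (t ℕ.* m)} (^≤1 s 0≤z z≤1) (suc≤2* (ℕ.pred (t ℕ.* m)))
      (slack-^ s (t ℕ.* m) 0≤z (subst (λ k → Slack k z) (ℕ.*-assoc s t m) slack-z))))

  fail≤½ : fail (trials k) k ℚ.≤ ½
  fail≤½ = ℚ.≤-trans (fail≤ (ℕ.pred k)) (from-yes (1/32 ℚ.≤? ½))

  slack : Slack (2 ℕ.* (2 ℕ.* m)) η
  slack = slack-∨ {2} {2 ℕ.* m} {fail (trials k) k} {θ} (≤½⇒slack fail≤½)
    (slack-mono {suc m} {2 ℕ.* m} θ≤1 (suc≤2* (ℕ.pred m)) (slack-^ na m 0≤base slack-base))

  0≤η : 0ℚ ℚ.≤ η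
  0≤η = 0≤∨ (ℚ.≤-trans fail≤½ (from-yes (½ ℚ.≤? 1ℚ))) (0≤fail (trials k) k) 0≤θ

  wins : Loses [] (trials D ℕ.+ nw ℕ.* (trials k ℕ.+ budget)) ½
  wins = star-½ (ℕ.pred D) (0≤^ nw 0≤η) (slack⇒^≤⅛ (2 ℕ.* (2 ℕ.* m)) 0≤η slack) phase
    where
    inner : ∀ {h n B v w S} → length S ≡ k → Fresh h S → (∀ {y} → y ∈ S → Built h v y) → (∀ {y} → y ∈ S → Built h w y) →
       Built h v w → 0ℚ ℚ.≤ B → (∀ {h′} → Extends S h h′ → Loses h′ n B) → Loses h (budget ℕ.+ n) (mix θ 0ℚ B)
    inner {h} {n} {B} {v} {w} {S} len f vS wS vw 0≤B failure with split na S len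
    ... | as , S′ , refl , las , lS′ with split s S′ lS′
    ...   | cs , bs , refl , lcs , lbs =
      subst₂ (λ a c → Loses h (a ℕ.* (s ℕ.+ c ℕ.* 2) ℕ.+ n) (mix ((x ^ℚ s ∨ℚ z ^ℚ c) ^ℚ a) 0ℚ B)) las lcs
      (triangle (as ++ cs ++ bs) s as bs cs f id
        (ℕ.≤-reflexive (trans (cong (s ℕ.+_) las) (sym lbs))) 0≤z z≤1 0≤B
        (λ e a∈ b∈ c∈ ab ac bc → clique⇒copy (v ∷ w ∷ _ ∷ _ ∷ _ ∷ [])
          ((keeps e vw ∷ keeps e (vS a∈) ∷ keeps e (vS b∈) ∷ keeps e (vS c∈) ∷ []) ∷
           (keeps e (wS a∈) ∷ keeps e (wS b∈) ∷ keeps e (wS c∈) ∷ []) ∷ (ab ∷ ac ∷ []) ∷ (bc ∷ []) ∷ [] ∷ []))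
        failure)
    phase : ∀ {h S v} → length S ≡ D → Fresh h S → (∀ {y} → y ∈ S → Built h v y) →
            Loses h (nw ℕ.* (trials k ℕ.+ budget)) (mix (η ^ℚ nw) 0ℚ 1ℚ)
    phase {h} {S} {v} len f built with split nw S len
    ... | ws , P , refl , lws , lP =
      subst (λ w → Loses h (w ℕ.* (trials k ℕ.+ budget)) (mix (η ^ℚ w) 0ℚ 1ℚ)) lws
        (neighbourhoods (trials k) k budget θ ws P f built
          (ℕ.≤-reflexive (trans (cong (λ w → trials k ℕ.+ w ℕ.* k) lws) (sym lP))) 0≤θ θ≤1 inner)

-- Approximating p by 1/t^b.

reciprocal : ∀ m → .{{_ : ℕ.NonZero m}} → ∃ λ ρ → 0ℚ ℚ.≤ ρ × ⟦ m ⟧ ℚ.* ρ ≡ 1ℚ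
reciprocal m = ℤ.+ 1 ℚ./ m , ℚ.nonNegative⁻¹ (ℤ.+ 1 ℚ./ m) {{ℚ.normalize-nonNeg 1 m}} , recip m

1/suc≤ : ∀ r → 0ℚ ℚ.< r → ∃ λ d → ℤ.+ 1 ℚ./ suc d ℚ.≤ r
1/suc≤ r@(ℚ.mkℚ (ℤ.+ suc n) d _) 0<r = d , ℚ.toℚᵘ-cancel-≤
  (ℚᵘ.≤-respˡ-≃ (ℚᵘ.≃-sym (ℚ.toℚᵘ-fromℚᵘ (ℚᵘ.mkℚᵘ (ℤ.+ 1) d)))
    (ℚᵘ.*≤* (ℤ.*-monoʳ-≤-nonNeg (ℤ.+ suc d) (ℤ.+≤+ (ℕ.s≤s (ℕ.z≤n {n}))))))
1/suc≤ r@(ℚ.mkℚ (ℤ.+ zero) d _) 0<r = contradiction (ℚ.positive 0<r) λ ()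
1/suc≤ r@(ℚ.mkℚ ℤ.-[1+ n ] d _) 0<r = contradiction (ℚ.positive 0<r) λ ()

-- A natural number t of the order of r^(-1/b), for b = suc b-1.
module Root (b-1 : ℕ) (r : ℚ) (0<r : 0ℚ ℚ.< r) where

  b : ℕ
  b = suc b-1

  Large : ℕ → Set
  Large t = 1ℚ ℚ.≤ r ℚ.* ⟦ t ℕ.^ b ⟧

  some-large : ∃ λ d → Large (suc d)
  some-large = let d , le = 1/suc≤ r 0<r in d , ℚ.≤-trans
    (ℚ.≤-reflexive (trans (sym (recip (suc d))) (ℚ.*-comm ⟦ suc d ⟧ (ℤ.+ 1 ℚ./ suc d))))
    (*-mono (ℚ.nonNegative⁻¹ (ℤ.+ 1 ℚ./ suc d) {{ℚ.normalize-nonNeg 1 (suc d)}}) le (0≤⟦⟧ (suc d))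
      (⟦⟧-mono (ℕ.m≤m*n (suc d) (suc d ℕ.^ b-1) {{ℕ.m^n≢0 (suc d) b-1}})))

  -- The number u + 1 is large while its predecessor is not, up to equality; the value 1 has no
  -- predecessor to compare with.
  Minimal : ℕ → Set
  Minimal zero    = Large 1
  Minimal (suc u) = Large (suc (suc u)) × r ℚ.* ⟦ suc u ℕ.^ b ⟧ ℚ.≤ 1ℚ

  minimal : ∀ u → Large (suc u) → ∃ Minimal
  minimal zero    large = zero , large
  minimal (suc u) large with ℚ.≤-total 1ℚ (r ℚ.* ⟦ suc u ℕ.^ b ⟧)
  ... | inj₁ large′ = minimal u large′
  ... | inj₂ small  = suc u , large , small

  minimal-large : ∀ u → Minimal u → Large (suc u)
  minimal-large zero    large       = large
  minimal-large (suc u) (large , _) = large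

  -- For t = 1 this is q ≤ 1. Otherwise t ≤ 2(t - 1) costs 2^b against (t - 1)^b r ≤ 1, and q ≤ 3r
  -- costs 3.
  minimal-bound : ∀ u {q} → Minimal u → 0ℚ ℚ.≤ q → q ℚ.≤ 1ℚ → q ℚ.≤ ⟦ 3 ⟧ ℚ.* r →
                  ⟦ suc u ℕ.^ b ⟧ ℚ.* q ℚ.≤ ⟦ 3 ℕ.* 2 ℕ.^ b ⟧
  minimal-bound zero {q} _ 0≤q q≤1 q≤3r = begin
    ⟦ 1 ℕ.^ b ⟧ ℚ.* q      ≡⟨ cong (λ k → ⟦ k ⟧ ℚ.* q) (ℕ.^-zeroˡ b) ⟩
    1ℚ ℚ.* q               ≡⟨ ℚ.*-identityˡ q ⟩
    q                      ≤⟨ q≤1 ⟩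
    ⟦ 1 ⟧                  ≤⟨ ⟦⟧-mono {1} {3 ℕ.* 2 ℕ.^ b} (ℕ.*-mono-≤ {1} {3} (ℕ.s≤s ℕ.z≤n) (ℕ.m^n>0 2 b)) ⟩
    ⟦ 3 ℕ.* 2 ℕ.^ b ⟧      ∎
    where open ℚ.≤-Reasoning
  minimal-bound (suc u) {q} (_ , small) 0≤q q≤1 q≤3r = begin
    ⟦ suc (suc u) ℕ.^ b ⟧ ℚ.* q
      ≤⟨ *-mono (0≤⟦⟧ (suc (suc u) ℕ.^ b)) (⟦⟧-mono (ℕ.^-monoˡ-≤ b (suc≤2* u))) 0≤q q≤3r ⟩
    ⟦ (2 ℕ.* suc u) ℕ.^ b ⟧ ℚ.* (⟦ 3 ⟧ ℚ.* r)             ≡⟨ cong (ℚ._* (⟦ 3 ⟧ ℚ.* r)) double ⟩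
    ⟦ 2 ℕ.^ b ⟧ ℚ.* ⟦ suc u ℕ.^ b ⟧ ℚ.* (⟦ 3 ⟧ ℚ.* r)
      ≡⟨ solve 4 (λ c v three r → c :* v :* (three :* r) := three :* c :* (r :* v)) refl ⟦ 2 ℕ.^ b ⟧ ⟦ suc u ℕ.^ b ⟧ ⟦ 3 ⟧ r ⟩
    ⟦ 3 ⟧ ℚ.* ⟦ 2 ℕ.^ b ⟧ ℚ.* (r ℚ.* ⟦ suc u ℕ.^ b ⟧)
      ≤⟨ *-monoˡ (⟦ 3 ⟧ ℚ.* ⟦ 2 ℕ.^ b ⟧) (0≤* (0≤⟦⟧ 3) (0≤⟦⟧ (2 ℕ.^ b))) small ⟩
    ⟦ 3 ⟧ ℚ.* ⟦ 2 ℕ.^ b ⟧ ℚ.* 1ℚ                          ≡⟨ ℚ.*-identityʳ _ ⟩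
    ⟦ 3 ⟧ ℚ.* ⟦ 2 ℕ.^ b ⟧                                 ≡⟨ ⟦⟧-* 3 (2 ℕ.^ b) ⟨
    ⟦ 3 ℕ.* 2 ℕ.^ b ⟧                                     ∎
    where
    open ℚ.≤-Reasoning
    double : ⟦ (2 ℕ.* suc u) ℕ.^ b ⟧ ≡ ⟦ 2 ℕ.^ b ⟧ ℚ.* ⟦ suc u ℕ.^ b ⟧
    double = trans (⟦⟧-^ (2 ℕ.* suc u) b) (trans (cong (_^ℚ b) (⟦⟧-* 2 (suc u)))
      (trans (^-distrib-* ⟦ 2 ⟧ ⟦ suc u ⟧ b) (cong₂ ℚ._*_ (sym (⟦⟧-^ 2 b)) (sym (⟦⟧-^ (suc u) b)))))

-- If κ y ≤ T^a, then K^a ≥ (T^b q)^a ≥ κ^b y^b q^a ≥ κ/2 = K^a + 1, which is absurd; κ is chosen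
-- for this last equality.
large-y : ∀ a b-1 {q y T K} → let b = suc b-1 ; κ = ⟦ 2 ⟧ ℚ.* (K ^ℚ a ℚ.+ 1ℚ) in
  0ℚ ℚ.≤ q → 0ℚ ℚ.≤ y → 0ℚ ℚ.≤ T → 0ℚ ℚ.≤ K → T ^ℚ b ℚ.* q ℚ.≤ K → ½ ℚ.≤ y ^ℚ b ℚ.* q ^ℚ a → T ^ℚ a ℚ.≤ κ ℚ.* y
large-y a b-1 {q} {y} {T} {K} 0≤q 0≤y 0≤T 0≤K Tq≤K ½≤ = case ℚ.≤-total (T ^ℚ a) (κ ℚ.* y) of λ
  { (inj₁ le) → le
  ; (inj₂ κy≤) → contradiction (ℚ.≤-trans (K+1≤ κy≤) (ℚ.≤-reflexive (sym (ℚ.+-identityʳ (K ^ℚ a)))))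
      λ le → ℚ.<-irrefl refl (ℚ.<-≤-trans (from-yes (0ℚ ℚ.<? 1ℚ)) (cancel le)) }
  where
  b : ℕ
  b = suc b-1
  κ : ℚ
  κ = ⟦ 2 ⟧ ℚ.* (K ^ℚ a ℚ.+ 1ℚ)
  open ℚ.≤-Reasoning
  cancel : K ^ℚ a ℚ.+ 1ℚ ℚ.≤ K ^ℚ a ℚ.+ 0ℚ → 1ℚ ℚ.≤ 0ℚ
  cancel le = subst₂ ℚ._≤_ (solve 1 (λ k → (:- k) :+ (k :+ con 1ℚ) := con 1ℚ) refl (K ^ℚ a))
    (solve 1 (λ k → (:- k) :+ (k :+ con 0ℚ) := con 0ℚ) refl (K ^ℚ a)) (ℚ.+-monoʳ-≤ (ℚ.- (K ^ℚ a)) le)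
  1≤κ : 1ℚ ℚ.≤ κ
  1≤κ = ℚ.≤-trans (from-yes (1ℚ ℚ.≤? ⟦ 2 ⟧ ℚ.* (0ℚ ℚ.+ 1ℚ)))
    (*-monoˡ ⟦ 2 ⟧ (0≤⟦⟧ 2) (ℚ.+-monoˡ-≤ 1ℚ (0≤^ a 0≤K)))
  0≤κ : 0ℚ ℚ.≤ κ
  0≤κ = ℚ.≤-trans 0≤1 1≤κ
  K+1≤ : κ ℚ.* y ℚ.≤ T ^ℚ a → K ^ℚ a ℚ.+ 1ℚ ℚ.≤ K ^ℚ a
  K+1≤ κy≤ = begin
    K ^ℚ a ℚ.+ 1ℚ
      ≡⟨ solve 1 (λ k → k :+ con 1ℚ := con ⟦ 2 ⟧ :* (k :+ con 1ℚ) :* con 1ℚ :* con ½) refl (K ^ℚ a) ⟩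
    κ ℚ.* 1ℚ ℚ.* ½                           ≡⟨ cong (λ u → κ ℚ.* u ℚ.* ½) (1^ b-1) ⟨
    κ ℚ.* 1ℚ ^ℚ b-1 ℚ.* ½
      ≤⟨ *-mono (0≤* 0≤κ (0≤^ b-1 0≤1)) (*-monoˡ κ 0≤κ (^-mono b-1 0≤1 1≤κ)) (from-yes (0ℚ ℚ.≤? ½)) ½≤ ⟩
    κ ^ℚ b ℚ.* (y ^ℚ b ℚ.* q ^ℚ a)           ≡⟨ ℚ.*-assoc (κ ^ℚ b) (y ^ℚ b) (q ^ℚ a) ⟨
    κ ^ℚ b ℚ.* y ^ℚ b ℚ.* q ^ℚ a             ≡⟨ cong (ℚ._* q ^ℚ a) (^-distrib-* κ y b) ⟨
    (κ ℚ.* y) ^ℚ b ℚ.* q ^ℚ a                ≤⟨ *-monoʳ (q ^ℚ a) (0≤^ a 0≤q) (^-mono b (0≤* 0≤κ 0≤y) κy≤) ⟩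
    (T ^ℚ a) ^ℚ b ℚ.* q ^ℚ a
      ≡⟨ cong (ℚ._* q ^ℚ a) (trans (sym (^-*-assoc T b a)) (trans (cong (T ^ℚ_) (ℕ.*-comm b a)) (^-*-assoc T a b))) ⟩
    (T ^ℚ b) ^ℚ a ℚ.* q ^ℚ a                 ≡⟨ ^-distrib-* (T ^ℚ b) q a ⟨
    (T ^ℚ b ℚ.* q) ^ℚ a                      ≤⟨ ^-mono a (0≤* (0≤^ b 0≤T) 0≤q) Tq≤K ⟩
    K ^ℚ a                                   ∎

1≤x+½⇒½≤x : ∀ {x} → 1ℚ ℚ.≤ x ℚ.+ ½ → ½ ℚ.≤ x
1≤x+½⇒½≤x {x} le = ≤-from-diff (ℚ.≤-trans (0≤y-x le)
  (ℚ.≤-reflexive (solve 1 (λ x → x :+ con ½ :- con 1ℚ := x :- con ½) refl x)))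

-- The strategy is fixed before q: p is known only through its approximations, and one strategy has
-- to serve all late terms.
Winnable : Graph → (a b c : ℕ) → Set
Winnable H a b c = ∀ u ρ → 0ℚ ℚ.≤ ρ → ⟦ suc u ℕ.^ b ⟧ ℚ.* ρ ≡ 1ℚ → ∃ λ N → N ℕ.≤ c ℕ.* suc u ℕ.^ a ×
  ∃ λ (σ : Strategy [] N) → ∀ q → ρ ℚ.≤ q → q ℚ.≤ 1ℚ → 1ℚ ℚ.≤ prob H q σ ℚ.+ ½

upperConstant : (a b c : ℕ) → ℚ
upperConstant a b c = ⟦ c ⟧ ℚ.* (⟦ 2 ⟧ ℚ.* (⟦ 3 ℕ.* 2 ℕ.^ b ⟧ ^ℚ a ℚ.+ 1ℚ))

-- t = suc u and ρ = 1/t^b, where t^b is 1/p up to a constant factor.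
Scale : ℝ → ℕ → Set
Scale p b = ∃₂ λ u ρ → 0ℚ ℚ.≤ ρ × ⟦ suc u ℕ.^ b ⟧ ℚ.* ρ ≡ 1ℚ ×
  Eventually (λ n → ρ ℚ.≤ seq p n × seq p n ℚ.≤ 1ℚ × ⟦ suc u ℕ.^ b ⟧ ℚ.* seq p n ℚ.≤ ⟦ 3 ℕ.* 2 ℕ.^ b ⟧)

-- Take r to be half of a late term of p. Later terms differ from 2r by at most r, so they lie
-- between r and 3r.
scale : ∀ b-1 p → 0ℝ < p → p < 1ℝ → Scale p (suc b-1)
scale b-1 p (ε₀ , 0<ε₀ , N₀ , ε₀≤p) p<1 = from-approximation (½ ℚ.* seq p M) 0<r approx
  where
  b N₁ M : ℕ
  b = suc b-1
  0<½ε₀ : 0ℚ ℚ.< ½ ℚ.* ε₀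
  0<½ε₀ = ℚ.positive⁻¹ (½ ℚ.* ε₀) {{ℚ.pos*pos⇒pos ½ ε₀ {{ℚ.positive 0<ε₀}}}}
  N₁ = proj₁ (cauchy p (½ ℚ.* ε₀) 0<½ε₀)
  M = N₀ ℕ.⊔ N₁
  ½ε₀≤r : ½ ℚ.* ε₀ ℚ.≤ ½ ℚ.* seq p M
  ½ε₀≤r = *-monoˡ ½ (from-yes (0ℚ ℚ.≤? ½)) (ℚ.≤-trans (ℚ.≤-reflexive (sym (ℚ.+-identityˡ ε₀)))
    (ε₀≤p M (ℕ.m≤m⊔n N₀ N₁)))
  0<r : 0ℚ ℚ.< ½ ℚ.* seq p M
  0<r = ℚ.<-≤-trans 0<½ε₀ ½ε₀≤r
  approx : Eventually (λ n → ½ ℚ.* seq p M ℚ.≤ seq p n × seq p n ℚ.≤ ⟦ 3 ⟧ ℚ.* (½ ℚ.* seq p M))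
  approx = M , λ n M≤n →
    let close = ℚ.≤-trans (proj₂ (cauchy p (½ ℚ.* ε₀) 0<½ε₀) n M (ℕ.≤-trans (ℕ.m≤n⊔m N₀ N₁) M≤n) (ℕ.m≤n⊔m N₀ N₁)) ½ε₀≤r
    in ≤-from-diff (ℚ.≤-trans (0≤y-x (∣-∣⇒≥ {seq p n} {seq p M} close)) (ℚ.≤-reflexive
         (solve 2 (λ x a → x :+ con ½ :* a :- a := x :- con ½ :* a) refl (seq p n) (seq p M)))) ,
       ℚ.≤-trans (∣-∣⇒≤ {seq p n} {seq p M} close) (ℚ.≤-reflexive
         (solve 1 (λ a → a :+ con ½ :* a := con ⟦ 3 ⟧ :* (con ½ :* a)) refl (seq p M)))
  from-approximation : ∀ r → 0ℚ ℚ.< r → Eventually (λ n → r ℚ.≤ seq p n × seq p n ℚ.≤ ⟦ 3 ⟧ ℚ.* r) →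
    Scale p b
  from-approximation r 0<r approx = from-minimal (minimal (proj₁ some-large) (proj₂ some-large))
    where
    open Root b-1 r 0<r using (Minimal; minimal; some-large; minimal-bound; minimal-large)
    from-minimal : ∃ Minimal → Scale p b
    from-minimal (u , min) = from-reciprocal (reciprocal (suc u ℕ.^ b) {{ℕ.m^n≢0 (suc u) b}})
      where
      from-reciprocal : ∃ (λ ρ → 0ℚ ℚ.≤ ρ × ⟦ suc u ℕ.^ b ⟧ ℚ.* ρ ≡ 1ℚ) → Scale p b
      from-reciprocal (ρ , 0≤ρ , tρ≡1) = u , ρ , 0≤ρ , tρ≡1 , map-ev (λ ((r≤ , ≤3r) , ≤1) →
          ℚ.≤-trans ρ≤r r≤ , ≤1 , minimal-bound u min (ℚ.≤-trans (ℚ.<⇒≤ 0<r) r≤) ≤1 ≤3r)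
          (approx ∧-ev eventually-<1 {p} p<1)
        where
        ρ≤r : ρ ℚ.≤ r
        ρ≤r = begin
          ρ                                       ≡⟨ ℚ.*-identityˡ ρ ⟨
          1ℚ ℚ.* ρ                                ≤⟨ *-monoʳ ρ 0≤ρ (minimal-large u min) ⟩
          r ℚ.* ⟦ suc u ℕ.^ b ⟧ ℚ.* ρ             ≡⟨ ℚ.*-assoc r ⟦ suc u ℕ.^ b ⟧ ρ ⟩
          r ℚ.* (⟦ suc u ℕ.^ b ⟧ ℚ.* ρ)           ≡⟨ cong (r ℚ.*_) tρ≡1 ⟩
          r ℚ.* 1ℚ                                ≡⟨ ℚ.*-identityʳ r ⟩
          r                                       ∎
          where open ℚ.≤-Reasoning

succeeds : ∀ {H p N} ρ (σ : Strategy [] N) → (∀ q → ρ ℚ.≤ q → q ℚ.≤ 1ℚ → 1ℚ ℚ.≤ prob H q σ ℚ.+ ½) →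
  Eventually (λ n → ρ ℚ.≤ seq p n × seq p n ℚ.≤ 1ℚ) → fromℚ ½ ≤ successProb H p σ
succeeds {H} {p} ρ σ wins (M , ev) ε 0<ε = M , λ n M≤n →
  let ρ≤q , q≤1 = ev n M≤n
      1≤P = subst (λ P → 1ℚ ℚ.≤ P ℚ.+ ½) (sym (seq-prob H p σ n)) (wins (seq p n) ρ≤q q≤1)
  in ℚ.≤-trans (1≤x+½⇒½≤x {seq (successProb H p σ) n} 1≤P) (x≤x+y (seq (successProb H p σ) n) (ℚ.<⇒≤ 0<ε))

upper-bound : ∀ {H} a b-1 c → Winnable H a (suc b-1) c →
  ∀ p → 0ℝ < p → p < 1ℝ → ∀ y → y Is p ^- a / suc b-1 → f[ H , p ]≤ (fromℚ (upperConstant a (suc b-1) c) * y)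
upper-bound {H} a b-1 c winnable p 0<p p<1 y (0<y , y^b*p^a≈1) = from-scale (scale b-1 p 0<p p<1)
  where
  b : ℕ
  b = suc b-1
  κ : ℚ
  κ = ⟦ 2 ⟧ ℚ.* (⟦ 3 ℕ.* 2 ℕ.^ b ⟧ ^ℚ a ℚ.+ 1ℚ)
  from-scale : Scale p b → f[ H , p ]≤ (fromℚ (upperConstant a b c) * y)
  from-scale (u , ρ , 0≤ρ , tρ≡1 , ev) = from-strategy (winnable u ρ 0≤ρ tρ≡1)
    where
    t : ℕ
    t = suc u
    from-strategy : (∃ λ N → N ℕ.≤ c ℕ.* t ℕ.^ a × ∃ λ (σ : Strategy [] N) →
        ∀ q → ρ ℚ.≤ q → q ℚ.≤ 1ℚ → 1ℚ ℚ.≤ prob H q σ ℚ.+ ½) → f[ H , p ]≤ (fromℚ (upperConstant a b c) * y)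
    from-strategy (N , N≤ , σ , wins) = N ,
        (σ , succeeds {H} {p} ρ σ wins (map-ev (λ (ρ≤ , ≤1 , _) → ρ≤ , ≤1) ev)) ,
        λ ε 0<ε → map-ev (λ {n} h → ℚ.≤-trans (bound n h) (x≤x+y (⟦ c ⟧ ℚ.* κ ℚ.* seq y n) (ℚ.<⇒≤ 0<ε)))
          (ev ∧-ev eventually-positive {y} 0<y ∧-ev y^b*p^a≈1 ½ (from-yes (0ℚ ℚ.<? ½)))
      where
      bound : ∀ n → (ρ ℚ.≤ seq p n × seq p n ℚ.≤ 1ℚ × ⟦ t ℕ.^ b ⟧ ℚ.* seq p n ℚ.≤ ⟦ 3 ℕ.* 2 ℕ.^ b ⟧) × 0ℚ ℚ.≤ seq y n ×
              ℚ.∣ seq (y ^ b * p ^ a) n ℚ.- 1ℚ ∣ ℚ.≤ ½ → ⟦ N ⟧ ℚ.≤ ⟦ c ⟧ ℚ.* κ ℚ.* seq y n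
      bound n ((ρ≤ , ≤1 , tq≤) , 0≤y , close) = begin
        ⟦ N ⟧                          ≤⟨ ⟦⟧-mono N≤ ⟩
        ⟦ c ℕ.* t ℕ.^ a ⟧              ≡⟨ trans (⟦⟧-* c (t ℕ.^ a)) (cong (⟦ c ⟧ ℚ.*_) (⟦⟧-^ t a)) ⟩
        ⟦ c ⟧ ℚ.* ⟦ t ⟧ ^ℚ a           ≤⟨ *-monoˡ ⟦ c ⟧ (0≤⟦⟧ c) (large-y a b-1 (ℚ.≤-trans 0≤ρ ρ≤) 0≤y (0≤⟦⟧ t)
                                             (0≤⟦⟧ (3 ℕ.* 2 ℕ.^ b)) (subst (λ w → w ℚ.* seq p n ℚ.≤ _) (⟦⟧-^ t b) tq≤) ½≤) ⟩
        ⟦ c ⟧ ℚ.* (κ ℚ.* seq y n)      ≡⟨ ℚ.*-assoc ⟦ c ⟧ κ (seq y n) ⟨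
        ⟦ c ⟧ ℚ.* κ ℚ.* seq y n        ∎
        where
        open ℚ.≤-Reasoning
        ½≤ : ½ ℚ.≤ seq y n ^ℚ b ℚ.* seq p n ^ℚ a
        ½≤ = ℚ.≤-trans (1≤x+½⇒½≤x {seq (y ^ b * p ^ a) n} (∣-∣⇒≥ {seq (y ^ b * p ^ a) n} {1ℚ} close))
          (ℚ.≤-reflexive (cong₂ ℚ._*_ (seq-^ y b n) (seq-^ p a n)))

0<fromℚ : ∀ {x} → 0ℚ ℚ.< x → 0ℝ < fromℚ x
0<fromℚ {x} 0<x = x , 0<x , 0 , λ _ _ → ℚ.≤-reflexive (ℚ.+-identityˡ x)

-- Both bounds combined, and the three cliques.

theta : ∀ {H} a b-1 r c-1 →
  (∀ q → 0ℚ ℚ.≤ q → q ℚ.≤ 1ℚ → ∀ {n} (σ : Strategy [] n) →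
     prob H q σ ℚ.≤ ⟦ n ⟧ ^ℚ (suc r ℕ.* suc b-1) ℚ.* q ^ℚ (suc r ℕ.* a)) →
  Winnable H a (suc b-1) (suc c-1) → f[ H ,p]=Θ[p^- a / suc b-1 ]
theta a b-1 r c-1 bound winnable =
  fromℚ ⅛ , fromℚ C , 0<fromℚ 0<⅛ , 0<fromℚ (ℚ.<-≤-trans (from-yes (0ℚ ℚ.<? 1ℚ)) 1≤C) , λ p 0<p p<1 y y-is →
    lower-bound a b-1 r bound p 0<p p<1 y y-is , upper-bound a b-1 (suc c-1) winnable p 0<p p<1 y y-is
  where
  b : ℕ
  b = suc b-1
  C : ℚ
  C = upperConstant a b (suc c-1)
  1≤C : 1ℚ ℚ.≤ C
  1≤C = ℚ.≤-trans (from-yes (1ℚ ℚ.≤? ⟦ 1 ⟧ ℚ.* (⟦ 2 ⟧ ℚ.* (0ℚ ℚ.+ 1ℚ))))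
    (*-mono (0≤⟦⟧ 1) (⟦⟧-mono {1} {suc c-1} (ℕ.s≤s ℕ.z≤n)) (from-yes (0ℚ ℚ.≤? ⟦ 2 ⟧ ℚ.* (0ℚ ℚ.+ 1ℚ)))
      (*-monoˡ ⟦ 2 ⟧ (0≤⟦⟧ 2) (ℚ.+-monoˡ-≤ 1ℚ (0≤^ a (0≤⟦⟧ (3 ℕ.* 2 ℕ.^ b))))))

copy-bound : ∀ {m s k} → KeyChoice m s k → ∀ q → 0ℚ ℚ.≤ q → q ℚ.≤ 1ℚ → ∀ {n} (σ : Strategy [] n) →
             prob (K m) q σ ℚ.≤ ⟦ n ⟧ ^ℚ s ℚ.* q ^ℚ k
copy-bound {m} {s} {k} choice q 0≤q q≤1 σ = Supermartingale.prob≤ (K m) s k (clique-certificate choice) q 0≤q q≤1 σ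

winnable₃ : Winnable (K 3) 3 2 90
winnable₃ u ρ 0≤ρ tρ≡1 = _ , turns₃ u , wins
  where open Triangle u ρ 0≤ρ (trans (cong (λ k → ⟦ suc u ℕ.* k ⟧ ℚ.* ρ) (sym (ℕ.*-identityʳ (suc u)))) tρ≡1)

winnable₄ : Winnable (K 4) 2 1 348
winnable₄ u ρ 0≤ρ tρ≡1 = _ , turns₄ u , wins
  where open Tetrahedron u ρ 0≤ρ (trans (cong (λ k → ⟦ k ⟧ ℚ.* ρ) (sym (ℕ.*-identityʳ (suc u)))) tρ≡1)

winnable₅ : Winnable (K 5) 8 3 4608
winnable₅ u ρ 0≤ρ tρ≡1 = _ , turns₅ u , wins
  where open Pentatope u ρ 0≤ρ (trans (cong (λ k → ⟦ k ⟧ ℚ.* ρ) (trans (ℕ.*-assoc (suc u) (suc u) (suc u))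
               (cong (λ k → suc u ℕ.* (suc u ℕ.* k)) (sym (ℕ.*-identityʳ (suc u)))))) tρ≡1)

theorem13 : f[ K 3 ,p]=Θ[p^- 3 / 2 ] × f[ K 4 ,p]=Θ[p^- 2 / 1 ] × f[ K 5 ,p]=Θ[p^- 8 / 3 ]
-- The third argument is 1 for K_4 because (s, k) = (2, 4) is twice (b, a) = (1, 2); the last number
-- is one less than the constant in the turn count.
theorem13 = theta 3 1 0 89 (copy-bound choice₃) winnable₃ ,
            theta 2 0 1 347 (copy-bound choice₄) winnable₄ ,
            theta 8 2 0 4607 (copy-bound choice₅) winnable₅
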